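{- Let $n\ge 4$ and let $W_n$ be the wheel graph on $n$ vertices. Then \[ M_2(W_n)\simeq\begin{cases} S^2\vee S^2\vee S^2 & n=4,\\ S^3\vee S^3 & n=5,\\ \text{a point} & n\ge 6.\end{cases} \]
   Context: The wheel graph $W_n$ on $n$ vertices is obtained from a cycle on $n-1$ vertices by adding one new vertex adjacent to every vertex of the cycle. A $2$-matching of a graph $G$ is a set of edges $H\subseteq E(G)$ such that every vertex has degree at most $2$ in $H$. The $2$-matching complex $M_2(G)$ is the simplicial complex whose vertices are the edges of $G$ and whose faces are the $2$-matchings of $G$. $\simeq$ denotes homotopy equivalence. -}

module Defs where

open import Algebra.Apartness.Bundles using (HeytingField; HeytingCommutativeRing)
open import Algebra.Bundles using (CommutativeRing)
import Algebra.Properties.CommutativeMonoid.Sum as Sum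
import Algebra.Properties.Monoid.Mult as Mult
open import Data.Bool.Base using (_∨_)
open import Data.Empty using (⊥-elim)
open import Data.Fin.Base using (Fin; zero; suc; toℕ; splitAt; join)
open import Data.Fin.Properties
  using (_≟_; toℕ<n; toℕ-fromℕ<; suc-injective; join-splitAt; +↔⊎)
open import Data.Fin.Subset using (Subset; _∈_; _⊆_; _∩_; ⁅_⁆; ∣_∣)
open import Data.Fin.Subset.Properties
  using (p⊆q⇒∣p∣≤∣q∣; p∩q⊆p; p∩q⊆q; x∈p∩q⁺; ∣⁅x⁆∣≡1)
open import Data.Nat.Base as ℕ using (ℕ; zero; suc; s≤s; z≤n)
open import Data.Nat.DivMod using (_%_; _mod_; m%n<n; m<n⇒m%n≡m; n%n≡0)
import Data.Nat.Properties as ℕₚ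
open import Data.Product.Base using (Σ; ∃; _×_; _,_; proj₁; proj₂; map; swap)
open import Data.Sum.Base using (_⊎_; inj₁; inj₂; [_,_]′)
open import Data.Sum.Function.Propositional using (_⊎-↔_)
open import Data.Unit.Base using (⊤)
open import Data.Vec.Base using (tabulate)
open import Data.Vec.Functional using (_∷_; replicate)
open import Function.Base using (_∘_; id)
open import Function.Bundles using (_↔_; _⇔_)
open import Function.Construct.Composition using (_↔-∘_)
open import Function.Construct.Identity using (↔-id)
open import Function.Construct.Symmetry using (↔-sym)
open import Level using (0ℓ)
open import Relation.Binary.Core using (Rel)
open import Relation.Binary.Lattice.Definitions using (Supremum)
open import Relation.Binary.PropositionalEquality
  using (_≡_; _≢_; refl; sym; trans; cong; cong₂; subst)
open import Relation.Binary.Structures using (IsStrictPartialOrder)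
open import Relation.Nullary.Decidable using (does)
open import Relation.Nullary.Negation using (¬_)

SameEnds : {A : Set} → Rel (A × A) 0ℓ
SameEnds p q = p ≡ q ⊎ p ≡ swap q

-- Finite simple graphs, with vertex set Fin order and edge set Fin size.
-- The orientation given by ends has no meaning.
record Graph : Set where
  field
    order    : ℕ
    size     : ℕ
    ends     : Fin size → Fin order × Fin order
    loopless : ∀ e → proj₁ (ends e) ≢ proj₂ (ends e)
    simple   : ∀ e f → SameEnds (ends e) (ends f) → e ≡ f

next : ∀ {k} → Fin k → Fin k
next {suc k} i = suc (toℕ i) mod suc k

toℕ-next : ∀ {k} (i : Fin k) →
           toℕ (next i) ≡ suc (toℕ i) ⊎ (suc (toℕ i) ≡ k × toℕ (next i) ≡ 0)
toℕ-next {suc k} i with ℕₚ.m≤n⇒m<n∨m≡n (toℕ<n i)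
... | inj₁ i+1<k = inj₁ (trans (toℕ-fromℕ< (m%n<n (suc (toℕ i)) (suc k))) (m<n⇒m%n≡m i+1<k))
... | inj₂ i+1≡k = inj₂ (i+1≡k , trans (toℕ-fromℕ< (m%n<n (suc (toℕ i)) (suc k)))
                                       (trans (cong (_% suc k) i+1≡k) (n%n≡0 (suc k))))

next-≢ : ∀ {k} → 3 ℕ.≤ k → (i : Fin k) → i ≢ next i
next-≢ 3≤k i i≡next with toℕ-next i
... | inj₁ eq = ℕₚ.1+n≢n (trans (sym eq) (cong toℕ (sym i≡next)))
... | inj₂ (i+1≡k , eq) with trans (cong toℕ i≡next) eq
...   | i≡0 with subst (3 ℕ.≤_) (trans (sym i+1≡k) (cong suc i≡0)) 3≤k
...     | s≤s ()

next²-≢ : ∀ {k} → 3 ℕ.≤ k → (i : Fin k) → i ≢ next (next i)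
next²-≢ 3≤k i i≡next² with toℕ-next i | toℕ-next (next i) | cong toℕ i≡next²
... | inj₁ p | inj₁ q | r =
  ℕₚ.m≢1+m+n (toℕ i) {1} (trans r (trans q (trans (cong suc p) (cong suc (sym (ℕₚ.+-comm (toℕ i) 1))))))
... | inj₁ p | inj₂ (s , q) | r with subst (3 ℕ.≤_) (trans (sym s) (cong suc (trans p (cong suc (trans r q))))) 3≤k
...   | s≤s (s≤s ())
next²-≢ 3≤k i i≡next² | inj₂ (s , p) | inj₁ q | r
  with subst (3 ℕ.≤_) (trans (sym s) (cong suc (trans r (trans q (cong suc p))))) 3≤k
...   | s≤s (s≤s ())
next²-≢ 3≤k i i≡next² | inj₂ (s , p) | inj₂ (s′ , q) | r
  with subst (3 ℕ.≤_) (trans (sym s) (cong suc (trans r q))) 3≤k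
...   | s≤s ()

cycle : (k : ℕ) → 3 ℕ.≤ k → Graph
cycle k 3≤k = record
  { order    = k
  ; size     = k
  ; ends     = λ i → i , next i
  ; loopless = next-≢ 3≤k
  ; simple   = λ where
      i j (inj₁ eq) → cong proj₁ eq
      i j (inj₂ eq) → ⊥-elim (next²-≢ 3≤k i
        (trans (cong proj₁ eq) (cong next (sym (cong proj₂ eq)))))
  }

-- A new vertex zero is joined to every vertex of G: the edges are those of G
-- together with one edge from zero to each vertex of G.
cone : Graph → Graph
cone G = record
  { order    = suc order
  ; size     = size ℕ.+ order
  ; ends     = ends′ ∘ splitAt size
  ; loopless = loopless′ ∘ splitAt size
  ; simple   = λ e f same → trans (sym (join-splitAt size order e)) (trans
                 (cong (join size order) (simple′ (splitAt size e) (splitAt size f) same))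
                 (join-splitAt size order f))
  }
  where
  open Graph G

  ends′ : Fin size ⊎ Fin order → Fin (suc order) × Fin (suc order)
  ends′ (inj₁ e) = map suc suc (ends e)
  ends′ (inj₂ v) = zero , suc v

  loopless′ : ∀ e → proj₁ (ends′ e) ≢ proj₂ (ends′ e)
  loopless′ (inj₁ e) eq = loopless e (suc-injective eq)
  loopless′ (inj₂ v) ()

  simple′ : ∀ e f → SameEnds (ends′ e) (ends′ f) → e ≡ f
  simple′ (inj₁ e) (inj₁ f) (inj₁ eq) = cong inj₁ (simple e f (inj₁
    (cong₂ _,_ (suc-injective (cong proj₁ eq)) (suc-injective (cong proj₂ eq)))))
  simple′ (inj₁ e) (inj₁ f) (inj₂ eq) = cong inj₁ (simple e f (inj₂
    (cong₂ _,_ (suc-injective (cong proj₁ eq)) (suc-injective (cong proj₂ eq)))))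
  simple′ (inj₁ e) (inj₂ v) (inj₁ ())
  simple′ (inj₁ e) (inj₂ v) (inj₂ ())
  simple′ (inj₂ v) (inj₁ e) (inj₁ ())
  simple′ (inj₂ v) (inj₁ e) (inj₂ ())
  simple′ (inj₂ v) (inj₂ w) (inj₁ eq) = cong inj₂ (suc-injective (cong proj₂ eq))
  simple′ (inj₂ v) (inj₂ w) (inj₂ ())

wheel : (n : ℕ) → 4 ℕ.≤ n → Graph
wheel (suc k) (s≤s 3≤k) = cone (cycle k 3≤k)

record SimplicialComplex : Set₁ where
  field
    #vertices : ℕ
    Face      : Subset #vertices → Set
    down      : ∀ {σ τ} → σ ⊆ τ → Face τ → Face σ
    vertex    : ∀ v → Face ⁅ v ⁆

module _ (G : Graph) where
  open Graph G

  incident : Fin order → Subset size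
  incident v = tabulate λ e → does (proj₁ (ends e) ≟ v) ∨ does (proj₂ (ends e) ≟ v)

  degree : Subset size → Fin order → ℕ
  degree H v = ∣ H ∩ incident v ∣

  Is2Matching : Subset size → Set
  Is2Matching H = ∀ v → degree H v ℕ.≤ 2

  M₂ : SimplicialComplex
  M₂ = record
    { #vertices = size
    ; Face      = Is2Matching
    ; down      = λ {σ} {τ} σ⊆τ τ-matching v → ℕₚ.≤-trans
        (p⊆q⇒∣p∣≤∣q∣ λ x∈ → x∈p∩q⁺
          (σ⊆τ (p∩q⊆p σ (incident v) x∈) , p∩q⊆q σ (incident v) x∈))
        (τ-matching v)
    ; vertex    = λ e v → ℕₚ.≤-trans
        (p⊆q⇒∣p∣≤∣q∣ (p∩q⊆p ⁅ e ⁆ (incident v)))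
        (ℕₚ.≤-trans (ℕₚ.≤-reflexive (∣⁅x⁆∣≡1 e)) (s≤s z≤n))
    }

-- A Cauchy-complete Archimedean ordered field, in the constructive sense: the
-- usual total order is replaced by a strict order whose symmetrisation is the
-- apartness relation of a Heyting field (hence x < z implies x < y or y < z),
-- and binary maxima are part of the structure.  Classically this determines
-- the ordered field of real numbers up to unique isomorphism; constructively,
-- the Cauchy reals over ℚ are a model.
record RealField : Set₁ where
  field
    heytingField : HeytingField 0ℓ 0ℓ 0ℓ

  open HeytingField heytingField public
    using (_≈_; _#_; _+_; _*_; -_; _-_; 0#; 1#; heytingCommutativeRing)
    renaming (Carrier to ℝ)

  open HeytingCommutativeRing heytingCommutativeRing public using (commutativeRing)

  private module R = CommutativeRing commutativeRing

  open Sum R.+-commutativeMonoid public using (sum)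
  open Mult R.+-monoid public using () renaming (_×_ to _·_)

  infix 4 _<_ _≤_
  infixl 6 _⊔_

  field
    _<_                    : Rel ℝ 0ℓ
    <-isStrictPartialOrder : IsStrictPartialOrder _≈_ _<_
    #⇔<⊎>                  : ∀ {x y} → x # y ⇔ (x < y ⊎ y < x)
    0<1                    : 0# < 1#
    +-monoʳ-<              : ∀ z {x y} → x < y → z + x < z + y
    *-pos                  : ∀ {x y} → 0# < x → 0# < y → 0# < x * y
    archimedean            : ∀ x → ∃ λ n → x < n · 1#

  _≤_ : Rel ℝ 0ℓ
  x ≤ y = ¬ (y < x)

  field
    _⊔_        : ℝ → ℝ → ℝ
    ⊔-supremum : Supremum _≤_ _⊔_

  -- Within ε x y says |x − y| < ε.
  Within : ℝ → Rel ℝ 0ℓ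
  Within ε x y = x - y < ε × y - x < ε

  Cauchy : (ℕ → ℝ) → Set
  Cauchy s = ∀ ε → 0# < ε → ∃ λ N → ∀ m n → N ℕ.≤ m → N ℕ.≤ n → Within ε (s m) (s n)

  _ConvergesTo_ : (ℕ → ℝ) → ℝ → Set
  s ConvergesTo l = ∀ ε → 0# < ε → ∃ λ N → ∀ n → N ℕ.≤ n → Within ε (s n) l

  field
    complete : ∀ s → Cauchy s → ∃ λ l → s ConvergesTo l

module Topology (R : RealField) where
  open RealField R
  private module R = CommutativeRing commutativeRing

  -- A subspace of the finite-dimensional Euclidean space ℝ^Coord.
  record Space : Set₁ where
    field
      Coord  : Set
      finite : ∃ λ n → Coord ↔ Fin n
      In     : (Coord → ℝ) → Set

  open Space

  Point : Space → Set
  Point X = Σ (Coord X → ℝ) (In X)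

  module _ (X : Space) where

    Eq : Rel (Point X) 0ℓ
    Eq x y = ∀ i → proj₁ x i ≈ proj₁ y i

    -- The ε-balls of the maximum norm, which generate the Euclidean topology.
    Near : ℝ → Rel (Point X) 0ℓ
    Near ε x y = ∀ i → Within ε (proj₁ x i) (proj₁ y i)

  -- Continuity implies that a map sends equal points to equal points, and in
  -- particular that its values do not depend on the proofs of membership.
  Continuous : (X Y : Space) → (Point X → Point Y) → Set
  Continuous X Y f = ∀ x ε → 0# < ε →
    ∃ λ δ → 0# < δ × (∀ y → Near X δ x y → Near Y ε (f x) (f y))

  record Map (X Y : Space) : Set where
    field
      fun        : Point X → Point Y
      continuous : Continuous X Y fun

  open Map

  infixr 2 _×ˢ_
  _×ˢ_ : Space → Space → Space
  X ×ˢ Y = record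
    { Coord  = Coord X ⊎ Coord Y
    ; finite = _ , ↔-sym +↔⊎ ↔-∘ (proj₂ (finite X) ⊎-↔ proj₂ (finite Y))
    ; In     = λ z → In X (z ∘ inj₁) × In Y (z ∘ inj₂)
    }

  pair : (X Y : Space) → Point X → Point Y → Point (X ×ˢ Y)
  pair X Y (x , x∈X) (y , y∈Y) = [ x , y ]′ , x∈X , y∈Y

  interval : Space
  interval = record
    { Coord  = Fin 1
    ; finite = 1 , ↔-id _
    ; In     = λ t → 0# ≤ t zero × t zero ≤ 1#
    }

  private module < = IsStrictPartialOrder <-isStrictPartialOrder

  start end : Point interval
  start = (λ _ → 0#) , <.irrefl R.refl , <.asym 0<1
  end   = (λ _ → 1#) , <.asym 0<1 , <.irrefl R.refl

  record Homotopy (X Y : Space) (f g : Point X → Point Y) : Set where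
    field
      homotopy : Map (X ×ˢ interval) Y
      at-start : ∀ x → Eq Y (fun homotopy (pair X interval x start)) (f x)
      at-end   : ∀ x → Eq Y (fun homotopy (pair X interval x end)) (g x)

  infix 1 _≃_
  record _≃_ (X Y : Space) : Set where
    field
      to      : Map X Y
      from    : Map Y X
      from∘to : Homotopy X X (fun from ∘ fun to) id
      to∘from : Homotopy Y Y (fun to ∘ fun from) id

  -- Barycentric coordinates: nonnegative weights of total 1 on the vertices,
  -- whose support is a face.  Faces being closed under subsets, the last
  -- condition is stated as: every set of vertices of positive weight is a face.
  ∥_∥ : SimplicialComplex → Space
  ∥ K ∥ = record
    { Coord  = Fin #vertices
    ; finite = _ , ↔-id _
    ; In     = λ x → (∀ v → 0# ≤ x v)
                   × sum x ≈ 1#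
                   × (∀ σ → (∀ {v} → v ∈ σ → 0# < x v) → Face σ)
    }
    where open SimplicialComplex K

  point : Space
  point = record
    { Coord  = Fin 0
    ; finite = 0 , ↔-id _
    ; In     = λ _ → ⊤
    }

  sphere : ℕ → Space
  sphere d = record
    { Coord  = Fin (suc d)
    ; finite = suc d , ↔-id _
    ; In     = λ x → sum (λ i → x i * x i) ≈ 1#
    }

  record PointedSpace : Set₁ where
    field
      space     : Space
      basepoint : Point space

  open PointedSpace public

  𝕊 : ℕ → PointedSpace
  𝕊 d = record
    { space     = sphere d
    ; basepoint = 1# ∷ replicate d 0# , R.trans (R.+-cong (R.*-identityˡ 1#) (zeros d)) (R.+-identityʳ 1#)
    }
    where
    zeros : ∀ n → sum (λ (_ : Fin n) → 0# * 0#) ≈ 0#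
    zeros zero    = R.refl
    zeros (suc n) = R.trans (R.+-cong (R.zeroˡ 0#) (zeros n)) (R.+-identityˡ 0#)

  -- The wedge as the subspace X × {y₀} ∪ {x₀} × Y of the product.  The
  -- disjunction is the classical one: the two copies of the spaces must be
  -- glued into a closed subspace, in which one cannot decide on which copy a
  -- point near the basepoint lies.
  infixl 3 _⋁_
  _⋁_ : PointedSpace → PointedSpace → PointedSpace
  X ⋁ Y = record
    { space = record
      { Coord  = Coord (space X ×ˢ space Y)
      ; finite = finite (space X ×ˢ space Y)
      ; In     = λ z → Σ (In (space X ×ˢ space Y) z) λ (x∈X , y∈Y) →
                   ¬ ¬ (Eq (space X) (z ∘ inj₁ , x∈X) (basepoint X)
                       ⊎ Eq (space Y) (z ∘ inj₂ , y∈Y) (basepoint Y))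
      }
    ; basepoint = let (z , z∈) = pair (space X) (space Y) (basepoint X) (basepoint Y)
                  in z , z∈ , λ ¬p → ¬p (inj₁ λ _ → R.refl)
    }

{-# OPTIONS --safe #-}

-- If the faces containing σ have a cone with apex w as their link, then they
-- can be removed up to homotopy: the smallest weight on σ is moved to w.  In
-- a wheel with n ≥ 6, two spokes leave free some edge of the rim, which is the
-- apex for the faces containing both; then all faces with two spokes, and next
-- all faces with one, are removed, and the full simplex on the rim remains.
-- For n = 4 and n = 5 removals and insertions of faces lead to 3 or 2 boundaries
-- of simplices that share the facet spanned by the rim.  Giving each of them
-- its own copies of all but one of the vertices of that facet turns the union
-- into a wedge, and the boundary of a simplex is homeomorphic to a sphere.
--
-- Membership in all these spaces is stable under double negation, so that it
-- can be argued classically; only the maps and their continuity are constructive.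
module Submission where

open import Defs

-- The change at n = 6: with k = n - 1 rim vertices, two spokes leave at least three rim vertices on
-- at most two arcs as soon as k ≥ 5, so some rim edge has both ends free. For k = 4 this fails
-- exactly for the two pairs of opposite spokes, for k = 3 for all three pairs. The link of such a
-- pair is a sphere of dimension k - 3 up to homotopy, and everything else collapses, which explains
-- the number of spheres and their dimension k - 1. The obstacle is that the order of the reals is
-- undecidable. No map may be defined by cases on signs, and homotopies cannot be pasted. Hence the
-- maps are formulas in sums, products, maxima, reciprocals and square roots, and the homotopies
-- between maps of complexes are straight lines within common faces. Completeness of the field
-- serves the square root, by which the boundary of a simplex is projected to the sphere. For n = 4
-- and n = 5 the conditions on removals and insertions concern finitely many sets of vertices and
-- are decided by evaluation.

-- Arithmetic and order in a constructive real field.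

module OrderedField (R : RealField) where

  open import Algebra.Bundles using (CommutativeRing)
  open import Algebra.Apartness.Bundles using (HeytingField)
  import Algebra.Properties.Ring as RingProperties
  import Algebra.Properties.Semiring.Mult.TCOptimised as Multiples
  import Algebra.Solver.Ring as RingSolver
  open import Algebra.Solver.Ring.AlmostCommutativeRing using (fromCommutativeRing; _-Raw-AlmostCommutative⟶_)
  open import Data.Empty using (⊥-elim)
  open import Data.Integer.Base as ℤ using (ℤ; +_; -[1+_]; _⊖_; _◃_)
  import Data.Integer.Properties as ℤₚ
  open import Data.Maybe.Base using (just; nothing)
  open import Data.Nat.Base as ℕ using (ℕ; zero; suc)
  open import Data.Product.Base using (∃; _×_; _,_; proj₁; proj₂)
  import Data.Nat.Properties as ℕₚ
  import Data.Sign.Base as Sign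
  open import Data.Sum.Base using (_⊎_; inj₁; inj₂)
  open import Function.Bundles using (Equivalence)
  import Relation.Binary.PropositionalEquality as ≡
  open import Relation.Binary.Definitions using (WeaklyDecidable)
  import Relation.Binary.Reasoning.Setoid as SetoidReasoning
  open import Relation.Binary.Structures using (IsStrictPartialOrder)
  open import Relation.Nullary using (Stable)
  open import Relation.Nullary.Decidable using (yes; no)
  open import Relation.Nullary.Negation using (¬_)

  open RealField R

  module ℝ = CommutativeRing commutativeRing
  private
    module < = IsStrictPartialOrder <-isStrictPartialOrder

  open RingProperties ℝ.ring
    using (-‿distribˡ-*; -‿distribʳ-*; -‿involutive; -0#≈0#; -‿+-comm)
  open Multiples ℝ.semiring using (1+×; ×-homo-+; ×1-homo-*) renaming (_×_ to _⋆_)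

  module IntegerCoefficients where
    open SetoidReasoning ℝ.setoid

    -- Equality of reals is undecidable, so the ring solver computes with integer coefficients. With
    -- the optimised multiples `con (+ 1)` evaluates to `1#` and `con (+ 2)` to `1# + 1#`, as they
    -- appear in the goals.
    ⟦_⟧ : ℤ → ℝ
    ⟦ + n ⟧      = n ⋆ 1#
    ⟦ -[1+ n ] ⟧ = - (suc n ⋆ 1#)

    cancel : ∀ a b c → (c + a) - (c + b) ≈ a - b
    cancel a b c = begin
      (c + a) + - (c + b)     ≈⟨ ℝ.+-cong (ℝ.+-comm c a) (ℝ.sym (-‿+-comm c b)) ⟩
      (a + c) + (- c + - b)   ≈⟨ ℝ.+-assoc a c _ ⟩
      a + (c + (- c + - b))   ≈⟨ ℝ.+-congˡ (ℝ.sym (ℝ.+-assoc c (- c) (- b))) ⟩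
      a + ((c + - c) + - b)   ≈⟨ ℝ.+-congˡ (ℝ.+-congʳ (ℝ.-‿inverseʳ c)) ⟩
      a + (0# + - b)          ≈⟨ ℝ.+-congˡ (ℝ.+-identityˡ _) ⟩
      a + - b ∎

    ⊖-homo : ∀ m n → ⟦ m ⊖ n ⟧ ≈ m ⋆ 1# - n ⋆ 1#
    ⊖-homo m zero = ℝ.sym (ℝ.trans (ℝ.+-congˡ -0#≈0#) (ℝ.+-identityʳ _))
    ⊖-homo zero (suc n) = ℝ.sym (ℝ.+-identityˡ _)
    ⊖-homo (suc m) (suc n) = begin
      ⟦ suc m ⊖ suc n ⟧                      ≡⟨ ≡.cong ⟦_⟧ (ℤₚ.[1+m]⊖[1+n]≡m⊖n m n) ⟩
      ⟦ m ⊖ n ⟧                              ≈⟨ ⊖-homo m n ⟩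
      m ⋆ 1# - n ⋆ 1#                        ≈⟨ cancel _ _ 1# ⟨
      (1# + m ⋆ 1#) - (1# + n ⋆ 1#)          ≈⟨ ℝ.+-cong (ℝ.sym (1+× m 1#)) (ℝ.-‿cong (ℝ.sym (1+× n 1#))) ⟩
      suc m ⋆ 1# - suc n ⋆ 1# ∎

    +-homo : ∀ x y → ⟦ x ℤ.+ y ⟧ ≈ ⟦ x ⟧ + ⟦ y ⟧
    +-homo (+ m)      (+ n)      = ×-homo-+ 1# m n
    +-homo (+ m)      (-[1+ n ]) = ⊖-homo m (suc n)
    +-homo (-[1+ m ]) (+ n)      = ℝ.trans (⊖-homo n (suc m)) (ℝ.+-comm _ _)
    +-homo (-[1+ m ]) (-[1+ n ]) = begin
      - (suc (suc (m ℕ.+ n)) ⋆ 1#)       ≡⟨ ≡.cong (λ k → - (k ⋆ 1#)) (ℕₚ.+-suc (suc m) n) ⟨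
      - ((suc m ℕ.+ suc n) ⋆ 1#)         ≈⟨ ℝ.-‿cong (×-homo-+ 1# (suc m) (suc n)) ⟩
      - (suc m ⋆ 1# + suc n ⋆ 1#)        ≈⟨ -‿+-comm _ _ ⟨
      - (suc m ⋆ 1#) + - (suc n ⋆ 1#) ∎

    -‿homo : ∀ x → ⟦ ℤ.- x ⟧ ≈ - ⟦ x ⟧
    -‿homo (+ zero)   = ℝ.sym -0#≈0#
    -‿homo (+ suc n)  = ℝ.refl
    -‿homo (-[1+ n ]) = ℝ.sym (-‿involutive _)

    +◃-homo : ∀ n → ⟦ Sign.+ ◃ n ⟧ ≈ n ⋆ 1#
    +◃-homo zero    = ℝ.refl
    +◃-homo (suc n) = ℝ.refl

    -◃-homo : ∀ n → ⟦ Sign.- ◃ n ⟧ ≈ - (n ⋆ 1#)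
    -◃-homo zero    = ℝ.sym -0#≈0#
    -◃-homo (suc n) = ℝ.refl

    *-homo : ∀ x y → ⟦ x ℤ.* y ⟧ ≈ ⟦ x ⟧ * ⟦ y ⟧
    *-homo (+ m)      (+ n)      = ℝ.trans (+◃-homo (m ℕ.* n)) (×1-homo-* m n)
    *-homo (+ m)      (-[1+ n ]) = ℝ.trans (-◃-homo (m ℕ.* suc n))
      (ℝ.trans (ℝ.-‿cong (×1-homo-* m (suc n))) (-‿distribʳ-* _ _))
    *-homo (-[1+ m ]) (+ n)      = ℝ.trans (-◃-homo (suc m ℕ.* n))
      (ℝ.trans (ℝ.-‿cong (×1-homo-* (suc m) n)) (-‿distribˡ-* _ _))
    *-homo (-[1+ m ]) (-[1+ n ]) = begin
      ⟦ Sign.+ ◃ (suc m ℕ.* suc n) ⟧         ≈⟨ +◃-homo (suc m ℕ.* suc n) ⟩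
      (suc m ℕ.* suc n) ⋆ 1#                 ≈⟨ ×1-homo-* (suc m) (suc n) ⟩
      (suc m ⋆ 1#) * (suc n ⋆ 1#)            ≈⟨ -‿involutive _ ⟨
      - - ((suc m ⋆ 1#) * (suc n ⋆ 1#))      ≈⟨ ℝ.-‿cong (-‿distribˡ-* _ _) ⟩
      - (- (suc m ⋆ 1#) * (suc n ⋆ 1#))      ≈⟨ -‿distribʳ-* _ _ ⟩
      - (suc m ⋆ 1#) * - (suc n ⋆ 1#) ∎

    morphism : ℤ.+-*-rawRing -Raw-AlmostCommutative⟶ fromCommutativeRing commutativeRing
    morphism = record
      { ⟦_⟧ = ⟦_⟧ ; +-homo = +-homo ; *-homo = *-homo ; -‿homo = -‿homo
      ; 0-homo = ℝ.refl ; 1-homo = ℝ.refl }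

    _coeff≟_ : WeaklyDecidable (λ a b → ⟦ a ⟧ ≈ ⟦ b ⟧)
    a coeff≟ b with a ℤₚ.≟ b
    ... | yes a≡b = just (ℝ.reflexive (≡.cong ⟦_⟧ a≡b))
    ... | no  _   = nothing

  module Solver = RingSolver ℤ.+-*-rawRing (fromCommutativeRing commutativeRing)
    IntegerCoefficients.morphism IntegerCoefficients._coeff≟_
  open Solver using (solve; con; _:=_; _:+_; _:*_; _:-_; :-_)

  opaque
    -- `y ≤ x` is by definition the negation of `x < y`, so the two cases are exhaustive up to
    -- double negation. Classical case distinctions on the order go through this lemma.
    <-or-≤ : ∀ {A : Set} → Stable A → ∀ x y → (x < y → A) → (y ≤ x → A) → A
    <-or-≤ stable x y f g = stable λ ¬A → ¬A (g λ x<y → ¬A (f x<y))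

    <-respˡ : ∀ {x y z} → x ≈ y → x < z → y < z
    <-respˡ = proj₂ <.<-resp-≈

    <-respʳ : ∀ {x y z} → y ≈ z → x < y → x < z
    <-respʳ = proj₁ <.<-resp-≈

    <-trans : ∀ {x y z} → x < y → y < z → x < z
    <-trans = <.trans

    <-irrefl : ∀ {x} → ¬ (x < x)
    <-irrefl = <.irrefl ℝ.refl

    <⇒≤ : ∀ {x y} → x < y → x ≤ y
    <⇒≤ = <.asym

    ≈⇒≤ : ∀ {x y} → x ≈ y → x ≤ y
    ≈⇒≤ x≈y = <.irrefl (ℝ.sym x≈y)

    ≤-refl : ∀ {x} → x ≤ x
    ≤-refl = <-irrefl

    <-cotrans : ∀ {x z} → x < z → ∀ y → x < y ⊎ y < z
    <-cotrans x<z y with #-cotrans (Equivalence.from #⇔<⊎> (inj₁ x<z)) y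
      where open HeytingField heytingField using (#-cotrans)
    ... | inj₁ x#y with Equivalence.to #⇔<⊎> x#y
    ...   | inj₁ x<y = inj₁ x<y
    ...   | inj₂ y<x = inj₂ (<-trans y<x x<z)
    <-cotrans x<z y | inj₂ y#z with Equivalence.to #⇔<⊎> y#z
    ...   | inj₁ y<z = inj₂ y<z
    ...   | inj₂ z<y = inj₁ (<-trans x<z z<y)

    ≤-<-trans : ∀ {x y z} → x ≤ y → y < z → x < z
    ≤-<-trans {x} x≤y y<z with <-cotrans y<z x
    ... | inj₁ y<x = ⊥-elim (x≤y y<x)
    ... | inj₂ x<z = x<z

    <-≤-trans : ∀ {x y z} → x < y → y ≤ z → x < z
    <-≤-trans {z = z} x<y y≤z with <-cotrans x<y z
    ... | inj₁ x<z = x<z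
    ... | inj₂ z<y = ⊥-elim (y≤z z<y)

    ≤-trans : ∀ {x y z} → x ≤ y → y ≤ z → x ≤ z
    ≤-trans x≤y y≤z z<x = x≤y (≤-<-trans y≤z z<x)

    ≤-antisym : ∀ {x y} → x ≤ y → y ≤ x → x ≈ y
    ≤-antisym {x} {y} x≤y y≤x = proj₁ (tight x y) λ x#y → case (Equivalence.to #⇔<⊎> x#y)
      where
      open HeytingField heytingField using (tight)
      case : ¬ (x < y ⊎ y < x)
      case (inj₁ x<y) = y≤x x<y
      case (inj₂ y<x) = x≤y y<x

    ≈-stable : ∀ {x y} → Stable (x ≈ y)
    ≈-stable ¬¬x≈y = ≤-antisym (λ y<x → ¬¬x≈y λ x≈y → ≈⇒≤ x≈y y<x)
                               (λ x<y → ¬¬x≈y λ x≈y → ≈⇒≤ (ℝ.sym x≈y) x<y)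

    ≤-respʳ : ∀ {x y z} → y ≈ z → x ≤ y → x ≤ z
    ≤-respʳ y≈z x≤y z<x = x≤y (<-respˡ (ℝ.sym y≈z) z<x)

    ≤-respˡ : ∀ {x y z} → x ≈ y → x ≤ z → y ≤ z
    ≤-respˡ x≈y x≤z z<y = x≤z (<-respʳ (ℝ.sym x≈y) z<y)

    ≤-stable : ∀ {x y} → Stable (x ≤ y)
    ≤-stable ¬¬x≤y y<x = ¬¬x≤y λ x≤y → x≤y y<x

    -- Inequalities are reduced to signs, so that what remains is a ring identity.
    <-by : ∀ {x y e} → 0# < e → e ≈ y - x → x < y
    <-by {x} {y} 0<e e≈y-x = <-respˡ (ℝ.+-identityʳ x)
      (<-respʳ (solve 2 (λ x y → x :+ (y :- x) := y) ℝ.refl x y) (+-monoʳ-< x (<-respʳ e≈y-x 0<e)))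

    <⇒0< : ∀ {x y} → x < y → 0# < y - x
    <⇒0< {x} {y} x<y = <-respˡ (ℝ.-‿inverseˡ x) (<-respʳ (ℝ.+-comm _ y) (+-monoʳ-< (- x) x<y))

    ≤-by : ∀ {x y e} → 0# ≤ e → e ≈ y - x → x ≤ y
    ≤-by {x} {y} 0≤e e≈y-x y<x = 0≤e (<-by (<⇒0< y<x)
      (ℝ.trans (solve 2 (λ x y → x :- y := con (+ 0) :- (y :- x)) ℝ.refl x y)
               (ℝ.+-congˡ (ℝ.-‿cong (ℝ.sym e≈y-x)))))

    ≤⇒0≤ : ∀ {x y} → x ≤ y → 0# ≤ y - x
    ≤⇒0≤ {x} {y} x≤y y-x<0 = x≤y (<-by (<⇒0< y-x<0)
      (solve 2 (λ x y → con (+ 0) :- (y :- x) := x :- y) ℝ.refl x y))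

    +-pos-nonneg : ∀ {x y} → 0# < x → 0# ≤ y → 0# < x + y
    +-pos-nonneg {x} {y} 0<x 0≤y = ≤-<-trans 0≤y
      (<-by 0<x (solve 2 (λ x y → x := x :+ y :- y) ℝ.refl x y))

    +-pos : ∀ {x y} → 0# < x → 0# < y → 0# < x + y
    +-pos 0<x 0<y = +-pos-nonneg 0<x (<⇒≤ 0<y)

    +-nonneg : ∀ {x y} → 0# ≤ x → 0# ≤ y → 0# ≤ x + y
    +-nonneg {x} {y} 0≤x 0≤y = ≤-trans 0≤y
      (≤-by 0≤x (solve 2 (λ x y → x := x :+ y :- y) ℝ.refl x y))

    *-nonneg : ∀ {x y} → 0# ≤ x → 0# ≤ y → 0# ≤ x * y
    *-nonneg {x} {y} 0≤x 0≤y = <-or-≤ ≤-stable 0# x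
      (λ 0<x → <-or-≤ ≤-stable 0# y (λ 0<y → <⇒≤ (*-pos 0<x 0<y))
        (λ y≤0 → ≈⇒≤ (ℝ.sym (ℝ.trans (ℝ.*-congˡ (≤-antisym y≤0 0≤y)) (ℝ.zeroʳ x)))))
      (λ x≤0 → ≈⇒≤ (ℝ.sym (ℝ.trans (ℝ.*-congʳ (≤-antisym x≤0 0≤x)) (ℝ.zeroˡ y))))

    +-mono-≤ : ∀ {x y u v} → x ≤ y → u ≤ v → x + u ≤ y + v
    +-mono-≤ {x} {y} {u} {v} x≤y u≤v = ≤-by (+-nonneg (≤⇒0≤ x≤y) (≤⇒0≤ u≤v))
      (solve 4 (λ x y u v → (y :- x) :+ (v :- u) := (y :+ v) :- (x :+ u)) ℝ.refl x y u v)

    *-monoˡ-≤ : ∀ {x y z} → 0# ≤ z → x ≤ y → z * x ≤ z * y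
    *-monoˡ-≤ {x} {y} {z} 0≤z x≤y = ≤-by (*-nonneg 0≤z (≤⇒0≤ x≤y))
      (solve 3 (λ x y z → z :* (y :- x) := z :* y :- z :* x) ℝ.refl x y z)

    neg-nonneg : ∀ {x} → x ≤ 0# → 0# ≤ - x
    neg-nonneg x≤0 = ≤-respʳ (ℝ.+-identityˡ _) (≤⇒0≤ x≤0)

    square-nonneg : ∀ x → 0# ≤ x * x
    square-nonneg x = <-or-≤ ≤-stable 0# x (λ 0<x → <⇒≤ (*-pos 0<x 0<x))
      (λ x≤0 → ≤-respʳ (solve 1 (λ x → (:- x) :* (:- x) := x :* x) ℝ.refl x)
        (*-nonneg (neg-nonneg x≤0) (neg-nonneg x≤0)))

    *-cancelˡ-nonneg : ∀ {x y} → 0# < x → 0# ≤ x * y → 0# ≤ y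
    *-cancelˡ-nonneg {x} {y} 0<x 0≤xy y<0 = 0≤xy (<-by (*-pos 0<x (<⇒0< y<0))
      (solve 2 (λ x y → x :* (con (+ 0) :- y) := con (+ 0) :- x :* y) ℝ.refl x y))

  opaque
    invert : ∀ {x} → x # 0# → ∃ λ y → x * y ≈ 1#
    invert {x} x#0 with HeytingField.#⇒invertible heytingField x#0
    ... | y , _ , xy≈1 = y , ℝ.trans (ℝ.*-congʳ (solve 1 (λ x → x := x :- con (+ 0)) ℝ.refl x)) xy≈1

  opaque
    -- An invertible element is apart from zero; the sign of the inverse is then selected by its
    -- nonnegativity, which follows by cancelling `x`.
    inverse : ∀ {x} → 0# < x → ∃ λ y → 0# < y × x * y ≈ 1#
    inverse {x} 0<x with invert (Equivalence.from #⇔<⊎> (inj₂ 0<x))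
    ... | y , xy≈1 = y , 0<y , xy≈1
      where
      0≤y : 0# ≤ y
      0≤y = *-cancelˡ-nonneg 0<x (≤-respʳ (ℝ.sym xy≈1) (<⇒≤ 0<1))
      0<y : 0# < y
      0<y with Equivalence.to #⇔<⊎> (HeytingField.invertible⇒# heytingField {y} {0#}
        (x , ℝ.trans (ℝ.*-congˡ (solve 1 (λ y → y :- con (+ 0) := y) ℝ.refl y)) xy≈1
           , ℝ.trans (solve 2 (λ x y → (y :- con (+ 0)) :* x := x :* y) ℝ.refl x y) xy≈1))
      ... | inj₁ y<0 = ⊥-elim (0≤y y<0)
      ... | inj₂ p   = p

  opaque
    *-cancelˡ-pos : ∀ {x y} → 0# < x → 0# < x * y → 0# < y
    *-cancelˡ-pos {x} {y} 0<x 0<xy with inverse 0<x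
    ... | z , 0<z , xz≈1 = <-respʳ
      (ℝ.trans (solve 3 (λ x y z → z :* (x :* y) := x :* z :* y) ℝ.refl x y z)
               (ℝ.trans (ℝ.*-congʳ xz≈1) (ℝ.*-identityˡ y))) (*-pos 0<z 0<xy)

  2# : ℝ
  2# = 1# + 1#

  opaque
    ½ : ℝ
    ½ = proj₁ (inverse (+-pos 0<1 0<1))

  opaque
    unfolding ½
    0<½ : 0# < ½
    0<½ = proj₁ (proj₂ (inverse (+-pos 0<1 0<1)))

    ½+½ : ½ + ½ ≈ 1#
    ½+½ = ℝ.trans (solve 1 (λ h → h :+ h := con (+ 2) :* h) ℝ.refl ½) (proj₂ (proj₂ (inverse (+-pos 0<1 0<1))))

    halves : ∀ x → ½ * x + ½ * x ≈ x
    halves x = ℝ.trans (ℝ.sym (ℝ.distribʳ x ½ ½)) (ℝ.trans (ℝ.*-congʳ ½+½) (ℝ.*-identityˡ x))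

    x≤x⊔y : ∀ x y → x ≤ x ⊔ y
    x≤x⊔y x y = proj₁ (⊔-supremum x y)

    y≤x⊔y : ∀ x y → y ≤ x ⊔ y
    y≤x⊔y x y = proj₁ (proj₂ (⊔-supremum x y))

    ⊔-lub : ∀ {x y z} → x ≤ z → y ≤ z → x ⊔ y ≤ z
    ⊔-lub {x} {y} = proj₂ (proj₂ (⊔-supremum x y)) _

    x≤y⇒x⊔y≈y : ∀ {x y} → x ≤ y → x ⊔ y ≈ y
    x≤y⇒x⊔y≈y x≤y = ≤-antisym (⊔-lub x≤y ≤-refl) (y≤x⊔y _ _)

    y≤x⇒x⊔y≈x : ∀ {x y} → y ≤ x → x ⊔ y ≈ x
    y≤x⇒x⊔y≈x y≤x = ≤-antisym (⊔-lub ≤-refl y≤x) (x≤x⊔y _ _)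

  infixl 7 _⊓_
  _⊓_ : ℝ → ℝ → ℝ
  x ⊓ y = - (- x ⊔ - y)

  opaque
    neg-anti-≤ : ∀ {x y} → x ≤ y → - y ≤ - x
    neg-anti-≤ {x} {y} x≤y = ≤-by (≤⇒0≤ x≤y)
      (solve 2 (λ x y → y :- x := (:- x) :- (:- y)) ℝ.refl x y)

    x⊓y≤x : ∀ x y → x ⊓ y ≤ x
    x⊓y≤x x y = ≤-respʳ (-‿involutive x) (neg-anti-≤ (x≤x⊔y (- x) (- y)))

    x⊓y≤y : ∀ x y → x ⊓ y ≤ y
    x⊓y≤y x y = ≤-respʳ (-‿involutive y) (neg-anti-≤ (y≤x⊔y (- x) (- y)))

    x≤y⇒x⊓y≈x : ∀ {x y} → x ≤ y → x ⊓ y ≈ x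
    x≤y⇒x⊓y≈x x≤y = ℝ.trans (ℝ.-‿cong (y≤x⇒x⊔y≈x (neg-anti-≤ x≤y))) (-‿involutive _)

    y≤x⇒x⊓y≈y : ∀ {x y} → y ≤ x → x ⊓ y ≈ y
    y≤x⇒x⊓y≈y y≤x = ℝ.trans (ℝ.-‿cong (x≤y⇒x⊔y≈y (neg-anti-≤ y≤x))) (-‿involutive _)

    ⊓-glb : ∀ {x y z} → z ≤ x → z ≤ y → z ≤ x ⊓ y
    ⊓-glb z≤x z≤y = ≤-respˡ (-‿involutive _) (neg-anti-≤ (⊔-lub (neg-anti-≤ z≤x) (neg-anti-≤ z≤y)))

    -- A strict inequality is not a stable goal, so it is produced by cotransitivity. The one
    -- remaining case, in which the minimum lies below both arguments, is refuted classically.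
    ⊓-pos : ∀ {x y} → 0# < x → 0# < y → 0# < x ⊓ y
    ⊓-pos {x} {y} 0<x 0<y with <-cotrans 0<x (x ⊓ y) | <-cotrans 0<y (x ⊓ y)
    ... | inj₁ p | _ = p
    ... | _ | inj₁ p = p
    ... | inj₂ p | inj₂ q = ⊥-elim (<-or-≤ (λ ¬¬⊥ → ¬¬⊥ λ ()) x y
      (λ x<y → <.irrefl (x≤y⇒x⊓y≈x (<⇒≤ x<y)) p) (λ y≤x → <.irrefl (y≤x⇒x⊓y≈y y≤x) q))

-- Square roots as limits of nested intervals.

module SquareRoot (R : RealField) where

  open OrderedField R
  open import Data.Integer.Base using (+_)
  open import Data.Nat.Base as ℕ using (ℕ; zero; suc)
  import Data.Nat.Properties as ℕₚ
  open import Data.Product.Base using (∃; _×_; _,_; proj₁; proj₂)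
  open RealField R
  open Solver using (solve; con; _:=_; _:+_; _:*_; _:-_; :-_)

  opaque
    ≤-from-slack : ∀ {x y} → (∀ ε → 0# < ε → x ≤ y + ε) → x ≤ y
    ≤-from-slack {x} {y} slack y<x = slack (½ * (x - y)) (*-pos 0<½ (<⇒0< y<x))
      (<-by (*-pos 0<½ (<⇒0< y<x))
        (ℝ.trans (solve 3 (λ h x y → h := (y :+ (h :+ h)) :- (y :+ h)) ℝ.refl (½ * (x - y)) x y)
                 (ℝ.+-congʳ (ℝ.trans (ℝ.+-congˡ (halves (x - y)))
                                     (solve 2 (λ x y → y :+ (x :- y) := x) ℝ.refl x y)))))

  module NestedIntervals
    (lo hi : ℕ → ℝ)
    (lo≤hi : ∀ n → lo n ≤ hi n)
    (lo-mono : ∀ n → lo n ≤ lo (suc n))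
    (hi-anti : ∀ n → hi (suc n) ≤ hi n)
    (halving : ∀ n → hi (suc n) - lo (suc n) ≤ ½ * (hi n - lo n))
    where

    width : ℕ → ℝ
    width n = hi n - lo n

    opaque
      -- Linear decay is what the Archimedean axiom can use. It follows from halving because (n + 2)
      -- / 2 ≤ n + 1.
      width-bound : ∀ n → (suc n · 1#) * width n ≤ width 0
      width-bound zero = ≈⇒≤ (ℝ.trans (ℝ.*-congʳ (ℝ.+-identityʳ 1#)) (ℝ.*-identityˡ _))
      width-bound (suc n) = ≤-trans (≤-trans (*-monoˡ-≤ 0≤2+n (halving n)) (≤-by slack identity)) (width-bound n)
        where
        N : ℝ
        N = n · 1#
        0≤· : ∀ n → 0# ≤ n · 1#
        0≤· zero    = ≤-refl
        0≤· (suc n) = +-nonneg (<⇒≤ 0<1) (0≤· n)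
        0≤2+n : 0# ≤ suc (suc n) · 1#
        0≤2+n = 0≤· (suc (suc n))
        w : ℝ
        w = ½ * width n
        slack : 0# ≤ N * w
        slack = *-nonneg (0≤· n) (*-nonneg (<⇒≤ 0<½) (≤⇒0≤ (lo≤hi n)))
        identity : N * w ≈ (suc n · 1#) * width n - (suc (suc n) · 1#) * (½ * width n)
        identity = ℝ.sym (ℝ.trans (ℝ.+-congʳ (ℝ.*-congˡ (ℝ.sym (halves (width n)))))
          (solve 2 (λ n w → (con (+ 1) :+ n) :* (w :+ w) :- (con (+ 1) :+ (con (+ 1) :+ n)) :* w := n :* w)
            ℝ.refl N w))

    opaque
      width-small : ∀ ε → 0# < ε → ∃ λ n → width n < ε
      width-small ε 0<ε with inverse 0<ε
      ... | δ , 0<δ , εδ≈1 with archimedean (width 0 * δ)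
      ...   | n , w₀δ<n = n , <-by (*-cancelˡ-pos 0<δ (*-cancelˡ-pos 0<1+n
          (<-respʳ rearranged (+-pos-nonneg (<⇒0< w₀δ<1+n) (*-nonneg (≤⇒0≤ (width-bound n)) (<⇒≤ 0<δ))))))
          ℝ.refl
        where
        N : ℝ
        N = suc n · 1#
        n<1+n : n · 1# < N
        n<1+n = <-by 0<1 (solve 1 (λ n → con (+ 1) := con (+ 1) :+ n :- n) ℝ.refl (n · 1#))
        w₀δ<1+n : width 0 * δ < N
        w₀δ<1+n = <-trans w₀δ<n n<1+n
        0<1+n : 0# < N
        0<1+n = ≤-<-trans (*-nonneg (≤⇒0≤ (lo≤hi 0)) (<⇒≤ 0<δ)) w₀δ<1+n
        rearranged : (N - width 0 * δ) + (width 0 - N * width n) * δ ≈ N * (δ * (ε - width n))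
        rearranged = ℝ.trans
          (solve 4 (λ N δ w u → (N :- u :* δ) :+ (u :- N :* w) :* δ := N :* con (+ 1) :- N :* w :* δ)
            ℝ.refl N δ (width n) (width 0))
          (ℝ.trans (ℝ.+-congʳ (ℝ.*-congˡ (ℝ.sym εδ≈1)))
            (solve 4 (λ N δ w ε → N :* (ε :* δ) :- N :* w :* δ := N :* (δ :* (ε :- w)))
            ℝ.refl N δ (width n) ε))

    opaque
      lo-≤ : ∀ {m n} → m ℕ.≤ n → lo m ≤ lo n
      lo-≤ {m} m≤n = go (ℕₚ.≤⇒≤′ m≤n)
        where
        go : ∀ {n} → m ℕ.≤′ n → lo m ≤ lo n
        go ℕ.≤′-refl       = ≤-refl
        go (ℕ.≤′-step m≤n) = ≤-trans (go m≤n) (lo-mono _)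

    opaque
      hi-≤ : ∀ {m n} → m ℕ.≤ n → hi n ≤ hi m
      hi-≤ {m} m≤n = go (ℕₚ.≤⇒≤′ m≤n)
        where
        go : ∀ {n} → m ℕ.≤′ n → hi n ≤ hi m
        go ℕ.≤′-refl       = ≤-refl
        go (ℕ.≤′-step m≤n) = ≤-trans (hi-anti _) (go m≤n)

    opaque
      close : ∀ N m n → N ℕ.≤ m → N ℕ.≤ n → hi m - hi n ≤ width N
      close N m n N≤m N≤n = ≤-by
        (+-nonneg (≤⇒0≤ (hi-≤ N≤m)) (+-nonneg (≤⇒0≤ (lo≤hi n)) (≤⇒0≤ (lo-≤ N≤n))))
        (solve 5 (λ H L hm hn ln → (H :- hm) :+ ((hn :- ln) :+ (ln :- L)) := (H :- L) :- (hm :- hn))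
          ℝ.refl (hi N) (lo N) (hi m) (hi n) (lo n))

    opaque
      hi-cauchy : Cauchy hi
      hi-cauchy ε 0<ε with width-small ε 0<ε
      ... | N , w<ε = N , λ m n N≤m N≤n →
        ≤-<-trans (close N m n N≤m N≤n) w<ε , ≤-<-trans (close N n m N≤n N≤m) w<ε

    opaque
      limit : ℝ
      limit = proj₁ (complete hi hi-cauchy)

    opaque
      unfolding limit
      limit-converges : hi ConvergesTo limit
      limit-converges = proj₂ (complete hi hi-cauchy)

    opaque
      limit≤hi : ∀ n → limit ≤ hi n
      limit≤hi n hi<l with limit-converges _ (<⇒0< hi<l)
      ... | N , near = hi-≤ (ℕₚ.m≤n⊔m N n) (<-by (<⇒0< (proj₂ (near (N ℕ.⊔ n) (ℕₚ.m≤m⊔n N n))))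
        (solve 3 (λ l h k → (l :- h) :- (l :- k) := k :- h) ℝ.refl limit (hi n) (hi (N ℕ.⊔ n))))

    opaque
      lo≤limit : ∀ n → lo n ≤ limit
      lo≤limit n l<lo with limit-converges _ (<⇒0< l<lo)
      ... | N , near = ≤-trans (lo-≤ (ℕₚ.m≤n⊔m N n)) (lo≤hi (N ℕ.⊔ n))
        (<-by (<⇒0< (proj₁ (near (N ℕ.⊔ n) (ℕₚ.m≤m⊔n N n))))
        (solve 3 (λ l h k → (k :- l) :- (h :- l) := k :- h) ℝ.refl limit (hi (N ℕ.⊔ n)) (lo n)))

  -- Newton's iteration, started at 1 + a, traps the root between a / x and x.
  module Newton {a : ℝ} (0<a : 0# < a) where

    record Approximation : Set where
      field
        value    : ℝ
        positive : 0# < value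
        above    : a ≤ value * value
      quotient : ℝ
      quotient = a * proj₁ (inverse positive)
      opaque
        quotient-positive : 0# < quotient
        quotient-positive = *-pos 0<a (proj₁ (proj₂ (inverse positive)))
        product : value * quotient ≈ a
        product = ℝ.trans (solve 3 (λ x a y → x :* (a :* y) := a :* (x :* y)) ℝ.refl value a _)
          (ℝ.trans (ℝ.*-congˡ (proj₂ (proj₂ (inverse positive)))) (ℝ.*-identityʳ a))
        quotient≤value : quotient ≤ value
        quotient≤value = ≤-by (*-cancelˡ-nonneg positive (≤-respʳ
          (ℝ.trans (ℝ.+-congˡ (ℝ.-‿cong (ℝ.sym product)))
            (solve 2 (λ x q → x :* x :- x :* q := x :* (x :- q)) ℝ.refl value quotient)) (≤⇒0≤ above))) ℝ.refl

    open Approximation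

    opaque
      -- The inequality of arithmetic and geometric means: the square of (x + q) / 2 exceeds x q = a
      -- by the square of (x - q) / 2.
      improve-above : ∀ s → a ≤ ½ * (value s + quotient s) * (½ * (value s + quotient s))
      improve-above s = ≤-by (square-nonneg (½ * (x - q))) (ℝ.trans
        (solve 3 (λ h x q → h :* (x :- q) :* (h :* (x :- q)) :=
                            h :* (x :+ q) :* (h :* (x :+ q)) :- (h :+ h) :* (h :+ h) :* (x :* q)) ℝ.refl ½ x q)
        (ℝ.+-congˡ (ℝ.-‿cong (ℝ.trans (ℝ.*-cong (ℝ.*-cong ½+½ ½+½) (product s))
          (solve 1 (λ a → con (+ 1) :* con (+ 1) :* a := a) ℝ.refl a)))))
        where
        x : ℝ
        x = value s
        q : ℝ
        q = quotient s

    opaque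
      improve-positive : ∀ s → 0# < ½ * (value s + quotient s)
      improve-positive s = *-pos 0<½ (+-pos (positive s) (quotient-positive s))

    improve : Approximation → Approximation
    improve s = record
      { value    = ½ * (value s + quotient s)
      ; positive = improve-positive s
      ; above    = improve-above s
      }

    opaque
      improve-≤ : ∀ s → value (improve s) ≤ value s
      improve-≤ s = ≤-by (*-nonneg (<⇒≤ 0<½) (≤⇒0≤ (quotient≤value s))) (ℝ.trans
        (solve 3 (λ h x q → h :* (x :- q) := (h :* x :+ h :* x) :- h :* (x :+ q)) ℝ.refl ½ (value s) (quotient s))
        (ℝ.+-congʳ (halves (value s))))

    opaque
      -- Value times quotient stays equal to `a`, and the value decreases.
      improve-quotient : ∀ s → quotient s ≤ quotient (improve s)
      improve-quotient s = ≤-by (*-cancelˡ-nonneg (positive (improve s))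
        (≤-respʳ (ℝ.trans
          (solve 3 (λ x y q → (x :- y) :* q := x :* q :- y :* q) ℝ.refl (value s) x′ (quotient s))
          (ℝ.trans (ℝ.+-congʳ (ℝ.trans (product s) (ℝ.sym (product (improve s)))))
            (solve 3 (λ x q p → x :* p :- x :* q := x :* (p :- q)) ℝ.refl x′ (quotient s) (quotient (improve s)))))
          (*-nonneg (≤⇒0≤ (improve-≤ s)) (<⇒≤ (quotient-positive s))))) ℝ.refl
        where
        x′ : ℝ
        x′ = value (improve s)

    opaque
      -- The new quotient is at least the old quotient q, and (x + q) / 2 - q is half of x - q.
      improve-halves : ∀ s → value (improve s) - quotient (improve s) ≤ ½ * (value s - quotient s)
      improve-halves s = ≤-by (≤⇒0≤ (improve-quotient s)) (ℝ.sym (ℝ.trans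
        (solve 4 (λ h x q p → h :* (x :- q) :- (h :* (x :+ q) :- p) := p :- (h :* q :+ h :* q))
          ℝ.refl ½ (value s) (quotient s) (quotient (improve s)))
        (ℝ.+-congˡ (ℝ.-‿cong (halves (quotient s))))))

    opaque
      initial-above : a ≤ (1# + a) * (1# + a)
      initial-above = ≤-by (+-nonneg (<⇒≤ 0<1) (+-nonneg (<⇒≤ 0<a) (square-nonneg a)))
        (solve 1 (λ a → con (+ 1) :+ (a :+ a :* a) := (con (+ 1) :+ a) :* (con (+ 1) :+ a) :- a) ℝ.refl a)

    iterate : ℕ → Approximation
    iterate zero = record
      -- The square of 1 + a exceeds `a` by 1 + a + a², so this start lies above the root for small
      -- and large `a` alike.
      { value    = 1# + a
      ; positive = +-pos 0<1 0<a
      ; above    = initial-above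
      }
    iterate (suc n) = improve (iterate n)

    lo hi : ℕ → ℝ
    lo n = quotient (iterate n)
    hi n = value (iterate n)

    open NestedIntervals lo hi (λ n → quotient≤value (iterate n)) (λ n → improve-quotient (iterate n))
      (λ n → improve-≤ (iterate n)) (λ n → improve-halves (iterate n))

    root : ℝ
    root = limit

    opaque
      root-positive : 0# < root
      root-positive = <-≤-trans (quotient-positive (iterate 0)) (lo≤limit 0)

    opaque
      -- Both root² and a = lo n * hi n lie in [lo n ², hi n ²].
      square-bounds : ∀ n → (root * root ≤ a + width n * hi 0) × (a ≤ root * root + width n * hi 0)
      square-bounds n =
        ≤-by (+-nonneg (*-nonneg (≤⇒0≤ l≤h) (<⇒≤ 0<h)) (+-nonneg (*-nonneg (<⇒≤ root-positive) (≤⇒0≤ l≤h)) gap))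
          (ℝ.trans (solve 4 (λ l h q H → (h :- l) :* h :+ (l :* (h :- l) :+ (h :- q) :* (H :- h)) :=
               (h :* q :+ (h :- q) :* H) :- l :* l) ℝ.refl root h q (hi 0))
            (ℝ.+-congʳ (ℝ.+-congʳ (product (iterate n)))))
        , ≤-by (+-nonneg (*-nonneg (≤⇒0≤ q≤l) (<⇒≤ 0<q)) (+-nonneg (*-nonneg (<⇒≤ root-positive) (≤⇒0≤ q≤l))
            (+-nonneg gap (*-nonneg (≤⇒0≤ q≤h) (≤⇒0≤ q≤h)))))
          (ℝ.trans (solve 4 (λ l h q H → (l :- q) :* q :+ (l :* (l :- q) :+ ((h :- q) :* (H :- h) :+ (h :- q) :* (h :- q))) :=
               (l :* l :+ (h :- q) :* H) :- h :* q) ℝ.refl root h q (hi 0))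
            (ℝ.+-congˡ (ℝ.-‿cong (product (iterate n)))))
        where
        h : ℝ
        h = hi n
        q : ℝ
        q = lo n
        0<h : 0# < h
        0<h = positive (iterate n)
        0<q : 0# < q
        0<q = quotient-positive (iterate n)
        l≤h : root ≤ h
        l≤h = limit≤hi n
        q≤l : q ≤ root
        q≤l = lo≤limit n
        q≤h : q ≤ h
        q≤h = ≤-trans q≤l l≤h
        gap : 0# ≤ (h - q) * (hi 0 - h)
        gap = *-nonneg (≤⇒0≤ q≤h) (≤⇒0≤ (hi-≤ (ℕ.z≤n {n})))

    opaque
      root-square : root * root ≈ a
      root-square = ≤-antisym (≤-from-slack λ ε 0<ε → shrink ε 0<ε (λ n → proj₁ (square-bounds n)))
                              (≤-from-slack λ ε 0<ε → shrink ε 0<ε (λ n → proj₂ (square-bounds n)))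
        where
        shrink : ∀ {x y} ε → 0# < ε → (∀ n → x ≤ y + width n * hi 0) → x ≤ y + ε
        shrink ε 0<ε bound with inverse (positive (iterate 0))
        ... | z , 0<z , Hz≈1 with width-small (ε * z) (*-pos 0<ε 0<z)
        ...   | n , w<εz = ≤-trans (bound n) (+-mono-≤ ≤-refl (≤-by
          (*-nonneg (<⇒≤ (positive (iterate 0))) (≤⇒0≤ (<⇒≤ w<εz)))
          (ℝ.trans (solve 4 (λ H ε z w → H :* (ε :* z :- w) := ε :* (H :* z) :- w :* H) ℝ.refl (hi 0) ε z (width n))
            (ℝ.+-congʳ (ℝ.trans (ℝ.*-congˡ Hz≈1) (ℝ.*-identityʳ ε))))))

  opaque
    sqrt : ∀ {a} → 0# < a → ∃ λ s → 0# < s × s * s ≈ a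
    sqrt 0<a = root , root-positive , root-square
      where open Newton 0<a

-- Continuity of real-valued functions and of maps between spaces.

module Continuity (R : RealField) where

  open OrderedField R
  open SquareRoot R
  open import Data.Fin.Base using (Fin; zero; suc)
  open import Data.Integer.Base using (+_)
  open import Data.Nat.Base using (zero; suc)
  open import Data.Product.Base using (∃; _×_; _,_; proj₁; proj₂; map₂)
  open import Function.Base using (_∘_; id)
  open import Function.Bundles using (Inverse)
  import Relation.Binary.PropositionalEquality as ≡
  open RealField R
  open Topology R
  open Space
  open Map
  open Solver using (solve; con; _:=_; _:+_; _:*_; _:-_; :-_)

  3# : ℝ
  3# = 2# + 1#

  -- The non-strict form of `Within`: bounds for maxima and products are naturally non-strict.
  -- Strictness is regained at the end by aiming at `½ * ε` instead of `ε`.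
  Close : ℝ → ℝ → ℝ → Set
  Close ε x y = x ≤ y + ε × y ≤ x + ε

  opaque
    within⇒close : ∀ {ε x y} → Within ε x y → Close ε x y
    within⇒close {ε} {x} {y} (p , q) =
      ≤-by (≤⇒0≤ (<⇒≤ p)) (solve 3 (λ x y ε → ε :- (x :- y) := (y :+ ε) :- x) ℝ.refl x y ε) ,
      ≤-by (≤⇒0≤ (<⇒≤ q)) (solve 3 (λ x y ε → ε :- (y :- x) := (x :+ ε) :- y) ℝ.refl x y ε)

  opaque
    half< : ∀ {ε} → 0# < ε → ½ * ε < ε
    half< {ε} 0<ε = <-by (*-pos 0<½ 0<ε) (ℝ.trans
      (solve 1 (λ h → h := h :+ h :- h) ℝ.refl (½ * ε)) (ℝ.+-congʳ (halves ε)))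

  opaque
    close⇒within : ∀ {ε η x y} → η < ε → Close η x y → Within ε x y
    close⇒within {ε} {η} {x} {y} η<ε (p , q) =
      ≤-<-trans (≤-by (≤⇒0≤ p) (solve 3 (λ x y ε → y :+ ε :- x := ε :- (x :- y)) ℝ.refl x y η)) η<ε ,
      ≤-<-trans (≤-by (≤⇒0≤ q) (solve 3 (λ x y ε → x :+ ε :- y := ε :- (y :- x)) ℝ.refl x y η)) η<ε

  opaque
    within-refl : ∀ {ε x y} → 0# < ε → x ≈ y → Within ε x y
    within-refl {ε} {x} {y} 0<ε x≈y = <-respˡ (zero-difference x≈y) 0<ε , <-respˡ (zero-difference (ℝ.sym x≈y)) 0<ε
      where
      zero-difference : ∀ {x y} → x ≈ y → 0# ≈ x - y
      zero-difference {x} {y} x≈y = ℝ.trans (ℝ.sym (ℝ.-‿inverseʳ y)) (ℝ.+-congʳ (ℝ.sym x≈y))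

  opaque
    within-mono : ∀ {δ ε x y} → δ ≤ ε → Within δ x y → Within ε x y
    within-mono δ≤ε (p , q) = <-≤-trans p δ≤ε , <-≤-trans q δ≤ε

  opaque
    all-within : ∀ {x y} → (∀ ε → 0# < ε → Within ε x y) → x ≈ y
    all-within w = ≤-antisym (≤-from-slack λ ε 0<ε → proj₁ (within⇒close (w ε 0<ε)))
                             (≤-from-slack λ ε 0<ε → proj₂ (within⇒close (w ε 0<ε)))

  opaque
    common-threshold : ∀ {n} (P : Fin n → ℝ → Set) → (∀ i {δ ε} → δ ≤ ε → P i ε → P i δ) →
                       (∀ i → ∃ λ δ → 0# < δ × P i δ) → ∃ λ δ → 0# < δ × (∀ i → P i δ)
    common-threshold {zero} P mono h = 1# , 0<1 , λ ()
    common-threshold {suc n} P mono h with h zero | common-threshold (P ∘ suc) (λ i → mono (suc i)) (h ∘ suc)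
    ... | δ , 0<δ , p | δ′ , 0<δ′ , p′ = δ ⊓ δ′ , ⊓-pos 0<δ 0<δ′ , λ where
      zero    → mono zero (x⊓y≤x δ δ′) p
      (suc i) → mono (suc i) (x⊓y≤y δ δ′) (p′ i)

  near-mono : ∀ (X : Space) {δ ε x y} → δ ≤ ε → Near X δ x y → Near X ε x y
  near-mono X δ≤ε near i = within-mono δ≤ε (near i)

  Cont : (X : Space) → (Point X → ℝ) → Set
  Cont X f = ∀ x ε → 0# < ε → ∃ λ δ → 0# < δ × (∀ y → Near X δ x y → Within ε (f x) (f y))

  -- Continuity may be checked coordinate by coordinate, since finitely many thresholds have a
  -- positive minimum; the enumeration in `finite Y` supplies the finiteness.
  mapOf : (X Y : Space) (f : Point X → Coord Y → ℝ) → (∀ x → In Y (f x)) →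
          (∀ i → Cont X (λ x → f x i)) → Map X Y
  mapOf X Y f f∈Y cont = record
    { fun = λ x → f x , f∈Y x
    ; continuous = λ x ε 0<ε →
        let (δ , 0<δ , p) = common-threshold
              (λ j δ → ∀ y → Near X δ x y → Within ε (f x (index j)) (f y (index j)))
              (λ j δ≤ε p y near → p y (near-mono X {x = x} {y} δ≤ε near))
              (λ j → cont (index j) x ε 0<ε)
        in δ , 0<δ , λ y near i →
             ≡.subst (λ j → Within ε (f x j) (f y j)) (Inverse.strictlyInverseʳ coords i)
               (p (Inverse.to coords i) y near)
    }
    where
    coords = proj₂ (finite Y)
    index : Fin (proj₁ (finite Y)) → Coord Y
    index = Inverse.from coords

  map-cont : ∀ (X Y : Space) (f : Map X Y) i → Cont X (λ x → proj₁ (fun f x) i)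
  map-cont X Y f i x ε 0<ε = map₂ (map₂ (λ p y near → p y near i)) (continuous f x ε 0<ε)

  opaque
    cont-cong : ∀ (X : Space) {f} → Cont X f → ∀ {x y} → Eq X x y → f x ≈ f y
    cont-cong X {f} cf {x} {y} x≈y = all-within λ ε 0<ε →
      let (δ , 0<δ , p) = cf x ε 0<ε in p y λ i → within-refl 0<δ (x≈y i)

  map-cong : ∀ (X Y : Space) (f : Map X Y) {x y} → Eq X x y → Eq Y (fun f x) (fun f y)
  map-cong X Y f x≈y i = cont-cong X (map-cont X Y f i) x≈y

  infixr 9 _∘ᵐ_
  _∘ᵐ_ : {X Y Z : Space} → Map Y Z → Map X Y → Map X Z
  g ∘ᵐ f = record
    { fun = fun g ∘ fun f
    ; continuous = λ x ε 0<ε →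
        let (δ , 0<δ , p) = continuous g (fun f x) ε 0<ε
            (γ , 0<γ , q) = continuous f x δ 0<δ
        in γ , 0<γ , λ y near → p (fun f y) (q y near)
    }

  idᵐ : (X : Space) → Map X X
  idᵐ X = record { fun = id ; continuous = λ x ε 0<ε → ε , 0<ε , λ y near → near }

  module _ (X : Space) where

    cont-coord : ∀ i → Cont X (λ x → proj₁ x i)
    cont-coord i x ε 0<ε = ε , 0<ε , λ y near → near i

    cont-const : ∀ c → Cont X (λ _ → c)
    cont-const c x ε 0<ε = ε , 0<ε , λ y _ → within-refl 0<ε ℝ.refl

    both : ∀ {f g} → Cont X f → Cont X g → ∀ x η θ → 0# < η → 0# < θ →
      ∃ λ δ → 0# < δ × (∀ y → Near X δ x y → Within η (f x) (f y) × Within θ (g x) (g y))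
    both cf cg x η θ 0<η 0<θ =
      let (δ , 0<δ , p) = cf x η 0<η
          (γ , 0<γ , q) = cg x θ 0<θ
      in δ ⊓ γ , ⊓-pos 0<δ 0<γ , λ y near →
        p y (near-mono X {x = x} {y} (x⊓y≤x δ γ) near) , q y (near-mono X {x = x} {y} (x⊓y≤y δ γ) near)

    opaque
      cont-+ : ∀ {f g} → Cont X f → Cont X g → Cont X (λ x → f x + g x)
      cont-+ {f} {g} cf cg x ε 0<ε =
        let 0<η           = *-pos 0<½ 0<ε
            (δ , 0<δ , p) = both cf cg x (½ * ε) (½ * ε) 0<η 0<η
        in δ , 0<δ , λ y near →
          let ((a , b) , (c , d)) = p y near
          in add (f x) (f y) (g x) (g y) a c , add (f y) (f x) (g y) (g x) b d
        where
        add : ∀ u v w z → u - v < ½ * ε → w - z < ½ * ε → (u + w) - (v + z) < ε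
        add u v w z p q = <-by (+-pos (<⇒0< p) (<⇒0< q)) (ℝ.trans
          (solve 5 (λ u v w z h → (h :- (u :- v)) :+ (h :- (w :- z)) := (h :+ h) :- ((u :+ w) :- (v :+ z)))
            ℝ.refl u v w z (½ * ε)) (ℝ.+-congʳ (halves ε)))

    opaque
      cont-neg : ∀ {f} → Cont X f → Cont X (λ x → - f x)
      cont-neg {f} cf x ε 0<ε =
        let (δ , 0<δ , p) = cf x ε 0<ε
        in δ , 0<δ , λ y near → let (a , b) = p y near in
          <-respˡ (flip (f y) (f x)) b , <-respˡ (flip (f x) (f y)) a
        where
        flip : ∀ u v → u - v ≈ - v - - u
        flip = solve 2 (λ u v → u :- v := (:- v) :- (:- u)) ℝ.refl

    opaque
      cont-⊔ : ∀ {f g} → Cont X f → Cont X g → Cont X (λ x → f x ⊔ g x)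
      cont-⊔ {f} {g} cf cg x ε 0<ε =
        let 0<η           = *-pos 0<½ 0<ε
            (δ , 0<δ , p) = both cf cg x (½ * ε) (½ * ε) 0<η 0<η
        in δ , 0<δ , λ y near → let (a , c) = p y near in close⇒within (half< 0<ε)
          ( bound (proj₁ (within⇒close a)) (proj₁ (within⇒close c))
          , bound (proj₂ (within⇒close a)) (proj₂ (within⇒close c)))
        where
        bound : ∀ {η u v w z} → u ≤ v + η → w ≤ z + η → u ⊔ w ≤ v ⊔ z + η
        bound p q = ⊔-lub (≤-trans p (+-mono-≤ (x≤x⊔y _ _) ≤-refl)) (≤-trans q (+-mono-≤ (y≤x⊔y _ _) ≤-refl))

    Bounded : ℝ → ℝ → Set
    Bounded b x = x ≤ b × - x ≤ b

    bounded-neg : ∀ {b x} → Bounded b x → Bounded b (- x)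
    bounded-neg {b} {x} (p , q) = q , ≤-respˡ (solve 1 (λ x → x := :- (:- x)) ℝ.refl x) p

    opaque
      -- Twice a b - x y equals (a - x)(b + y) + (a + x)(b - y), a sum of products of nonnegative
      -- numbers. This avoids a case distinction on signs.
      bounded-* : ∀ {a b x y} → Bounded a x → Bounded b y → x * y ≤ a * b
      bounded-* {a} {b} {x} {y} (p₁ , p₂) (q₁ , q₂) = ≤-by (*-cancelˡ-nonneg (+-pos 0<1 0<1) (≤-respʳ
        (solve 4 (λ a b x y → (a :- x) :* (b :- (:- y)) :+ (a :- (:- x)) :* (b :- y) :=
                              con (+ 2) :* (a :* b :- x :* y)) ℝ.refl a b x y)
        (+-nonneg (*-nonneg (≤⇒0≤ p₁) (≤⇒0≤ q₂)) (*-nonneg (≤⇒0≤ p₂) (≤⇒0≤ q₁))))) ℝ.refl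

    opaque
      close⇒bounded : ∀ {η x y} → Close η x y → Bounded η (x - y)
      close⇒bounded {η} {x} {y} (p , q) =
        ≤-by (≤⇒0≤ p) (solve 3 (λ η x y → y :+ η :- x := η :- (x :- y)) ℝ.refl η x y) ,
        ≤-by (≤⇒0≤ q) (solve 3 (λ η x y → x :+ η :- y := η :- (:- (x :- y))) ℝ.refl η x y)

    opaque
      -- The difference of the products is (f - f′) g + (g - g′) f - (f - f′)(g - g′). Each of the
      -- three terms is at most η b, the last one because η ≤ b.
      product-close : ∀ {η b f f′ g g′} → Close η f f′ → Close η g g′ → Bounded b f → Bounded b g →
        η ≤ b → Close (η * b + η * b + η * b) (f * g) (f′ * g′)
      product-close {η} {b} {f} {f′} {g} {g′} p q f≤b g≤b η≤b =
        ≤-respˡ (solve 4 (λ f f′ g g′ → f′ :* g′ :+ ((f :- f′) :* g :+ (g :- g′) :* f :+ (f :- f′) :* (:- (g :- g′))) :=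
            f :* g) ℝ.refl f f′ g g′)
          (+-mono-≤ ≤-refl (+-mono-≤ (+-mono-≤ (bounded-* u g≤b) (bounded-* v f≤b)) (bounded-* u (bounded-neg (widen v))))) ,
        ≤-respˡ (solve 4 (λ f f′ g g′ → f :* g :+ ((:- (f :- f′)) :* g :+ (:- (g :- g′)) :* f :+ (f :- f′) :* (g :- g′)) :=
            f′ :* g′) ℝ.refl f f′ g g′)
          (+-mono-≤ ≤-refl (+-mono-≤ (+-mono-≤ (bounded-* (bounded-neg u) g≤b) (bounded-* (bounded-neg v) f≤b)) (bounded-* u (widen v))))
        where
        u : Bounded η (f - f′)
        u = close⇒bounded p
        v : Bounded η (g - g′)
        v = close⇒bounded q
        widen : ∀ {x} → Bounded η x → Bounded b x
        widen (l , r) = ≤-trans l η≤b , ≤-trans r η≤b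

    opaque
      cont-* : ∀ {f g} → Cont X f → Cont X g → Cont X (λ x → f x * g x)
      cont-* {f} {g} cf cg x ε 0<ε =
        -- `b` bounds both absolute values, and its summand 1 makes it positive. With z = 1 / (3 b),
        -- a threshold of at most `½ * ε * z` keeps the three error terms together below `½ * ε`.
        let (z , 0<z , cz≈1) = inverse (*-pos 0<3 0<b)
            0<η′          = *-pos (*-pos 0<½ 0<ε) 0<z
            0<η           = ⊓-pos 0<b 0<η′
            (δ , 0<δ , p) = both cf cg x (b ⊓ (½ * ε * z)) (b ⊓ (½ * ε * z)) 0<η 0<η
        in δ , 0<δ , λ y near → let (u , v) = p y near in close⇒within
          (≤-<-trans (small z cz≈1) (half< 0<ε))
          (product-close (within⇒close u) (within⇒close v) (f≤b , -f≤b) (g≤b , -g≤b) (x⊓y≤x _ _))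
        where
        F G b : ℝ
        F = f x ⊔ - f x
        G = g x ⊔ - g x
        b = F + G + 1#
        0≤abs : ∀ u → 0# ≤ u ⊔ - u
        0≤abs u = <-or-≤ ≤-stable 0# u (λ 0<u → ≤-trans (<⇒≤ 0<u) (x≤x⊔y _ _))
          (λ u≤0 → ≤-trans (neg-nonneg u≤0) (y≤x⊔y _ _))
        0≤F : 0# ≤ F
        0≤F = 0≤abs (f x)
        0≤G : 0# ≤ G
        0≤G = 0≤abs (g x)
        F≤b : F ≤ b
        F≤b = ≤-by (+-nonneg 0≤G (<⇒≤ 0<1)) (solve 2 (λ F G → G :+ con (+ 1) := F :+ G :+ con (+ 1) :- F) ℝ.refl F G)
        G≤b : G ≤ b
        G≤b = ≤-by (+-nonneg 0≤F (<⇒≤ 0<1)) (solve 2 (λ F G → F :+ con (+ 1) := F :+ G :+ con (+ 1) :- G) ℝ.refl F G)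
        f≤b : f x ≤ b
        f≤b = ≤-trans (x≤x⊔y _ _) F≤b
        -f≤b : - f x ≤ b
        -f≤b = ≤-trans (y≤x⊔y _ _) F≤b
        g≤b : g x ≤ b
        g≤b = ≤-trans (x≤x⊔y _ _) G≤b
        -g≤b : - g x ≤ b
        -g≤b = ≤-trans (y≤x⊔y _ _) G≤b
        0<b : 0# < b
        0<b = <-respʳ (ℝ.+-comm _ _) (+-pos-nonneg 0<1 (+-nonneg 0≤F 0≤G))
        0<3 : 0# < 3#
        0<3 = +-pos (+-pos 0<1 0<1) 0<1
        small : ∀ z → 3# * b * z ≈ 1# → let m = (b ⊓ (½ * ε * z)) * b in m + m + m ≤ ½ * ε
        small z cz≈1 = ≤-by (*-nonneg (<⇒≤ (*-pos 0<3 0<b)) (≤⇒0≤ (x⊓y≤y b (½ * ε * z))))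
          (ℝ.trans (solve 4 (λ b e z m → con (+ 3) :* b :* (e :* z :- m) :=
              e :* (con (+ 3) :* b :* z) :- (m :* b :+ m :* b :+ m :* b)) ℝ.refl b (½ * ε) z (b ⊓ (½ * ε * z)))
            (ℝ.+-congʳ (ℝ.trans (ℝ.*-congˡ cz≈1) (ℝ.*-identityʳ _))))

    recip : (f : Point X → ℝ) → (∀ x → 0# < f x) → Point X → ℝ
    recip f 0<f x = proj₁ (inverse (0<f x))

    root : (f : Point X → ℝ) → (∀ x → 0# < f x) → Point X → ℝ
    root f 0<f x = proj₁ (sqrt (0<f x))

    opaque
      quotient-bound : ∀ {p d e z z′} → 0# < p → p * (z - z′) ≈ d → d ≤ e * p → z ≤ z′ + e
      quotient-bound {p} {d} {e} {z} {z′} 0<p pz≈d d≤ep = ≤-by (*-cancelˡ-nonneg 0<p (≤-respʳ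
        (ℝ.trans (ℝ.+-congˡ (ℝ.-‿cong (ℝ.sym pz≈d)))
          (solve 4 (λ p e z z′ → e :* p :- p :* (z :- z′) := p :* (z′ :+ e :- z)) ℝ.refl p e z z′))
        (≤⇒0≤ d≤ep))) ℝ.refl

    opaque
      -- The reciprocals differ by (a′ - a) / (a a′). The first bound on `η` keeps a′ above a / 2,
      -- and the second makes the numerator at most e a (a / 2), hence at most e a a′.
      recip-close : ∀ {a a′ z z′ e η} → 0# < a → 0# < a′ → 0# < e → a * z ≈ 1# → a′ * z′ ≈ 1# →
        η ≤ ½ * a → η ≤ e * a * (½ * a) → Close η a a′ → Close e z z′
      recip-close {a} {a′} {z} {z′} {e} {η} 0<a 0<a′ 0<e az≈1 a′z′≈1 η≤½a η≤ea½a (p , q) =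
        quotient-bound (*-pos 0<a 0<a′)
          (ℝ.trans (solve 4 (λ a a′ z z′ → a :* a′ :* (z :- z′) := a′ :* (a :* z) :- a :* (a′ :* z′)) ℝ.refl a a′ z z′)
            (ℝ.+-cong (times-one az≈1) (ℝ.-‿cong (times-one a′z′≈1))))
          (≤-trans (≤-by (≤⇒0≤ q) (solve 3 (λ a a′ η → a :+ η :- a′ := η :- (a′ :- a)) ℝ.refl a a′ η)) η≤eaa′) ,
        quotient-bound (*-pos 0<a 0<a′)
          (ℝ.trans (solve 4 (λ a a′ z z′ → a :* a′ :* (z′ :- z) := a :* (a′ :* z′) :- a′ :* (a :* z)) ℝ.refl a a′ z z′)
            (ℝ.+-cong (times-one a′z′≈1) (ℝ.-‿cong (times-one az≈1))))
          (≤-trans (≤-by (≤⇒0≤ p) (solve 3 (λ a a′ η → a′ :+ η :- a := η :- (a :- a′)) ℝ.refl a a′ η)) η≤eaa′)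
        where
        times-one : ∀ {x y} → y ≈ 1# → x * y ≈ x
        times-one y≈1 = ℝ.trans (ℝ.*-congˡ y≈1) (ℝ.*-identityʳ _)
        ½a≤a′ : ½ * a ≤ a′
        ½a≤a′ = ≤-by (+-nonneg (≤⇒0≤ p) (≤⇒0≤ η≤½a)) (ℝ.trans
          (ℝ.+-congʳ (ℝ.+-congˡ (ℝ.-‿cong (ℝ.sym (halves a)))))
          (solve 3 (λ a′ η h → (a′ :+ η :- (h :+ h)) :+ (h :- η) := a′ :- h) ℝ.refl a′ η (½ * a)))
        η≤eaa′ : η ≤ e * (a * a′)
        η≤eaa′ = ≤-trans η≤ea½a (≤-respʳ (ℝ.*-assoc e a a′) (*-monoˡ-≤ (<⇒≤ (*-pos 0<e 0<a)) ½a≤a′))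

    opaque
      cont-recip : ∀ {f} → Cont X f → (0<f : ∀ x → 0# < f x) → Cont X (recip f 0<f)
      cont-recip {f} cf 0<f x ε 0<ε =
        let 0<a           = 0<f x
            0<e           = *-pos 0<½ 0<ε
            (δ , 0<δ , p) = cf x ((½ * f x) ⊓ (½ * ε * f x * (½ * f x)))
                              (⊓-pos (*-pos 0<½ 0<a) (*-pos (*-pos 0<e 0<a) (*-pos 0<½ 0<a)))
        in δ , 0<δ , λ y near → close⇒within (half< 0<ε)
          (recip-close 0<a (0<f y) 0<e (proj₂ (proj₂ (inverse (0<f x)))) (proj₂ (proj₂ (inverse (0<f y))))
            (x⊓y≤x _ _) (x⊓y≤y _ _) (within⇒close (p y near)))

    opaque
      -- Since a - a′ = (s - s′)(s + s′), an error of s e in the square is less than (s + s′) e and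
      -- leaves an error of at most e in the root.
      root-close : ∀ {a a′ s s′ e} → 0# < s → 0# < s′ → 0# < e → s * s ≈ a → s′ * s′ ≈ a′ →
        Close (s * e) a a′ → Close e s s′
      root-close {a} {a′} {s} {s′} {e} 0<s 0<s′ 0<e s²≈a s′²≈a′ (p , q) =
        ≤-by (*-cancelˡ-nonneg (+-pos 0<s 0<s′) (≤-respʳ
          (ℝ.trans (ℝ.+-congʳ (ℝ.+-cong (ℝ.+-congʳ (ℝ.sym s′²≈a′)) (ℝ.-‿cong (ℝ.sym s²≈a))))
            (solve 3 (λ s s′ e → (s′ :* s′ :+ s :* e :- s :* s) :+ s′ :* e := (s :+ s′) :* ((s′ :+ e) :- s)) ℝ.refl s s′ e))
          (+-nonneg (≤⇒0≤ p) (<⇒≤ (*-pos 0<s′ 0<e))))) ℝ.refl ,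
        ≤-by (*-cancelˡ-nonneg (+-pos 0<s 0<s′) (≤-respʳ
          (ℝ.trans (ℝ.+-congʳ (ℝ.+-cong (ℝ.+-congʳ (ℝ.sym s²≈a)) (ℝ.-‿cong (ℝ.sym s′²≈a′))))
            (solve 3 (λ s s′ e → (s :* s :+ s :* e :- s′ :* s′) :+ s′ :* e := (s :+ s′) :* ((s :+ e) :- s′)) ℝ.refl s s′ e))
          (+-nonneg (≤⇒0≤ q) (<⇒≤ (*-pos 0<s′ 0<e))))) ℝ.refl

    opaque
      cont-root : ∀ {f} → Cont X f → (0<f : ∀ x → 0# < f x) → Cont X (root f 0<f)
      cont-root {f} cf 0<f x ε 0<ε =
        let (s , 0<s , s²≈a) = sqrt (0<f x)
            0<e              = *-pos 0<½ 0<ε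
            (δ , 0<δ , p)    = cf x (s * (½ * ε)) (*-pos 0<s 0<e)
        in δ , 0<δ , λ y near → let (s′ , 0<s′ , s′²≈a′) = sqrt (0<f y) in close⇒within (half< 0<ε)
          (root-close 0<s 0<s′ 0<e s²≈a s′²≈a′ (within⇒close (p y near)))

    cont-minus : ∀ {f g} → Cont X f → Cont X g → Cont X (λ x → f x - g x)
    cont-minus cf cg = cont-+ cf (cont-neg cg)

    cont-⊓ : ∀ {f g} → Cont X f → Cont X g → Cont X (λ x → f x ⊓ g x)
    cont-⊓ cf cg = cont-neg (cont-⊔ (cont-neg cf) (cont-neg cg))

    cont-sum : ∀ {n} {f : Point X → Fin n → ℝ} → (∀ i → Cont X (λ x → f x i)) → Cont X (λ x → sum (f x))
    cont-sum {zero}  cf = cont-const 0#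
    cont-sum {suc n} cf = cont-+ (cf zero) (cont-sum (λ i → cf (suc i)))

-- Homotopies and the composition of homotopy equivalences.

module Homotopies (R : RealField) where

  open OrderedField R
  open Continuity R
  open import Data.Fin.Base using (zero)
  open import Data.Integer.Base using (+_)
  open import Data.Product.Base using (_,_; proj₁; proj₂)
  open import Data.Sum.Base using (inj₁; inj₂)
  open import Function.Base using (_∘_)
  open import Relation.Nullary using (Stable)
  open RealField R
  open Topology R
  open Space
  open Map
  open Homotopy
  open _≃_
  open Solver using (solve; con; _:=_; _:+_; _:*_; _:-_; :-_)

  -- Stability allows membership of a given point to be proved by undecidable case distinctions;
  -- `respects` carries it over to coordinates that are equal only up to `≈`.
  record StableSpace (X : Space) : Set where
    field
      stable   : ∀ x → Stable (In X x)
      respects : ∀ {x y} → (∀ i → x i ≈ y i) → In X x → In X y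

  open StableSpace

  π₁ : ∀ X Y → Map (X ×ˢ Y) X
  π₁ X Y = mapOf (X ×ˢ Y) X (λ z → proj₁ z ∘ inj₁) (proj₁ ∘ proj₂) (λ i → cont-coord (X ×ˢ Y) (inj₁ i))

  π₂ : ∀ X Y → Map (X ×ˢ Y) Y
  π₂ X Y = mapOf (X ×ˢ Y) Y (λ z → proj₁ z ∘ inj₂) (proj₂ ∘ proj₂) (λ i → cont-coord (X ×ˢ Y) (inj₂ i))

  ⟨_,_⟩ : ∀ {X Y Z} → Map Z X → Map Z Y → Map Z (X ×ˢ Y)
  ⟨_,_⟩ {X} {Y} {Z} f g = mapOf Z (X ×ˢ Y) (λ z → proj₁ (pair X Y (fun f z) (fun g z)))
    (λ z → proj₂ (pair X Y (fun f z) (fun g z)))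
    λ { (inj₁ i) → map-cont Z X f i ; (inj₂ j) → map-cont Z Y g j }

  pair-cong : ∀ X Y x x′ y y′ → Eq X x x′ → Eq Y y y′ → Eq (X ×ˢ Y) (pair X Y x y) (pair X Y x′ y′)
  pair-cong X Y x x′ y y′ p q (inj₁ i) = p i
  pair-cong X Y x x′ y y′ p q (inj₂ j) = q j

  constᵐ : ∀ {X} Y → Point Y → Map X Y
  constᵐ {X} Y y = mapOf X Y (λ _ → proj₁ y) (λ _ → proj₂ y) (λ i → cont-const X (proj₁ y i))

  homotopy-by-≈ : ∀ {X Y} (f : Map X Y) (g : Point X → Point Y) → (∀ x → Eq Y (fun f x) (g x)) →
                  Homotopy X Y (fun f) g
  homotopy-by-≈ {X} {Y} f g f≈g = record
    { homotopy = f ∘ᵐ π₁ X interval ; at-start = λ x i → ℝ.refl ; at-end = f≈g }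

  postcompose : ∀ {X Y Z} {f g : Point X → Point Y} (k : Map Y Z) → Homotopy X Y f g →
                Homotopy X Z (fun k ∘ f) (fun k ∘ g)
  postcompose {X} {Y} {Z} k H = record
    { homotopy = k ∘ᵐ homotopy H
    ; at-start = λ x → map-cong Y Z k (at-start H x)
    ; at-end   = λ x → map-cong Y Z k (at-end H x)
    }

  precompose : ∀ {X Y Z} {f g : Point Y → Point Z} → Homotopy Y Z f g → (k : Map X Y) →
               Homotopy X Z (f ∘ fun k) (g ∘ fun k)
  precompose {X} {Y} {Z} H k = record
    { homotopy = homotopy H ∘ᵐ lift
    ; at-start = λ x i → ℝ.trans (map-cong (Y ×ˢ interval) Z (homotopy H) {fun lift (pair X interval x start)} {pair Y interval (fun k x) start} (same x start) i) (at-start H (fun k x) i)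
    ; at-end   = λ x i → ℝ.trans (map-cong (Y ×ˢ interval) Z (homotopy H) {fun lift (pair X interval x end)} {pair Y interval (fun k x) end} (same x end) i) (at-end H (fun k x) i)
    }
    where
    lift : Map (X ×ˢ interval) (Y ×ˢ interval)
    lift = ⟨ k ∘ᵐ π₁ X interval , π₂ X interval ⟩
    same : ∀ x t → Eq (Y ×ˢ interval)
      (fun lift (pair X interval x t)) (pair Y interval (fun k x) t)
    same x t (inj₁ i) = ℝ.refl
    same x t (inj₂ j) = ℝ.refl

  -- The clocks of a concatenation, written without cases: this one runs until time 1/2 and then
  -- rests at 1, while `clamp≥0` rests at 0 until time 1/2 and then runs.
  clamp≤1 : Map interval interval
  clamp≤1 = mapOf interval interval (λ t _ → (2# * proj₁ t zero) ⊓ 1#)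
    (λ (t , 0≤t , t≤1) → ⊓-glb (*-nonneg (<⇒≤ (+-pos 0<1 0<1)) 0≤t) (<⇒≤ 0<1) , x⊓y≤y _ _)
    (λ _ → cont-⊓ interval (cont-* interval (cont-const interval 2#) (cont-coord interval zero)) (cont-const interval 1#))

  clamp≥0 : Map interval interval
  clamp≥0 = mapOf interval interval (λ t _ → (2# * proj₁ t zero - 1#) ⊔ 0#)
    (λ (t , 0≤t , t≤1) → y≤x⊔y _ _ , ⊔-lub (≤-by (*-nonneg (<⇒≤ (+-pos 0<1 0<1)) (≤⇒0≤ t≤1))
      (solve 1 (λ t → con (+ 2) :* (con (+ 1) :- t) := con (+ 1) :- (con (+ 2) :* t :- con (+ 1))) ℝ.refl (t zero))) (<⇒≤ 0<1))
    (λ _ → cont-⊔ interval (cont-minus interval (cont-* interval (cont-const interval 2#) (cont-coord interval zero))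
      (cont-const interval 1#)) (cont-const interval 0#))

  -- Constructively [0,1] is not the union of its halves, so the two homotopies
  -- are not glued: at every time one of the first two terms cancels the third.
  concatenate : ∀ {X Y} {f g h : Point X → Point Y} → StableSpace Y →
                Homotopy X Y f g → Homotopy X Y g h → Homotopy X Y f h
  concatenate {X} {Y} {f} {g} {h} Y-stable H K = record
    { homotopy = mapOf XI Y value value∈Y λ i →
        cont-minus XI (cont-+ XI (map-cont XI Y first i) (map-cont XI Y second i)) (map-cont XI Y middle i)
    ; at-start = λ x i → let z = pair X interval x start in ℝ.trans (early z 2·0≤1 i)
        (ℝ.trans (slide (homotopy H) x (fun clamp≤1 start) start (ℝ.trans (x≤y⇒x⊓y≈x 2·0≤1) (ℝ.zeroʳ 2#)) i)
          (at-start H x i))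
    ; at-end = λ x i → let z = pair X interval x end in ℝ.trans (late z 1≤2 i)
        (ℝ.trans (slide (homotopy K) x (fun clamp≥0 end) end
          (ℝ.trans (y≤x⇒x⊔y≈x (≤⇒0≤ 1≤2)) (solve 0 (con (+ 2) :* con (+ 1) :- con (+ 1) := con (+ 1)) ℝ.refl)) i)
          (at-end K x i))
    }
    where
    XI : Space
    XI = X ×ˢ interval

    space-part : Point XI → Point X
    space-part = fun (π₁ X interval)

    time-part : Point XI → Point interval
    time-part = fun (π₂ X interval)

    first second middle : Map XI Y
    first  = homotopy H ∘ᵐ ⟨ π₁ X interval , clamp≤1 ∘ᵐ π₂ X interval ⟩
    second = homotopy K ∘ᵐ ⟨ π₁ X interval , clamp≥0 ∘ᵐ π₂ X interval ⟩
    middle = homotopy H ∘ᵐ ⟨ π₁ X interval , constᵐ {XI} interval end ⟩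

    value : Point XI → Coord Y → ℝ
    value z i = proj₁ (fun first z) i + proj₁ (fun second z) i - proj₁ (fun middle z) i

    time : Point XI → ℝ
    time z = proj₁ z (inj₂ zero)

    slide : (G : Map XI Y) → ∀ x s t → proj₁ s zero ≈ proj₁ t zero →
            Eq Y (fun G (pair X interval x s)) (fun G (pair X interval x t))
    slide G x s t s≈t = map-cong XI Y G {pair X interval x s} {pair X interval x t}
      (pair-cong X interval x x s t (λ _ → ℝ.refl) λ { zero → s≈t })

    2·0≤1 : 2# * 0# ≤ 1#
    2·0≤1 = ≤-respˡ (ℝ.sym (ℝ.zeroʳ 2#)) (<⇒≤ 0<1)

    1≤2 : 1# ≤ 2# * 1#
    1≤2 = ≤-by (<⇒≤ 0<1) (solve 0 (con (+ 1) := con (+ 2) :* con (+ 1) :- con (+ 1)) ℝ.refl)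

    early : ∀ z → 2# * time z ≤ 1# → ∀ i → value z i ≈ proj₁ (fun first z) i
    early z 2t≤1 i = ℝ.trans
      (ℝ.+-cong (ℝ.+-congˡ (ℝ.trans (slide (homotopy K) (space-part z) (fun clamp≥0 (time-part z)) start
          (x≤y⇒x⊔y≈y (≤-by (≤⇒0≤ 2t≤1)
            (solve 1 (λ t → con (+ 1) :- t := con (+ 0) :- (t :- con (+ 1))) ℝ.refl (2# * time z)))) i)
          (at-start K (space-part z) i)))
        (ℝ.-‿cong (at-end H (space-part z) i)))
      (solve 2 (λ a b → a :+ b :- b := a) ℝ.refl _ _)

    late : ∀ z → 1# ≤ 2# * time z → ∀ i → value z i ≈ proj₁ (fun second z) i
    late z 1≤2t i = ℝ.trans
      (ℝ.+-congʳ (ℝ.+-congʳ (slide (homotopy H) (space-part z) (fun clamp≤1 (time-part z)) end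
        (y≤x⇒x⊓y≈y 1≤2t) i)))
      (solve 2 (λ a b → a :+ b :- a := b) ℝ.refl _ _)

    value∈Y : ∀ z → In Y (value z)
    value∈Y z = <-or-≤ (stable Y-stable (value z)) (2# * time z) 1#
      (λ 2t<1 → respects Y-stable (λ i → ℝ.sym (early z (<⇒≤ 2t<1) i)) (proj₂ (fun first z)))
      (λ 1≤2t → respects Y-stable (λ i → ℝ.sym (late z 1≤2t i)) (proj₂ (fun second z)))

  ≃-sym : ∀ {X Y} → X ≃ Y → Y ≃ X
  ≃-sym e = record { to = from e ; from = to e ; from∘to = to∘from e ; to∘from = from∘to e }

  ≃-trans : ∀ {X Y Z} → StableSpace X → StableSpace Z → X ≃ Y → Y ≃ Z → X ≃ Z
  ≃-trans X-stable Z-stable e e′ = record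
    { to      = to e′ ∘ᵐ to e
    ; from    = from e ∘ᵐ from e′
    ; from∘to = concatenate X-stable (postcompose (from e) (precompose (from∘to e′) (to e))) (from∘to e)
    ; to∘from = concatenate Z-stable (postcompose (to e′) (precompose (to∘from e) (from e′))) (to∘from e′)
    }

-- Realizations of complexes: contiguity, simplicial maps and the removal of faces.

module Realizations (R : RealField) where

  open OrderedField R
  open Continuity R
  open Homotopies R
  import Algebra.Properties.Semiring.Sum as SemiringSum
  open import Data.Bool.Base using (if_then_else_)
  open import Data.Empty using (⊥)
  open import Data.Fin.Base using (Fin; zero; suc)
  open import Data.Fin.Properties using (_≟_)
  open import Data.Fin.Subset using (Subset; _∈_; _∉_; _⊆_; _∪_; ⁅_⁆; inside; outside)
  open import Data.Fin.Subset.Properties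
    using (_∈?_; _⊆?_; x∈⁅x⁆; p⊆p∪q; q⊆p∪q; ⊆-trans)
  open import Data.Integer.Base using (+_)
  open import Data.Nat.Base using (ℕ; zero; suc)
  open import Data.Product.Base using (_×_; _,_; proj₁; proj₂)
  open import Data.Sum.Base using (inj₂)
  open import Data.Vec.Base using ([]; _∷_; here; there)
  open import Function.Base using (_∘_; id)
  open import Function.Construct.Identity using (↔-id)
  import Relation.Binary.PropositionalEquality as ≡
  open ≡ using (_≡_; _≢_)
  open import Relation.Nullary using (Stable; yes; no; does)
  open import Relation.Nullary.Decidable using (decidable-stable)
  open import Relation.Nullary.Negation using (¬_; contradiction)
  open RealField R
  open Topology R
  open Space
  open Map
  open Solver using (solve; con; _:=_; _:+_; _:*_; _:-_; :-_)
  open SemiringSum ℝ.semiring using (sum-cong-≋; ∑-distrib-+; ∑-comm; *-distribˡ-sum; sum-replicate-zero)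

  record Faces (n : ℕ) : Set₁ where
    field
      Face   : Subset n → Set
      down   : ∀ {σ τ} → σ ⊆ τ → Face τ → Face σ
      stable : ∀ {σ} → Stable (Face σ)

  open Faces public

  -- ∥ K ∥ for a set of faces that need not contain all the vertices.
  ∣_∣ : ∀ {n} → Faces n → Space
  ∣_∣ {n} F = record
    { Coord  = Fin n
    ; finite = _ , ↔-id _
    ; In     = λ x → (∀ v → 0# ≤ x v)
                   × sum x ≈ 1#
                   × (∀ σ → (∀ {v} → v ∈ σ → 0# < x v) → Face F σ)
    }

  record Support {n} (x : Fin n → ℝ) (τ : Subset n) : Set where
    field
      pos⇒∈ : ∀ {v} → 0# < x v → v ∈ τ
      ∈⇒pos : ∀ {v} → v ∈ τ → 0# < x v

  open Support

  opaque
    -- Which weights are positive cannot be decided, so a support exists only up to double negation.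
    -- That is enough for a stable conclusion.
    by-support : ∀ {n} {A : Set} → Stable A → (x : Fin n → ℝ) → (∀ τ → Support x τ → A) → A
    by-support {zero}  stable x f = f [] record { pos⇒∈ = λ { {()} } ; ∈⇒pos = λ { {()} } }
    by-support {suc n} {A} stable x f = by-support stable (x ∘ suc) λ τ s →
      <-or-≤ stable 0# (x zero)
        (λ 0<x → f (inside ∷ τ) record
          { pos⇒∈ = λ { {zero} _ → here ; {suc v} p → there (pos⇒∈ s p) }
          ; ∈⇒pos = λ { here → 0<x ; (there v∈τ) → ∈⇒pos s v∈τ } })
        (λ x≤0 → f (outside ∷ τ) record
          { pos⇒∈ = λ { {zero} p → contradiction p x≤0 ; {suc v} p → there (pos⇒∈ s p) }
          ; ∈⇒pos = λ { (there v∈τ) → ∈⇒pos s v∈τ } })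

  module _ {n} (F : Faces n) where

    opaque
      stableSpace : StableSpace ∣ F ∣
      stableSpace = record
        { stable = λ x ¬¬x∈ →
            (λ v → ≤-stable λ k → ¬¬x∈ λ (p , _) → k (p v)) ,
            ≈-stable (λ k → ¬¬x∈ λ (_ , p , _) → k p) ,
            λ σ σ⊆ → stable F λ k → ¬¬x∈ λ (_ , _ , p) → k (p σ σ⊆)
        ; respects = λ x≈y (p , q , r) →
            (λ v → ≤-respʳ (x≈y v) (p v)) ,
            ℝ.trans (sum-cong-≋ (λ v → ℝ.sym (x≈y v))) q ,
            λ σ σ⊆ → r σ (λ v∈σ → <-respʳ (ℝ.sym (x≈y _)) (σ⊆ v∈σ))
        }

    opaque
      support-face : (x : Point ∣ F ∣) → ∀ {τ} → Support (proj₁ x) τ → Face F τ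
      support-face x s = proj₂ (proj₂ (proj₂ x)) _ (∈⇒pos s)

  -- The condition on v is the stable form of 0# < x v ⊎ 0# < y v.
  Contiguous : ∀ {n} → Faces n → (x y : Fin n → ℝ) → Set
  Contiguous F x y = ∀ σ → (∀ {v} → v ∈ σ → ¬ (x v ≤ 0# × y v ≤ 0#)) → Face F σ

  opaque
    contiguous-by : ∀ {n} (F : Faces n) {x y} τ → Face F τ → (∀ {v} → 0# < x v → v ∈ τ) →
                    (∀ {v} → 0# < y v → v ∈ τ) → Contiguous F x y
    contiguous-by F τ Fτ x⊆τ y⊆τ σ σ⊆ = down F (λ {v} v∈σ → decidable-stable (v ∈? τ) λ v∉τ →
      σ⊆ v∈σ ((λ 0<x → v∉τ (x⊆τ 0<x)) , (λ 0<y → v∉τ (y⊆τ 0<y)))) Fτ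

  opaque
    contiguous-stable : ∀ {n} (F : Faces n) {x y} → Stable (Contiguous F x y)
    contiguous-stable F ¬¬c σ σ⊆ = stable F λ k → ¬¬c λ c → k (c σ σ⊆)

  opaque
    sum-linear : ∀ {n} (x y : Fin n → ℝ) a → sum (λ v → x v + a * y v) ≈ sum x + a * sum y
    sum-linear x y a = ℝ.trans (∑-distrib-+ x (λ v → a * y v)) (ℝ.+-congˡ (ℝ.sym (*-distribˡ-sum a y)))

  opaque
    -- A convex combination has positive weight only at vertices where one of its two ends has, so
    -- by contiguity the whole segment lies in the realization.
    linear-homotopy : ∀ {n} {X : Space} (F : Faces n) (f g : Map X ∣ F ∣) →
      (∀ x → Contiguous F (proj₁ (fun f x)) (proj₁ (fun g x))) → Homotopy X ∣ F ∣ (fun f) (fun g)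
    linear-homotopy {n} {X} F f g contiguous = record
      { homotopy = mapOf XI ∣ F ∣ h h∈F λ v →
          cont-+ XI (along f v) (cont-* XI (cont-coord XI (inj₂ zero)) (cont-minus XI (along g v) (along f v)))
      ; at-start = λ x v → ℝ.trans (ℝ.+-congˡ (ℝ.zeroˡ _)) (ℝ.+-identityʳ _)
      ; at-end   = λ x v → ℝ.trans (ℝ.+-congˡ (ℝ.*-identityˡ _))
          (solve 2 (λ a b → a :+ (b :- a) := b) ℝ.refl _ _)
      }
      where
      XI : Space
      XI = X ×ˢ interval
      base : Point XI → Point X
      base = fun (π₁ X interval)
      h : Point XI → Fin n → ℝ
      h z v = proj₁ (fun f (base z)) v + proj₁ z (inj₂ zero) * (proj₁ (fun g (base z)) v - proj₁ (fun f (base z)) v)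
      along : (k : Map X ∣ F ∣) → ∀ v → Cont XI (λ z → proj₁ (fun k (base z)) v)
      along k = map-cont XI ∣ F ∣ (k ∘ᵐ π₁ X interval)
      convex : ∀ a b t → (1# - t) * a + t * b ≈ a + t * (b - a)
      convex = solve 3 (λ a b t → (con (+ 1) :- t) :* a :+ t :* b := a :+ t :* (b :- a)) ℝ.refl
      h∈F : ∀ z → In ∣ F ∣ (h z)
      h∈F z@(_ , _ , 0≤t , t≤1) =
        let (a , a≥0 , Σa≈1 , _) = fun f (base z)
            (b , b≥0 , Σb≈1 , _) = fun g (base z)
            t = proj₁ z (inj₂ zero)
        in (λ v → ≤-respʳ (convex (a v) (b v) t) (+-nonneg (*-nonneg (≤⇒0≤ t≤1) (a≥0 v)) (*-nonneg 0≤t (b≥0 v))))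
         , ℝ.trans (sum-linear a (λ v → b v - a v) t)
             (ℝ.trans (ℝ.+-cong Σa≈1 (ℝ.trans (ℝ.*-congˡ
               (ℝ.trans (sum-cong-≋ (λ v → ℝ.+-congˡ {b v} (solve 1 (λ a → :- a := (con (+ 0) :- con (+ 1)) :* a) ℝ.refl (a v))))
                 (ℝ.trans (sum-linear b a (0# - 1#)) (ℝ.trans (ℝ.+-cong Σb≈1 (ℝ.*-congˡ Σa≈1))
                   (solve 0 (con (+ 1) :+ (con (+ 0) :- con (+ 1)) :* con (+ 1) := con (+ 0)) ℝ.refl)))))
               (ℝ.zeroʳ t))) (ℝ.+-identityʳ 1#))
         , λ σ σ⊆ → contiguous (base z) σ λ {v} v∈σ (a≤0 , b≤0) →
             ≤-by (+-nonneg (*-nonneg (≤⇒0≤ t≤1) (neg-nonneg a≤0)) (*-nonneg 0≤t (neg-nonneg b≤0)))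
               (solve 3 (λ a b t → (con (+ 1) :- t) :* (:- a) :+ t :* (:- b) := con (+ 0) :- (a :+ t :* (b :- a)))
                 ℝ.refl (a v) (b v) t) (σ⊆ v∈σ)

  contiguous-≃ : ∀ {m n} (F : Faces m) (G : Faces n) (f : Map ∣ F ∣ ∣ G ∣) (g : Map ∣ G ∣ ∣ F ∣) →
    (∀ x → Contiguous F (proj₁ (fun g (fun f x))) (proj₁ x)) →
    (∀ y → Contiguous G (proj₁ (fun f (fun g y))) (proj₁ y)) → ∣ F ∣ ≃ ∣ G ∣
  contiguous-≃ F G f g gf fg = record
    { to      = f
    ; from    = g
    ; from∘to = linear-homotopy F (g ∘ᵐ f) (idᵐ ∣ F ∣) gf
    ; to∘from = linear-homotopy G (f ∘ᵐ g) (idᵐ ∣ G ∣) fg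
    }

  inclusion : ∀ {n} (F G : Faces n) → (∀ τ → Face F τ → Face G τ) → Map ∣ F ∣ ∣ G ∣
  inclusion F G F⊆G = mapOf ∣ F ∣ ∣ G ∣ proj₁
    (λ (x , x≥0 , Σx≈1 , carried) → x≥0 , Σx≈1 , λ σ σ⊆ → F⊆G σ (carried σ σ⊆)) (cont-coord ∣ F ∣)

  opaque
    contiguous-refl : ∀ {n} (F : Faces n) (x : Point ∣ F ∣) → Contiguous F (proj₁ x) (proj₁ x)
    contiguous-refl F x = by-support (contiguous-stable F) (proj₁ x) λ τ s →
      contiguous-by F τ (support-face F x s) (pos⇒∈ s) (pos⇒∈ s)

  SameFaces : ∀ {n} → Faces n → Faces n → Set
  SameFaces F G = ∀ τ → (Face F τ → Face G τ) × (Face G τ → Face F τ)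

  sameFaces-≃ : ∀ {n} (F G : Faces n) → SameFaces F G → ∣ F ∣ ≃ ∣ G ∣
  sameFaces-≃ F G same = contiguous-≃ F G
    (inclusion F G (λ τ → proj₁ (same τ))) (inclusion G F (λ τ → proj₂ (same τ)))
    (contiguous-refl F) (contiguous-refl G)

  opaque
    sum-nonpos : ∀ {n} (x : Fin n → ℝ) → (∀ v → x v ≤ 0#) → sum x ≤ 0#
    sum-nonpos {zero}  x x≤0 = ≤-refl
    sum-nonpos {suc n} x x≤0 = ≤-respʳ (ℝ.+-identityˡ 0#) (+-mono-≤ (x≤0 zero) (sum-nonpos (x ∘ suc) (x≤0 ∘ suc)))

  opaque
    sum-nonneg : ∀ {n} (x : Fin n → ℝ) → (∀ v → 0# ≤ x v) → 0# ≤ sum x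
    sum-nonneg {zero}  x x≥0 = ≤-refl
    sum-nonneg {suc n} x x≥0 = +-nonneg (x≥0 zero) (sum-nonneg (x ∘ suc) (x≥0 ∘ suc))

  opaque
    -- The Kronecker delta; `δ i` is also the vertex `i` in barycentric coordinates.
    δ : ∀ {n} → Fin n → Fin n → ℝ
    δ i j = if does (i ≟ j) then 1# else 0#

  opaque
    unfolding δ

    δ-nonneg : ∀ {n} (i j : Fin n) → 0# ≤ δ i j
    δ-nonneg i j with i ≟ j
    ... | yes _ = <⇒≤ 0<1
    ... | no  _ = ≤-refl

  opaque
    unfolding δ

    δ-≢ : ∀ {n} {i j : Fin n} → i ≢ j → δ i j ≈ 0#
    δ-≢ {i = i} {j} i≢j with i ≟ j
    ... | yes i≡j = contradiction i≡j i≢j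
    ... | no  _   = ℝ.refl

  opaque
    unfolding δ

    sum-δ : ∀ {n} (i : Fin n) → sum (δ i) ≈ 1#
    sum-δ {suc n} zero    = ℝ.trans (ℝ.+-congˡ (sum-replicate-zero n)) (ℝ.+-identityʳ 1#)
    sum-δ {suc n} (suc i) = ℝ.trans (ℝ.+-identityˡ _) (sum-δ i)

  module SimplicialMap {m n} (F : Faces m) (G : Faces n) (f : Fin m → Fin n) (image : Subset m → Subset n)
    (f∈image : ∀ {τ i} → i ∈ τ → f i ∈ image τ) (G-image : ∀ τ → Face F τ → Face G (image τ)) where

    push : (Fin m → ℝ) → Fin n → ℝ
    push x j = sum (λ i → x i * δ (f i) j)

    opaque
      push-support : ∀ {x τ} → (∀ i → 0# ≤ x i) → (∀ {v} → 0# < x v → v ∈ τ) → ∀ {j} → 0# < push x j → j ∈ image τ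
      push-support {x} {τ} x≥0 s {j} 0<push = decidable-stable (j ∈? image τ) λ j∉ →
        sum-nonpos (λ i → x i * δ (f i) j) (term≤0 j∉) 0<push
        where
        term≤0 : j ∉ image τ → ∀ i → x i * δ (f i) j ≤ 0#
        term≤0 j∉ i with i ∈? τ
        ... | yes i∈τ = ≈⇒≤ (ℝ.trans (ℝ.*-congˡ (δ-≢ λ { ≡.refl → j∉ (f∈image i∈τ) })) (ℝ.zeroʳ _))
        ... | no  i∉τ = ≈⇒≤ (ℝ.trans (ℝ.*-congʳ (≤-antisym (λ 0<x → i∉τ (s 0<x)) (x≥0 i))) (ℝ.zeroˡ _))

    opaque
      sum-push : ∀ x → sum (push x) ≈ sum x
      sum-push x = ℝ.trans (∑-comm (λ j i → x i * δ (f i) j)) (sum-cong-≋ λ i →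
        ℝ.trans (ℝ.sym (*-distribˡ-sum (x i) (δ (f i)))) (ℝ.trans (ℝ.*-congˡ (sum-δ (f i))) (ℝ.*-identityʳ _)))

    opaque
      push∈ : (x : Point ∣ F ∣) → In ∣ G ∣ (push (proj₁ x))
      push∈ p@(x , x≥0 , Σx≈1 , _) =
        (λ j → sum-nonneg (λ i → x i * δ (f i) j) (λ i → *-nonneg (x≥0 i) (δ-nonneg (f i) j))) ,
        ℝ.trans (sum-push x) Σx≈1 ,
        λ σ σ⊆ → by-support (stable G) x λ τ s →
          down G (λ v∈σ → push-support x≥0 (pos⇒∈ s) (σ⊆ v∈σ)) (G-image τ (support-face F p s))

    simplicial : Map ∣ F ∣ ∣ G ∣
    simplicial = mapOf ∣ F ∣ ∣ G ∣ (push ∘ proj₁) push∈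
      (λ j → cont-sum ∣ F ∣ λ i → cont-* ∣ F ∣ (cont-coord ∣ F ∣ i) (cont-const ∣ F ∣ (δ (f i) j)))

  -- f* and g* are any upper bounds for the images of sets of vertices.
  simplicial-≃ : ∀ {m n} (F : Faces m) (G : Faces n)
    (f : Fin m → Fin n) (f* : Subset m → Subset n) → (∀ {τ i} → i ∈ τ → f i ∈ f* τ) → (∀ τ → Face F τ → Face G (f* τ)) →
    (g : Fin n → Fin m) (g* : Subset n → Subset m) → (∀ {τ i} → i ∈ τ → g i ∈ g* τ) → (∀ τ → Face G τ → Face F (g* τ)) →
    (∀ τ → Face F τ → Face F (g* (f* τ) ∪ τ)) → (∀ τ → Face G τ → Face G (f* (g* τ) ∪ τ)) → ∣ F ∣ ≃ ∣ G ∣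
  simplicial-≃ F G f f* f∈ Gf g g* g∈ Fg gf fg = contiguous-≃ F G F→G.simplicial G→F.simplicial
    (λ x → by-support (contiguous-stable F) (proj₁ x) λ τ s → contiguous-by F (g* (f* τ) ∪ τ)
      (gf τ (support-face F x s))
      (λ p → p⊆p∪q τ (G→F.push-support (proj₁ (proj₂ (fun F→G.simplicial x)))
        (F→G.push-support (proj₁ (proj₂ x)) (pos⇒∈ s)) p))
      (λ p → q⊆p∪q (g* (f* τ)) τ (pos⇒∈ s p)))
    (λ x → by-support (contiguous-stable G) (proj₁ x) λ τ s → contiguous-by G (f* (g* τ) ∪ τ)
      (fg τ (support-face G x s))
      (λ p → p⊆p∪q τ (F→G.push-support (proj₁ (proj₂ (fun G→F.simplicial x)))
        (G→F.push-support (proj₁ (proj₂ x)) (pos⇒∈ s)) p))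
      (λ p → q⊆p∪q (f* (g* τ)) τ (pos⇒∈ s p)))
    where
    module F→G = SimplicialMap F G f f* f∈ Gf
    module G→F = SimplicialMap G F g g* g∈ Fg

  -- The extra value `c` gives the minimum over an empty set a meaning. In a collapse it is one of
  -- the weights on `σ`, on the sphere it is the coordinate 0 of the vertex `one`.
  minimum : ∀ {n} → Subset n → ℝ → (Fin n → ℝ) → ℝ
  minimum []            c x = c
  minimum (inside  ∷ σ) c x = x zero ⊓ minimum σ c (x ∘ suc)
  minimum (outside ∷ σ) c x = minimum σ c (x ∘ suc)

  opaque
    minimum-≤ : ∀ {n} (σ : Subset n) c x {v} → v ∈ σ → minimum σ c x ≤ x v
    minimum-≤ (inside  ∷ σ) c x here        = x⊓y≤x _ _
    minimum-≤ (inside  ∷ σ) c x (there v∈σ) = ≤-trans (x⊓y≤y _ _) (minimum-≤ σ c (x ∘ suc) v∈σ)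
    minimum-≤ (outside ∷ σ) c x (there v∈σ) = minimum-≤ σ c (x ∘ suc) v∈σ

  opaque
    minimum-glb : ∀ {n} (σ : Subset n) c x {z} → z ≤ c → (∀ v → z ≤ x v) → z ≤ minimum σ c x
    minimum-glb []            c x z≤c z≤x = z≤c
    minimum-glb (inside  ∷ σ) c x z≤c z≤x = ⊓-glb (z≤x zero) (minimum-glb σ c (x ∘ suc) z≤c (z≤x ∘ suc))
    minimum-glb (outside ∷ σ) c x z≤c z≤x = minimum-glb σ c (x ∘ suc) z≤c (z≤x ∘ suc)

  opaque
    -- Finding the place of the minimum takes undecidable comparisons, hence a stable goal.
    minimum-attained : ∀ {n} {A : Set} → Stable A → (σ : Subset n) → ∀ c x →
      (minimum σ c x ≈ c → A) → (∀ {v} → v ∈ σ → minimum σ c x ≈ x v → A) → A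
    minimum-attained stable []            c x f g = f ℝ.refl
    minimum-attained stable (outside ∷ σ) c x f g = minimum-attained stable σ c (x ∘ suc) f (λ v∈σ → g (there v∈σ))
    minimum-attained stable (inside  ∷ σ) c x f g = <-or-≤ stable (x zero) (minimum σ c (x ∘ suc))
      (λ x₀<m → g here (x≤y⇒x⊓y≈x (<⇒≤ x₀<m)))
      (λ m≤x₀ → minimum-attained stable σ c (x ∘ suc) (λ m≈c → f (ℝ.trans (y≤x⇒x⊓y≈y m≤x₀) m≈c))
        (λ v∈σ m≈x → g (there v∈σ) (ℝ.trans (y≤x⇒x⊓y≈y m≤x₀) m≈x)))

  cont-minimum : ∀ {n} (X : Space) (σ : Subset n) {c : Point X → ℝ} {f : Point X → Fin n → ℝ} → Cont X c →
    (∀ v → Cont X (λ x → f x v)) → Cont X (λ x → minimum σ (c x) (f x))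
  cont-minimum X []            cc cf = cc
  cont-minimum X (inside  ∷ σ) cc cf = cont-⊓ X (cf zero) (cont-minimum X σ cc (cf ∘ suc))
  cont-minimum X (outside ∷ σ) cc cf = cont-minimum X σ cc (cf ∘ suc)

  infixl 6 _∖_
  _∖_ : ∀ {n} → Faces n → Subset n → Faces n
  F ∖ σ = record
    { Face   = λ τ → Face F τ × ¬ (σ ⊆ τ)
    ; down   = λ σ⊆τ (Fτ , ρ⊈τ) → down F σ⊆τ Fτ , λ ρ⊆σ → ρ⊈τ (⊆-trans ρ⊆σ σ⊆τ)
    ; stable = λ ¬¬p → stable F (λ k → ¬¬p λ (q , _) → k q) , λ ρ⊆ → ¬¬p λ (_ , q) → q ρ⊆
    }

  -- The smallest weight on σ is subtracted on all of σ and added to w, which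
  -- keeps the total and stays in a common face with the original point.
  module Collapse {n} (F : Faces n) (σ : Subset n) {u w : Fin n} (u∈σ : u ∈ σ) (w∉σ : w ∉ σ)
    (cone : ∀ τ → Face F τ → σ ⊆ τ → Face F (τ ∪ ⁅ w ⁆)) where

    opaque
      indicator : Fin n → ℝ
      indicator v = if does (v ∈? σ) then 1# else 0#

    mass : (Fin n → ℝ) → ℝ
    mass x = minimum σ (x u) x

    retract : (Fin n → ℝ) → Fin n → ℝ
    -- `sum indicator` is the number of vertices of `σ`; each of them loses `mass x`, so `w`
    -- receives this multiple.
    retract x v = (x v + (- mass x) * indicator v) + (sum indicator * mass x) * δ w v

    -- A face that carries a point with support `τ` together with its image under the retraction.
    hull : Subset n → Subset n
    hull τ = if does (σ ⊆? τ) then τ ∪ ⁅ w ⁆ else τ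

    opaque
      ⊆hull : ∀ {τ v} → v ∈ τ → v ∈ hull τ
      ⊆hull {τ} v∈τ with σ ⊆? τ
      ... | yes _ = p⊆p∪q ⁅ w ⁆ v∈τ
      ... | no  _ = v∈τ

    opaque
      F-hull : ∀ τ → Face F τ → Face F (hull τ)
      F-hull τ Fτ with σ ⊆? τ
      ... | yes σ⊆τ = cone τ Fτ σ⊆τ
      ... | no  _   = Fτ

    opaque
      unfolding indicator

      indicator-∈ : ∀ {v} → v ∈ σ → indicator v ≈ 1#
      indicator-∈ {v} v∈σ with v ∈? σ
      ... | yes _   = ℝ.refl
      ... | no  v∉σ = contradiction v∈σ v∉σ

      indicator-∉ : ∀ {v} → v ∉ σ → indicator v ≈ 0#
      indicator-∉ {v} v∉σ with v ∈? σ
      ... | yes v∈σ = contradiction v∈σ v∉σ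
      ... | no  _   = ℝ.refl

      indicator-nonneg : ∀ v → 0# ≤ indicator v
      indicator-nonneg v with v ∈? σ
      ... | yes _ = <⇒≤ 0<1
      ... | no  _ = ≤-refl

    module _ (x : Fin n → ℝ) (x≥0 : ∀ v → 0# ≤ x v) where

      opaque
        mass-nonneg : 0# ≤ mass x
        mass-nonneg = minimum-glb σ (x u) x (x≥0 u) x≥0

      opaque
        added-nonneg : ∀ v → 0# ≤ (sum indicator * mass x) * δ w v
        added-nonneg v = *-nonneg (*-nonneg (sum-nonneg indicator indicator-nonneg) mass-nonneg) (δ-nonneg w v)

      opaque
        retract-nonneg : ∀ v → 0# ≤ retract x v
        retract-nonneg v = +-nonneg remaining (added-nonneg v)
          where
          remaining : 0# ≤ x v + (- mass x) * indicator v
          remaining with v ∈? σ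
          ... | yes v∈σ = ≤-by (≤⇒0≤ (minimum-≤ σ (x u) x v∈σ))
            (ℝ.trans (solve 2 (λ x m → x :- m := x :+ (:- m) :* con (+ 1) :- con (+ 0)) ℝ.refl (x v) (mass x))
              (ℝ.+-congʳ (ℝ.+-congˡ (ℝ.*-congˡ (ℝ.sym (indicator-∈ v∈σ))))))
          ... | no  v∉σ = ≤-respʳ (ℝ.trans (solve 2 (λ x m → x := x :+ (:- m) :* con (+ 0)) ℝ.refl (x v) (mass x))
            (ℝ.+-congˡ (ℝ.*-congˡ (ℝ.sym (indicator-∉ v∉σ))))) (x≥0 v)

      opaque
        sum-retract : sum (retract x) ≈ sum x
        sum-retract = ℝ.trans (sum-linear _ (δ w) (sum indicator * mass x))
          (ℝ.trans (ℝ.+-cong (sum-linear x indicator (- mass x)) (ℝ.*-congˡ (sum-δ w)))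
            (solve 3 (λ x i m → (x :+ (:- m) :* i) :+ (i :* m) :* con (+ 1) := x) ℝ.refl (sum x) (sum indicator) (mass x)))

      opaque
        massless : ∀ v → mass x ≈ 0# → retract x v ≈ x v
        massless v m≈0 = ℝ.trans (ℝ.+-cong (ℝ.+-congˡ (ℝ.*-congʳ (ℝ.-‿cong m≈0))) (ℝ.*-congʳ (ℝ.*-congˡ m≈0)))
          (solve 4 (λ x i s d → (x :+ (:- con (+ 0)) :* i) :+ (s :* con (+ 0)) :* d := x) ℝ.refl (x v) (indicator v) (sum indicator) (δ w v))

      opaque
        elsewhere : ∀ v → w ≢ v → retract x v ≤ x v
        elsewhere v w≢v = ≤-by (*-nonneg mass-nonneg (indicator-nonneg v))
          (ℝ.trans (solve 4 (λ x m i s → m :* i := x :- ((x :+ (:- m) :* i) :+ s :* con (+ 0)))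
              ℝ.refl (x v) (mass x) (indicator v) (sum indicator * mass x))
            (ℝ.+-congˡ (ℝ.-‿cong (ℝ.+-congˡ (ℝ.*-congˡ (ℝ.sym (δ-≢ w≢v)))))))

      opaque
        -- If the support misses a vertex of `σ`, the mass is zero and the point stays where it is.
        -- Otherwise `w` is the only vertex that can gain weight.
        retract-support : ∀ {τ} → Support x τ → ∀ {v} → 0# < retract x v → v ∈ hull τ
        retract-support {τ} s {v} 0<r with σ ⊆? τ
        ... | no σ⊈τ = decidable-stable (v ∈? τ) λ v∉τ → σ⊈τ λ {i} i∈σ → decidable-stable (i ∈? τ) λ i∉τ →
          v∉τ (pos⇒∈ s (<-respʳ (massless v (≤-antisym
            (≤-trans (minimum-≤ σ (x u) x i∈σ) (λ 0<xᵢ → i∉τ (pos⇒∈ s 0<xᵢ))) mass-nonneg)) 0<r))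
        ... | yes _ with w ≟ v
        ...   | yes ≡.refl = q⊆p∪q τ ⁅ w ⁆ (x∈⁅x⁆ w)
        ...   | no  w≢v    = p⊆p∪q ⁅ w ⁆ (pos⇒∈ s (<-≤-trans 0<r (elsewhere v w≢v)))

      opaque
        -- The vertex of `σ` at which the minimum is attained loses all its weight and, being
        -- different from `w`, gains none.
        retract-avoids : ¬ (∀ {v} → v ∈ σ → 0# < retract x v)
        retract-avoids pos = minimum-attained {A = ⊥} (λ k → k id) σ (x u) x (vanishes u∈σ) vanishes
          where
          vanishes : ∀ {v} → v ∈ σ → mass x ≈ x v → ⊥
          vanishes {v} v∈σ m≈x = ≈⇒≤ (ℝ.trans (ℝ.+-cong (ℝ.+-cong (ℝ.sym m≈x) (ℝ.*-congˡ (indicator-∈ v∈σ)))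
            (ℝ.*-congˡ (δ-≢ λ { ≡.refl → w∉σ v∈σ })))
            (solve 2 (λ m s → (m :+ (:- m) :* con (+ 1)) :+ s :* con (+ 0) := con (+ 0)) ℝ.refl (mass x) (sum indicator * mass x)))
            (pos v∈σ)

    opaque
      retract∈ : (x : Point ∣ F ∣) → In ∣ F ∖ σ ∣ (retract (proj₁ x))
      retract∈ p@(x , x≥0 , Σx≈1 , _) = retract-nonneg x x≥0 , ℝ.trans (sum-retract x x≥0) Σx≈1 , λ ρ ρ⊆ →
        stable (F ∖ σ) λ k → by-support {A = ⊥} (λ z → z id) x λ τ s → k
          ( down F (λ v∈ρ → retract-support x x≥0 s (ρ⊆ v∈ρ)) (F-hull τ (support-face F p s))
          , λ σ⊆ρ → retract-avoids x x≥0 (λ v∈σ → ρ⊆ (σ⊆ρ v∈σ)))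

    retraction : Map ∣ F ∣ ∣ F ∖ σ ∣
    retraction = mapOf ∣ F ∣ ∣ F ∖ σ ∣ (retract ∘ proj₁) retract∈ λ v →
      let cont-mass = cont-minimum ∣ F ∣ σ (cont-coord ∣ F ∣ u) (cont-coord ∣ F ∣)
      in cont-+ ∣ F ∣ (cont-+ ∣ F ∣ (cont-coord ∣ F ∣ v) (cont-* ∣ F ∣ (cont-neg ∣ F ∣ cont-mass) (cont-const ∣ F ∣ _)))
           (cont-* ∣ F ∣ (cont-* ∣ F ∣ (cont-const ∣ F ∣ _) cont-mass) (cont-const ∣ F ∣ _))

    opaque
      hull-fixed : ∀ τ → ¬ (σ ⊆ τ) → hull τ ≡ τ
      hull-fixed τ σ⊈τ with σ ⊆? τ
      ... | yes σ⊆τ = contradiction (λ {v} → σ⊆τ {v}) σ⊈τ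
      ... | no  _   = ≡.refl

    -- Both composites are contiguous to the identity through `hull τ`. For a support that does not
    -- contain `σ` this hull is the support itself, so the segment never meets a removed face.
    collapse-≃ : ∣ F ∣ ≃ ∣ F ∖ σ ∣
    collapse-≃ = contiguous-≃ F (F ∖ σ) retraction (inclusion (F ∖ σ) F (λ _ → proj₁))
      (λ x → by-support (contiguous-stable F) (proj₁ x) λ τ s → contiguous-by F (hull τ)
        (F-hull τ (support-face F x s)) (retract-support (proj₁ x) (proj₁ (proj₂ x)) s) (λ p → ⊆hull (pos⇒∈ s p)))
      (λ x → by-support (contiguous-stable (F ∖ σ)) (proj₁ x) λ τ s →
        let face = support-face (F ∖ σ) x s in contiguous-by (F ∖ σ) τ face
          (λ p → ≡.subst (_ ∈_) (hull-fixed τ (proj₂ face)) (retract-support (proj₁ x) (proj₁ (proj₂ x)) s p)) (pos⇒∈ s))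

-- Sequences of collapses, and their decision by evaluation.

module Collapsing (R : RealField) where

  open OrderedField R
  open Continuity R
  open Homotopies R
  open Realizations R
  open import Data.Bool.Base using (Bool; true; false; if_then_else_)
  open import Data.Empty using (⊥)
  open import Data.Fin.Base using (Fin; zero; suc)
  open import Data.Fin.Subset using (Subset; _∈_; _∉_; _⊆_; _∪_; ⁅_⁆; inside; outside; Nonempty)
  import Data.Fin.Subset as Subset
  open import Data.Fin.Subset.Properties
    using (_∈?_; out⊆; in⊆in; drop-∷-⊆; nonempty?; x∈⁅x⁆; p⊆p∪q; q⊆p∪q; ⊆-trans)
  open import Data.List.Base using (List; []; _∷_; map)
  open import Data.List.Relation.Unary.Any as Any using (Any)
  open import Data.Nat.Base using (ℕ; zero; suc)
  open import Data.Product.Base using (_×_; _,_; proj₁)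
  open import Data.Unit.Base using (⊤; tt)
  open import Data.Vec.Base as Vec using ([]; _∷_; here; there; lookup; tabulate)
  open import Function.Base using (_∘_; id)
  import Relation.Binary.PropositionalEquality as ≡
  open ≡ using (_≡_; _≢_)
  open import Relation.Nullary using (Dec; yes; does; proof; Reflects; ofʸ; ofⁿ)
  open import Relation.Nullary.Decidable using (decidable-stable; _×-dec_; _→-dec_; ¬?)
  open import Relation.Nullary.Negation using (¬_)
  open import Relation.Unary using (Decidable)
  open RealField R
  open Topology R

  -- A set of vertices whose cofaces are removed, with the apex of the cone that justifies the
  -- removal.
  Move : ℕ → Set
  Move n = Subset n × Fin n

  infixl 6 _∖∖_
  _∖∖_ : ∀ {n} → Faces n → List (Move n) → Faces n
  F ∖∖ []              = F
  F ∖∖ ((σ , _) ∷ ms) = (F ∖ σ) ∖∖ ms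

  Collapsible : ∀ {n} → Faces n → List (Move n) → Set
  Collapsible F []             = ⊤
  Collapsible F ((σ , w) ∷ ms) =
    (Nonempty σ × w ∉ σ × (∀ τ → σ ⊆ τ → Face F τ → Face F (τ ∪ ⁅ w ⁆))) × Collapsible (F ∖ σ) ms

  collapses-≃ : ∀ {n} (F : Faces n) ms → Collapsible F ms → ∣ F ∣ ≃ ∣ F ∖∖ ms ∣
  collapses-≃ F []             _ = sameFaces-≃ F F (λ _ → id , id)
  collapses-≃ F ((σ , w) ∷ ms) (((u , u∈σ) , w∉σ , cone) , rest) =
    ≃-trans (stableSpace F) (stableSpace (F ∖ σ ∖∖ ms))
      (Collapse.collapse-≃ F σ u∈σ w∉σ (λ τ Fτ σ⊆τ → cone τ σ⊆τ Fτ))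
      (collapses-≃ (F ∖ σ) ms rest)

  -- The decisions below are evaluated on all the subsets of a vertex set, so
  -- their boolean parts are plain recursive functions.
  _⊑ᵇ_ : ∀ {n} → Subset n → Subset n → Bool
  []            ⊑ᵇ []            = true
  (outside ∷ σ) ⊑ᵇ (_ ∷ τ)       = σ ⊑ᵇ τ
  (inside  ∷ σ) ⊑ᵇ (outside ∷ τ) = false
  (inside  ∷ σ) ⊑ᵇ (inside  ∷ τ) = σ ⊑ᵇ τ

  ⊑ᵇ-reflects : ∀ {n} (σ τ : Subset n) → Reflects (σ ⊆ τ) (σ ⊑ᵇ τ)
  ⊑ᵇ-reflects []            []            = ofʸ id
  ⊑ᵇ-reflects (outside ∷ σ) (_ ∷ τ) with σ ⊑ᵇ τ | ⊑ᵇ-reflects σ τ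
  ... | true  | ofʸ p = ofʸ (out⊆ p)
  ... | false | ofⁿ k = ofⁿ λ p → k (drop-∷-⊆ p)
  ⊑ᵇ-reflects (inside  ∷ σ) (outside ∷ τ) = ofⁿ λ p → absurd (p here)
    where
    absurd : ¬ (zero ∈ outside ∷ τ)
    absurd ()
  ⊑ᵇ-reflects (inside  ∷ σ) (inside  ∷ τ) with σ ⊑ᵇ τ | ⊑ᵇ-reflects σ τ
  ... | true  | ofʸ p = ofʸ (in⊆in p)
  ... | false | ofⁿ k = ofⁿ λ p → k (drop-∷-⊆ p)

  _⊑?_ : ∀ {n} → (σ τ : Subset n) → Dec (σ ⊆ τ)
  does  (σ ⊑? τ) = σ ⊑ᵇ τ
  proof (σ ⊑? τ) = ⊑ᵇ-reflects σ τ

  allᵇ : ∀ {n} → (Subset n → Bool) → Bool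
  allᵇ {zero}  p = p []
  allᵇ {suc n} p = if allᵇ (λ τ → p (true ∷ τ)) then allᵇ (λ τ → p (false ∷ τ)) else false

  allᵇ-reflects : ∀ {n} {P : Subset n → Set} {p} → (∀ τ → Reflects (P τ) (p τ)) → Reflects (∀ τ → P τ) (allᵇ p)
  allᵇ-reflects {zero} {p = p} r with p [] | r []
  ... | true  | ofʸ x = ofʸ λ { [] → x }
  ... | false | ofⁿ k = ofⁿ λ f → k (f [])
  allᵇ-reflects {suc n} {p = p} r
    with allᵇ (λ τ → p (true ∷ τ)) | allᵇ-reflects (λ τ → r (true ∷ τ))
  ... | false | ofⁿ k = ofⁿ λ f → k λ τ → f (true ∷ τ)
  ... | true  | ofʸ f with allᵇ (λ τ → p (false ∷ τ)) | allᵇ-reflects (λ τ → r (false ∷ τ))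
  ...   | true  | ofʸ g = ofʸ λ { (true ∷ τ) → f τ ; (false ∷ τ) → g τ }
  ...   | false | ofⁿ k = ofⁿ λ f → k λ τ → f (false ∷ τ)

  all-subsets? : ∀ {n} {P : Subset n → Set} → Decidable P → Dec (∀ τ → P τ)
  does  (all-subsets? P?) = allᵇ (λ τ → does (P? τ))
  proof (all-subsets? P?) = allᵇ-reflects (λ τ → proof (P? τ))

  ∖∖? : ∀ {n} (F : Faces n) → Decidable (Face F) → ∀ ms → Decidable (Face (F ∖∖ ms))
  ∖∖? F F? []             = F?
  ∖∖? F F? ((σ , w) ∷ ms) = ∖∖? (F ∖ σ) (λ τ → F? τ ×-dec ¬? (σ ⊑? τ)) ms

  collapsible? : ∀ {n} (F : Faces n) → Decidable (Face F) → ∀ ms → Dec (Collapsible F ms)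
  collapsible? F F? []             = yes tt
  collapsible? F F? ((σ , w) ∷ ms) =
    (nonempty? σ ×-dec ¬? (w ∈? σ) ×-dec all-subsets? λ τ → (σ ⊑? τ) →-dec (F? τ →-dec F? (τ ∪ ⁅ w ⁆)))
      ×-dec collapsible? (F ∖ σ) (λ τ → F? τ ×-dec ¬? (σ ⊑? τ)) ms

  sameFaces? : ∀ {n} (F G : Faces n) → Decidable (Face F) → Decidable (Face G) → Dec (SameFaces F G)
  sameFaces? F G F? G? = all-subsets? λ τ → (F? τ →-dec G? τ) ×-dec (G? τ →-dec F? τ)

  within : ∀ {n} → Subset n → List (Subset n) → Bool
  within τ []       = false
  within τ (φ ∷ φs) = if τ ⊑ᵇ φ then true else within τ φs

  within-reflects : ∀ {n} (τ : Subset n) φs → Reflects (Any (τ ⊆_) φs) (within τ φs)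
  within-reflects τ []       = ofⁿ λ ()
  within-reflects τ (φ ∷ φs) with τ ⊑ᵇ φ | ⊑ᵇ-reflects τ φ
  ... | true  | ofʸ p = ofʸ (Any.here p)
  ... | false | ofⁿ k with within τ φs | within-reflects τ φs
  ...   | true  | ofʸ p  = ofʸ (Any.there p)
  ...   | false | ofⁿ k′ = ofⁿ λ { (Any.here p) → k p ; (Any.there p) → k′ p }

  facets : ∀ {n} → List (Subset n) → Faces n
  facets φs = record
    { Face   = λ τ → Any (τ ⊆_) φs
    ; down   = λ σ⊆τ → Any.map (⊆-trans σ⊆τ)
    ; stable = λ {τ} → decidable-stable (record { does = within τ φs ; proof = within-reflects τ φs })
    }

  facets? : ∀ {n} (φs : List (Subset n)) → Decidable (Face (facets φs))
  does  (facets? φs τ) = within τ φs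
  proof (facets? φs τ) = within-reflects τ φs

  image : ∀ {m n} → (Fin m → Fin n) → Subset m → Subset n
  image f []            = Subset.⊥
  image f (inside  ∷ τ) = ⁅ f zero ⁆ ∪ image (f ∘ suc) τ
  image f (outside ∷ τ) = image (f ∘ suc) τ

  ∈-image : ∀ {m n} (f : Fin m → Fin n) {τ i} → i ∈ τ → f i ∈ image f τ
  ∈-image f {inside  ∷ τ} here        = p⊆p∪q (image (f ∘ suc) τ) (x∈⁅x⁆ (f zero))
  ∈-image f {inside  ∷ τ} (there i∈τ) = q⊆p∪q ⁅ f zero ⁆ (image (f ∘ suc) τ) (∈-image (f ∘ suc) i∈τ)
  ∈-image f {outside ∷ τ} (there i∈τ) = ∈-image (f ∘ suc) i∈τ

  preimage : ∀ {m n} → (Fin m → Fin n) → Subset n → Subset m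
  preimage f φ = tabulate (lookup φ ∘ f)

  -- Joining `w` to the support of a point gives a face shared with the apex, so the constant map is
  -- contiguous to the identity. From the empty face one obtains that `w` is a vertex at all.
  cone-≃-point : ∀ {n} (F : Faces n) w → Face F Subset.⊥ → (∀ τ → Face F τ → Face F (τ ∪ ⁅ w ⁆)) → ∣ F ∣ ≃ point
  cone-≃-point F w F⊥ cone = record
    { to      = mapOf ∣ F ∣ point (λ _ ()) (λ _ → tt) (λ ())
    ; from    = constᵐ ∣ F ∣ apex
    ; from∘to = linear-homotopy F (constᵐ ∣ F ∣ apex) (idᵐ ∣ F ∣)
        (λ x → by-support (contiguous-stable F) (proj₁ x) λ τ s → contiguous-by F (τ ∪ ⁅ w ⁆)
          (cone τ (support-face F x s)) (λ p → q⊆p∪q τ ⁅ w ⁆ (apex-support p)) (λ p → p⊆p∪q ⁅ w ⁆ (Support.pos⇒∈ s p)))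
    ; to∘from = homotopy-by-≈ (mapOf point point (λ _ ()) (λ _ → tt) (λ ())) id (λ _ ())
    }
    where
    apex-support : ∀ {v} → 0# < δ w v → v ∈ ⁅ w ⁆
    apex-support {v} 0<δ = decidable-stable (v ∈? ⁅ w ⁆) λ v∉ →
      ≈⇒≤ (δ-≢ (λ { ≡.refl → v∉ (x∈⁅x⁆ w) })) 0<δ
    apex : Point ∣ F ∣
    apex = δ w , δ-nonneg w , sum-δ w , λ σ σ⊆ → down F
      (λ v∈σ → q⊆p∪q Subset.⊥ ⁅ w ⁆ (apex-support (σ⊆ v∈σ))) (cone Subset.⊥ F⊥)

-- The wheels on four and five vertices.

module SmallWheels (R : RealField) where

  open Realizations R
  open Homotopies R
  open Collapsing R
  open import Data.Fin.Base using (Fin; zero; suc; _↑ˡ_; _↑ʳ_)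
  open import Data.Fin using () renaming (#_ to ♯_)
  open import Data.Fin.Properties using (all?)
  open import Data.Fin.Subset using (Subset; _∈_; _⊆_; _∪_; ⁅_⁆)
  import Data.Fin.Subset as Subset
  open import Data.Fin.Subset.Properties using (_∈?_)
  open import Data.List.Base using (List; []; _∷_; _++_; map; foldr)
  open import Data.Nat.Base as ℕ using (ℕ; zero; suc)
  import Data.Nat.Properties as ℕₚ
  open import Data.Product.Base using (_×_; _,_)
  open import Data.Unit.Base using (tt)
  open import Data.Vec.Base as Vec using ([]; _∷_; lookup)
  open import Data.Vec.Properties using (lookup∘tabulate; []=⇒lookup; lookup⇒[]=)
  open import Function.Base using (_∘_)
  import Relation.Binary.PropositionalEquality as ≡
  open ≡ using (_≡_; _≢_)
  open import Relation.Nullary using (Dec)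
  open import Relation.Nullary.Decidable using (decidable-stable; _×-dec_; _→-dec_; ¬?; toWitness)
  open import Relation.Nullary.Negation using (¬_)
  open import Relation.Unary using (Decidable)
  open RealField R
  open Topology R

  -- The predicate is literally that of `M₂`, so `∣ matchings G ∣` and `∥ M₂ G ∥` agree by
  -- computation.
  matchings : (G : Graph) → Faces (Graph.size G)
  matchings G = record
    { Face   = Is2Matching G
    ; down   = SimplicialComplex.down (M₂ G)
    ; stable = λ ¬¬m v → decidable-stable (_ ℕₚ.≤? 2) λ k → ¬¬m λ m → k (m v)
    }

  matching? : ∀ G → Decidable (Is2Matching G)
  matching? G τ = all? λ v → degree G τ v ℕₚ.≤? 2

  boundary : ∀ n → Faces n
  boundary n = record
    { Face   = λ τ → ¬ (∀ v → v ∈ τ)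
    ; down   = λ σ⊆τ k full → k λ v → σ⊆τ (full v)
    ; stable = λ ¬¬k full → ¬¬k λ k → k full
    }

  boundary? : ∀ n → Decidable (Face (boundary n))
  boundary? n τ = ¬? (all? (_∈? τ))

  -- The base vertex of a pointed complex is zero.
  leftVertex : ∀ n m → Fin (suc n) → Fin (suc (n ℕ.+ m))
  leftVertex n m zero    = zero
  leftVertex n m (suc i) = suc (i ↑ˡ m)

  rightVertex : ∀ n m → Fin (suc m) → Fin (suc (n ℕ.+ m))
  rightVertex n m zero    = zero
  rightVertex n m (suc j) = suc (n ↑ʳ j)

  ∈-preimage⁻ : ∀ {m n} {f : Fin m → Fin n} {φ i} → i ∈ preimage f φ → f i ∈ φ
  ∈-preimage⁻ {f = f} {φ} {i} p = lookup⇒[]= (f i) φ (≡.trans (≡.sym (lookup∘tabulate (lookup φ ∘ f) i)) ([]=⇒lookup p))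

  ∈-preimage⁺ : ∀ {m n} {f : Fin m → Fin n} {φ i} → f i ∈ φ → i ∈ preimage f φ
  ∈-preimage⁺ {f = f} {φ} {i} p = lookup⇒[]= i _ (≡.trans (lookup∘tabulate (lookup φ ∘ f) i) ([]=⇒lookup p))

  preimage-mono : ∀ {m n} (f : Fin m → Fin n) {φ ψ} → φ ⊆ ψ → preimage f φ ⊆ preimage f ψ
  preimage-mono f φ⊆ψ p = ∈-preimage⁺ {f = f} (φ⊆ψ (∈-preimage⁻ {f = f} p))

  infixl 3 _∨ᶠ_
  -- The last condition keeps a face from leaving the base vertex on both sides at once; one of the
  -- two preimages is therefore contained in the base vertex.
  _∨ᶠ_ : ∀ {n m} → Faces (suc n) → Faces (suc m) → Faces (suc (n ℕ.+ m))
  _∨ᶠ_ {n} {m} F G = record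
    { Face   = λ τ → Face F (preimage (leftVertex n m) τ) × Face G (preimage (rightVertex n m) τ)
                   × (∀ i j → suc (i ↑ˡ m) ∈ τ → ¬ (suc (n ↑ʳ j) ∈ τ))
    ; down   = λ σ⊆τ (f , g , d) →
        down F (preimage-mono (leftVertex n m) σ⊆τ) f ,
        down G (preimage-mono (rightVertex n m) σ⊆τ) g ,
        λ i j p q → d i j (σ⊆τ p) (σ⊆τ q)
    ; stable = λ ¬¬x → stable F (λ k → ¬¬x λ (f , _) → k f) , stable G (λ k → ¬¬x λ (_ , g , _) → k g) ,
        λ i j p q → ¬¬x λ (_ , _ , d) → d i j p q
    }

  ∨ᶠ? : ∀ {n m} (F : Faces (suc n)) (G : Faces (suc m)) → Decidable (Face F) → Decidable (Face G) →
        Decidable (Face (F ∨ᶠ G))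
  ∨ᶠ? {n} {m} F G F? G? τ = F? (preimage (leftVertex n m) τ) ×-dec G? (preimage (rightVertex n m) τ)
    ×-dec all? λ i → all? λ j → (suc (i ↑ˡ m) ∈? τ) →-dec ¬? (suc (n ↑ʳ j) ∈? τ)

  set : ∀ {n} → List (Fin n) → Subset n
  set = foldr (λ v τ → ⁅ v ⁆ ∪ τ) Subset.⊥

  -- K and E collapse to the same complex, and E also collapses to T.  The
  -- vertices of T are duplicated in D, which collapses to W.
  module Collapses
    {m n} (K : Faces m) (K? : Decidable (Face K)) (first : List (Move m))
    (expanded : List (Subset m)) (second third : List (Move m)) (reduced : List (Subset m))
    (ι : Fin m → Fin n) (π : Fin n → Fin m) (duplicated : List (Subset n)) (fourth : List (Move n)) (W : Faces n) (W? : Decidable (Face W))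
    where

    E T : Faces m
    D : Faces n
    E = facets expanded
    T = facets reduced
    D = facets duplicated

    Valid : Set
    Valid =
        Collapsible K first × SameFaces (K ∖∖ first) (E ∖∖ second)
      × Collapsible E second × Collapsible E third × SameFaces (E ∖∖ third) T
      × (∀ τ → Face T τ → Face D (image ι τ)) × (∀ τ → Face D τ → Face T (image π τ))
      × (∀ τ → Face T τ → Face T (image π (image ι τ) ∪ τ)) × (∀ τ → Face D τ → Face D (image ι (image π τ) ∪ τ))
      × Collapsible D fourth × SameFaces (D ∖∖ fourth) W

    valid? : Dec Valid
    valid? = collapsible? K K? first ×-dec sameFaces? (K ∖∖ first) (E ∖∖ second) (∖∖? K K? first) (∖∖? E E? second)
      ×-dec collapsible? E E? second ×-dec collapsible? E E? third
      ×-dec sameFaces? (E ∖∖ third) T (∖∖? E E? third) T?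
      ×-dec all-subsets? (λ τ → T? τ →-dec D? (image ι τ)) ×-dec all-subsets? (λ τ → D? τ →-dec T? (image π τ))
      ×-dec all-subsets? (λ τ → T? τ →-dec T? (image π (image ι τ) ∪ τ))
      ×-dec all-subsets? (λ τ → D? τ →-dec D? (image ι (image π τ) ∪ τ))
      ×-dec collapsible? D D? fourth ×-dec sameFaces? (D ∖∖ fourth) W (∖∖? D D? fourth) W?
      where
      E? : Decidable (Face E)
      E? = facets? expanded
      T? : Decidable (Face T)
      T? = facets? reduced
      D? : Decidable (Face D)
      D? = facets? duplicated

    opaque
      equivalence : Valid → ∣ K ∣ ≃ ∣ W ∣
      equivalence (c₁ , s₁ , c₂ , c₃ , s₂ , ιT , πD , πι , ιπ , c₄ , s₃) =
        then K (K ∖∖ first) (collapses-≃ K first c₁)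
        (then (K ∖∖ first) (E ∖∖ second) (sameFaces-≃ (K ∖∖ first) (E ∖∖ second) s₁)
        (then (E ∖∖ second) E (≃-sym (collapses-≃ E second c₂))
        (then E (E ∖∖ third) (collapses-≃ E third c₃)
        (then (E ∖∖ third) T (sameFaces-≃ (E ∖∖ third) T s₂)
        (then T D (simplicial-≃ T D ι (image ι) (∈-image ι) ιT π (image π) (∈-image π) πD πι ιπ)
        (then D (D ∖∖ fourth) (collapses-≃ D fourth c₄)
        (sameFaces-≃ (D ∖∖ fourth) W s₃)))))))
        where
        then : ∀ {k l} (F : Faces k) (G : Faces l) → ∣ F ∣ ≃ ∣ G ∣ → ∣ G ∣ ≃ ∣ W ∣ → ∣ F ∣ ≃ ∣ W ∣
        then F G = ≃-trans (stableSpace F) (stableSpace W)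

  -- The edge cᵢ joins the rim vertices i and i + 1, and sᵢ is the spoke at i.
  -- The link of sᵢsᵢ₊₁ consists of the vertex cᵢ and the edge cᵢ₋₁cᵢ₊₁, which is
  -- collapsed to cᵢ₊₁.  Inserting the tetrahedron sᵢsᵢ₊₁cᵢcᵢ₊₁ through its missing
  -- facet sᵢ₊₁cᵢcᵢ₊₁ turns this link into a cone.  The result consists of the
  -- boundaries of the tetrahedra c₀c₁c₂sᵢ.
  module WheelOnFour (3≤3 : 3 ℕ.≤ 3) where

    K₄ : Faces 6
    K₄ = matchings (cone (cycle 3 3≤3))

    private
      pattern c₀ = zero
      pattern c₁ = suc c₀
      pattern c₂ = suc c₁
      pattern s₀ = suc c₂
      pattern s₁ = suc s₀
      pattern s₂ = suc s₁

      ∂³ : Faces 4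
      ∂³ = boundary 4

      K₄? : Decidable (Face K₄)
      K₄? = matching? (cone (cycle 3 3≤3))

      W? : Decidable (Face (∂³ ∨ᶠ ∂³ ∨ᶠ ∂³))
      W? = ∨ᶠ? (∂³ ∨ᶠ ∂³) ∂³ (∨ᶠ? ∂³ ∂³ (boundary? 4) (boundary? 4)) (boundary? 4)

      first second third : List (Move 6)
      first =
          (set (s₀ ∷ s₁ ∷ c₂ ∷ []) , c₁) ∷ (set (s₁ ∷ s₂ ∷ c₀ ∷ []) , c₂) ∷ (set (s₂ ∷ s₀ ∷ c₁ ∷ []) , c₀) ∷ []
      second =
          (set (s₁ ∷ c₀ ∷ c₁ ∷ []) , s₀) ∷ (set (s₂ ∷ c₁ ∷ c₂ ∷ []) , s₁) ∷ (set (s₀ ∷ c₂ ∷ c₀ ∷ []) , s₂) ∷ []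
      third =
          (set (s₀ ∷ s₁ ∷ []) , c₀) ∷ (set (s₁ ∷ s₂ ∷ []) , c₁) ∷ (set (s₂ ∷ s₀ ∷ []) , c₂) ∷ []

      expanded reduced : List (Subset 6)
      expanded =
          set (c₀ ∷ c₁ ∷ c₂ ∷ [])
        ∷ set (s₀ ∷ c₂ ∷ c₁ ∷ []) ∷ set (s₁ ∷ c₀ ∷ c₂ ∷ []) ∷ set (s₂ ∷ c₁ ∷ c₀ ∷ [])
        ∷ set (s₀ ∷ s₁ ∷ c₀ ∷ c₁ ∷ []) ∷ set (s₁ ∷ s₂ ∷ c₁ ∷ c₂ ∷ []) ∷ set (s₂ ∷ s₀ ∷ c₂ ∷ c₀ ∷ []) ∷ []
      reduced =
          set (c₀ ∷ c₁ ∷ c₂ ∷ [])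
        ∷ set (s₀ ∷ c₀ ∷ c₁ ∷ []) ∷ set (s₀ ∷ c₁ ∷ c₂ ∷ []) ∷ set (s₀ ∷ c₂ ∷ c₀ ∷ [])
        ∷ set (s₁ ∷ c₀ ∷ c₁ ∷ []) ∷ set (s₁ ∷ c₁ ∷ c₂ ∷ []) ∷ set (s₁ ∷ c₂ ∷ c₀ ∷ [])
        ∷ set (s₂ ∷ c₀ ∷ c₁ ∷ []) ∷ set (s₂ ∷ c₁ ∷ c₂ ∷ []) ∷ set (s₂ ∷ c₂ ∷ c₀ ∷ []) ∷ []

      -- Vertex 0 is the common c₀; the other vertices come in blocks of three,
      -- consisting of sᵢ and copies of c₁ and c₂ for the i-th tetrahedron.
      ι : Fin 6 → Fin 10
      ι = lookup (♯ 0 ∷ ♯ 2 ∷ ♯ 3 ∷ ♯ 1 ∷ ♯ 4 ∷ ♯ 7 ∷ [])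

      π : Fin 10 → Fin 6
      π = lookup (c₀ ∷ s₀ ∷ c₁ ∷ c₂ ∷ s₁ ∷ c₁ ∷ c₂ ∷ s₂ ∷ c₁ ∷ c₂ ∷ [])

      apex left right : Fin 3 → Fin 10
      apex  = lookup (♯ 1 ∷ ♯ 4 ∷ ♯ 7 ∷ [])
      left  = lookup (♯ 2 ∷ ♯ 5 ∷ ♯ 8 ∷ [])
      right = lookup (♯ 3 ∷ ♯ 6 ∷ ♯ 9 ∷ [])

      -- The faces of `D` lie over faces of `T`, so a copy of a vertex can be joined by its other
      -- copies: an apex is separated from a foreign copy with its own copy as cone point. Copies
      -- from different blocks then share only faces without any `sᵢ`, which lie over `c₀c₁c₂`, and
      -- the common vertex `zero` is a cone point.
      separateApexes separateBases : Fin 3 → Fin 3 → List (Move 10)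
      separateApexes i j =
          (set (apex i ∷ left j ∷ []) , left i) ∷ (set (apex i ∷ right j ∷ []) , right i)
        ∷ (set (apex j ∷ left i ∷ []) , left j) ∷ (set (apex j ∷ right i ∷ []) , right j) ∷ []
      separateBases i j =
          (set (left i ∷ left j ∷ []) , zero) ∷ (set (left i ∷ right j ∷ []) , zero)
        ∷ (set (right i ∷ left j ∷ []) , zero) ∷ (set (right i ∷ right j ∷ []) , zero) ∷ []

      fourth : List (Move 10)
      fourth = separateApexes (♯ 0) (♯ 1) ++ separateApexes (♯ 0) (♯ 2) ++ separateApexes (♯ 1) (♯ 2)
            ++ separateBases (♯ 0) (♯ 1) ++ separateBases (♯ 0) (♯ 2) ++ separateBases (♯ 1) (♯ 2)

    open Collapses K₄ K₄? first expanded second third reduced ι π (map (preimage π) reduced) fourth (∂³ ∨ᶠ ∂³ ∨ᶠ ∂³) W?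

    four : ∣ K₄ ∣ ≃ ∣ boundary 4 ∨ᶠ boundary 4 ∨ᶠ boundary 4 ∣
    four = equivalence (toWitness {a? = valid?} tt)

  -- First the pairs of adjacent spokes are removed.  The link of s₀s₂ is then the
  -- 4-cycle {c₃, c₀} * {c₁, c₂}; inserting the edge c₁c₂ turns it into a cone and
  -- completes the link of s₂ to the boundary of c₀c₁c₂c₃, and likewise for s₁s₃.
  module WheelOnFive (3≤4 : 3 ℕ.≤ 4) where

    K₅ : Faces 8
    K₅ = matchings (cone (cycle 4 3≤4))

    private
      pattern c₀ = zero
      pattern c₁ = suc c₀
      pattern c₂ = suc c₁
      pattern c₃ = suc c₂
      pattern s₀ = suc c₃
      pattern s₁ = suc s₀
      pattern s₂ = suc s₁
      pattern s₃ = suc s₂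

      ∂⁴ : Faces 5
      ∂⁴ = boundary 5

      K₅? : Decidable (Face K₅)
      K₅? = matching? (cone (cycle 4 3≤4))

      first second third : List (Move 8)
      first =
          (set (s₀ ∷ s₁ ∷ []) , c₂) ∷ (set (s₁ ∷ s₂ ∷ []) , c₃)
        ∷ (set (s₂ ∷ s₃ ∷ []) , c₀) ∷ (set (s₃ ∷ s₀ ∷ []) , c₁) ∷ []
      second = (set (s₂ ∷ c₁ ∷ c₂ ∷ []) , s₀) ∷ (set (s₃ ∷ c₂ ∷ c₃ ∷ []) , s₁) ∷ []
      -- Once the opposite pairs are gone, the link of `s₀` consists of `c₁c₂c₃` and `c₀c₁c₂`, a
      -- cone with apex `c₁`; the link of `s₁` is likewise a cone with apex `c₂`. So these two
      -- spokes disappear, and a sphere remains around each of `s₂` and `s₃`.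
      third = (set (s₀ ∷ s₂ ∷ []) , c₁) ∷ (set (s₁ ∷ s₃ ∷ []) , c₂) ∷ (set (s₀ ∷ []) , c₁) ∷ (set (s₁ ∷ []) , c₂) ∷ []

      expanded reduced : List (Subset 8)
      expanded =
          set (s₀ ∷ s₂ ∷ c₁ ∷ c₂ ∷ c₃ ∷ []) ∷ set (s₀ ∷ s₂ ∷ c₁ ∷ c₂ ∷ c₀ ∷ [])
        ∷ set (s₁ ∷ s₃ ∷ c₂ ∷ c₃ ∷ c₀ ∷ []) ∷ set (s₁ ∷ s₃ ∷ c₂ ∷ c₃ ∷ c₁ ∷ [])
        ∷ set (c₀ ∷ c₁ ∷ c₂ ∷ c₃ ∷ [])
        ∷ set (s₂ ∷ c₁ ∷ c₃ ∷ c₀ ∷ []) ∷ set (s₂ ∷ c₂ ∷ c₃ ∷ c₀ ∷ [])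
        ∷ set (s₃ ∷ c₂ ∷ c₀ ∷ c₁ ∷ []) ∷ set (s₃ ∷ c₃ ∷ c₀ ∷ c₁ ∷ []) ∷ []
      reduced =
          set (c₀ ∷ c₁ ∷ c₂ ∷ c₃ ∷ [])
        ∷ set (s₂ ∷ c₀ ∷ c₁ ∷ c₂ ∷ []) ∷ set (s₂ ∷ c₀ ∷ c₁ ∷ c₃ ∷ [])
        ∷ set (s₂ ∷ c₀ ∷ c₂ ∷ c₃ ∷ []) ∷ set (s₂ ∷ c₁ ∷ c₂ ∷ c₃ ∷ [])
        ∷ set (s₃ ∷ c₀ ∷ c₁ ∷ c₂ ∷ []) ∷ set (s₃ ∷ c₀ ∷ c₁ ∷ c₃ ∷ [])
        ∷ set (s₃ ∷ c₀ ∷ c₂ ∷ c₃ ∷ []) ∷ set (s₃ ∷ c₁ ∷ c₂ ∷ c₃ ∷ []) ∷ []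

      -- s₀ and s₁ are not vertices of the reduced complex, so their images are immaterial.
      ι : Fin 8 → Fin 9
      ι = lookup (♯ 0 ∷ ♯ 2 ∷ ♯ 3 ∷ ♯ 4 ∷ ♯ 0 ∷ ♯ 0 ∷ ♯ 1 ∷ ♯ 5 ∷ [])

      π : Fin 9 → Fin 8
      π = lookup (c₀ ∷ s₂ ∷ c₁ ∷ c₂ ∷ c₃ ∷ s₃ ∷ c₁ ∷ c₂ ∷ c₃ ∷ [])

      edge : Fin 9 → Fin 9 → Fin 9 → Move 9
      edge u v w = set (u ∷ v ∷ []) , w

      fourth : List (Move 9)
      fourth =
          -- The first six moves separate the apexes 1 and 5 from the copies in the other block,
          -- with the copy in their own block as cone point. The other nine separate the copies from
          -- each other over the simplex on the rim.
          edge (♯ 1) (♯ 6) (♯ 2) ∷ edge (♯ 1) (♯ 7) (♯ 3) ∷ edge (♯ 1) (♯ 8) (♯ 4)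
        ∷ edge (♯ 5) (♯ 2) (♯ 6) ∷ edge (♯ 5) (♯ 3) (♯ 7) ∷ edge (♯ 5) (♯ 4) (♯ 8)
        ∷ edge (♯ 2) (♯ 6) zero ∷ edge (♯ 2) (♯ 7) zero ∷ edge (♯ 2) (♯ 8) zero
        ∷ edge (♯ 3) (♯ 6) zero ∷ edge (♯ 3) (♯ 7) zero ∷ edge (♯ 3) (♯ 8) zero
        ∷ edge (♯ 4) (♯ 6) zero ∷ edge (♯ 4) (♯ 7) zero ∷ edge (♯ 4) (♯ 8) zero ∷ []

    open Collapses K₅ K₅? first expanded second third reduced ι π (map (preimage π) reduced) fourth
      (∂⁴ ∨ᶠ ∂⁴) (∨ᶠ? ∂⁴ ∂⁴ (boundary? 5) (boundary? 5))

    five : ∣ K₅ ∣ ≃ ∣ boundary 5 ∨ᶠ boundary 5 ∣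
    five = equivalence (toWitness {a? = valid?} tt)

-- Contractibility for wheels on at least six vertices.

module LargeWheels (R : RealField) where

  open Realizations R renaming (∣_∣ to ∥_∥ᶠ)
  open Homotopies R
  open Collapsing R
  open SmallWheels R using (matchings)
  open import Data.Bool.Base using (true; _∨_)
  open import Data.Empty using (⊥; ⊥-elim)
  open import Data.Fin.Base using (Fin; zero; suc; toℕ; splitAt; _↑ˡ_; _↑ʳ_)
  open import Data.Fin.Properties using (_≟_; any?; splitAt-↑ˡ; splitAt-↑ʳ; splitAt⁻¹-↑ˡ; splitAt⁻¹-↑ʳ; toℕ-injective; suc-injective)
  open import Data.Fin.Subset using (Subset; _∈_; _∉_; _⊆_; _∪_; _∩_; ⁅_⁆; ∣_∣; Nonempty; _-_; inside; outside)
  import Data.Fin.Subset as Subset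
  open import Data.Fin.Subset.Properties
    using (_∈?_; x∈⁅x⁆; x∈⁅y⁆⇒x≡y; x∈p∪q⁻; x∈p∪q⁺; x∈p∩q⁺; x∈p∩q⁻; p⊆q⇒∣p∣≤∣q∣; ∣⁅x⁆∣≡1;
           x∈p⇒∣p-x∣<∣p∣; x∈p∧x≢y⇒x∈p-y; p⊆p∪q; q⊆p∪q; ∉⊥; ⊆-min)
  open import Data.List.Base using (List; []; _∷_; map; filter; cartesianProduct; allFin)
  open import Data.List.Membership.Propositional using () renaming (_∈_ to _∈ˡ_)
  open import Data.List.Membership.Propositional.Properties
    using (∈-map⁺; ∈-map⁻; ∈-filter⁺; ∈-filter⁻; ∈-cartesianProduct⁺; ∈-allFin)
  open import Data.List.Relation.Unary.All as All using (All; []; _∷_)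
  open import Data.Nat.Base as ℕ using (ℕ; zero; suc; s≤s; z≤n)
  import Data.Nat.Properties as ℕₚ
  open import Data.Product.Base using (∃; _×_; _,_; proj₁; proj₂)
  open import Data.Sum.Base using (_⊎_; inj₁; inj₂; [_,_]′)
  open import Data.Unit.Base using (tt)
  open import Data.Vec.Base using ([]; _∷_; lookup; tabulate)
  open import Data.Vec.Properties using (lookup∘tabulate; []=⇒lookup; lookup⇒[]=)
  open import Function.Base using (_∘_; id)
  import Relation.Binary.PropositionalEquality as ≡
  open ≡ using (_≡_; _≢_)
  open import Relation.Nullary using (yes; no; does)
  open import Relation.Nullary.Decidable using (¬?)
  open import Relation.Nullary.Negation using (¬_; contradiction)
  open Topology R

  Avoids : ∀ {n} → List (Move n) → Subset n → Set
  Avoids ms τ = All (λ (σ , _) → ¬ (σ ⊆ τ)) ms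

  ∖∖⁺ : ∀ {n} (F : Faces n) ms {τ} → Face F τ → Avoids ms τ → Face (F ∖∖ ms) τ
  ∖∖⁺ F []             Fτ []       = Fτ
  ∖∖⁺ F ((σ , _) ∷ ms) Fτ (k ∷ ks) = ∖∖⁺ (F ∖ σ) ms (Fτ , k) ks

  ∖∖⁻ : ∀ {n} (F : Faces n) ms {τ} → Face (F ∖∖ ms) τ → Face F τ × Avoids ms τ
  ∖∖⁻ F []             Fτ = Fτ , []
  ∖∖⁻ F ((σ , _) ∷ ms) p  with ∖∖⁻ (F ∖ σ) ms p
  ... | (Fτ , k) , ks = Fτ , k ∷ ks

  add-⊈ : ∀ {n} {σ τ : Subset n} {w} → w ∉ σ → ¬ (σ ⊆ τ) → ¬ (σ ⊆ τ ∪ ⁅ w ⁆)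
  add-⊈ {σ = σ} {τ} {w} w∉σ σ⊈τ σ⊆ = σ⊈τ λ {v} v∈σ → [ id , (λ v∈w → contradiction (≡.subst (_∈ σ) (x∈⁅y⁆⇒x≡y w v∈w) v∈σ) w∉σ) ]′
    (x∈p∪q⁻ τ ⁅ w ⁆ (σ⊆ v∈σ))

  -- Moves whose cones all exist in F can be performed in any order if no apex
  -- lies in a set that is removed.
  record Independent {n} (F : Faces n) (S : Fin n → Set) (m : Move n) : Set where
    field
      nonempty : Nonempty (proj₁ m)
      base     : ∀ {e} → e ∈ proj₁ m → S e
      apex     : ¬ S (proj₂ m)
      joinable : ∀ τ → proj₁ m ⊆ τ → Face F τ → Face F (τ ∪ ⁅ proj₂ m ⁆)

  open Independent

  -- Removed sets lie in `S` and apexes outside it, so joining a later apex never completes an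
  -- earlier removed set. The cones of later moves therefore survive each removal.
  independent⇒collapsible : ∀ {n} (F : Faces n) {S} ms → All (Independent F S) ms → Collapsible F ms
  independent⇒collapsible F []             []       = tt
  independent⇒collapsible F ((σ , w) ∷ ms) (i ∷ is) =
    (nonempty i , (λ w∈σ → apex i (base i w∈σ)) , joinable i) ,
    independent⇒collapsible (F ∖ σ) ms (All.map (λ {m} j → record
      { nonempty = nonempty j
      ; base     = base j
      ; apex     = apex j
      ; joinable = λ τ σ⊆τ (Fτ , k) → joinable j τ σ⊆τ Fτ , add-⊈ (λ w∈σ → apex j (base i w∈σ)) k
      }) is)

  avoids-add : ∀ {n} {F : Faces n} {S} {ms τ w} → All (Independent F S) ms → ¬ S w → Avoids ms τ → Avoids ms (τ ∪ ⁅ w ⁆)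
  avoids-add []       _   []       = []
  avoids-add (i ∷ is) ¬Sw (k ∷ ks) = add-⊈ (λ w∈σ → ¬Sw (base i w∈σ)) k ∷ avoids-add is ¬Sw ks

  avoids-⊥ : ∀ {n} {F : Faces n} {S} {ms} → All (Independent F S) ms → Avoids ms Subset.⊥
  avoids-⊥ = All.map λ i σ⊆⊥ → ∉⊥ (σ⊆⊥ (proj₂ (nonempty i)))

  ∣∪∣≤ : ∀ {n} (p q : Subset n) → ∣ p ∪ q ∣ ℕ.≤ ∣ p ∣ ℕ.+ ∣ q ∣
  ∣∪∣≤ []            []            = z≤n
  ∣∪∣≤ (inside  ∷ p) (inside  ∷ q) = s≤s (ℕₚ.≤-trans (∣∪∣≤ p q) (ℕₚ.+-monoʳ-≤ ∣ p ∣ (ℕₚ.n≤1+n ∣ q ∣)))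
  ∣∪∣≤ (inside  ∷ p) (outside ∷ q) = s≤s (∣∪∣≤ p q)
  ∣∪∣≤ (outside ∷ p) (inside  ∷ q) = ℕₚ.≤-trans (s≤s (∣∪∣≤ p q)) (ℕₚ.≤-reflexive (≡.sym (ℕₚ.+-suc ∣ p ∣ ∣ q ∣)))
  ∣∪∣≤ (outside ∷ p) (outside ∷ q) = ∣∪∣≤ p q

  ∣p∣≤2 : ∀ {n} {p : Subset n} a b → (∀ {e} → e ∈ p → e ≡ a ⊎ e ≡ b) → ∣ p ∣ ℕ.≤ 2
  ∣p∣≤2 {p = p} a b p⊆ab = ℕₚ.≤-trans
    (p⊆q⇒∣p∣≤∣q∣ {p = p} {⁅ a ⁆ ∪ ⁅ b ⁆} λ e∈p → x∈p∪q⁺ ([ (λ { ≡.refl → inj₁ (x∈⁅x⁆ a) }) , (λ { ≡.refl → inj₂ (x∈⁅x⁆ b) }) ]′ (p⊆ab e∈p)))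
    (ℕₚ.≤-trans (∣∪∣≤ ⁅ a ⁆ ⁅ b ⁆)
      (ℕₚ.≤-reflexive (≡.cong₂ ℕ._+_ (∣⁅x⁆∣≡1 a) (∣⁅x⁆∣≡1 b))))

  3≤∣p∣ : ∀ {n} {p : Subset n} {a b c} → a ∈ p → b ∈ p → c ∈ p → a ≢ b → a ≢ c → b ≢ c → 3 ℕ.≤ ∣ p ∣
  3≤∣p∣ {p = p} {a} {b} {c} a∈p b∈p c∈p a≢b a≢c b≢c = ℕₚ.≤-<-trans
    (ℕₚ.≤-<-trans (ℕₚ.≤-<-trans z≤n (x∈p⇒∣p-x∣<∣p∣ {p = p - a - b} c∈′)) (x∈p⇒∣p-x∣<∣p∣ {p = p - a} b∈))
    (x∈p⇒∣p-x∣<∣p∣ {p = p} a∈p)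
    where
    b∈ : b ∈ p - a
    b∈ = x∈p∧x≢y⇒x∈p-y b∈p (λ b≡a → a≢b (≡.sym b≡a))
    c∈ : c ∈ p - a
    c∈ = x∈p∧x≢y⇒x∈p-y c∈p (λ c≡a → a≢c (≡.sym c≡a))
    c∈′ : c ∈ p - a - b
    c∈′ = x∈p∧x≢y⇒x∈p-y c∈ (λ c≡b → b≢c (≡.sym c≡b))

  module _ (G : Graph) where
    open Graph G

    ∈-incident⁺ : ∀ {e v} → proj₁ (ends e) ≡ v ⊎ proj₂ (ends e) ≡ v → e ∈ incident G v
    ∈-incident⁺ {e} {v} h = lookup⇒[]= e _ (≡.trans (lookup∘tabulate _ e) (value h))
      where
      value : proj₁ (ends e) ≡ v ⊎ proj₂ (ends e) ≡ v → does (proj₁ (ends e) ≟ v) ∨ does (proj₂ (ends e) ≟ v) ≡ true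
      value h with proj₁ (ends e) ≟ v | proj₂ (ends e) ≟ v
      ... | yes _ | _     = ≡.refl
      ... | no  _ | yes _ = ≡.refl
      ... | no  p | no  q = ⊥-elim ([ p , q ]′ h)

    ∈-incident⁻ : ∀ {e v} → e ∈ incident G v → proj₁ (ends e) ≡ v ⊎ proj₂ (ends e) ≡ v
    ∈-incident⁻ {e} {v} e∈ = value (≡.trans (≡.sym (lookup∘tabulate (λ e → does (proj₁ (ends e) ≟ v) ∨ does (proj₂ (ends e) ≟ v)) e)) ([]=⇒lookup e∈))
      where
      value : does (proj₁ (ends e) ≟ v) ∨ does (proj₂ (ends e) ≟ v) ≡ true → proj₁ (ends e) ≡ v ⊎ proj₂ (ends e) ≡ v
      value h with proj₁ (ends e) ≟ v | proj₂ (ends e) ≟ v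
      ... | yes p | _     = inj₁ p
      ... | no  _ | yes q = inj₂ q
      value () | no _ | no _

  next-injective : ∀ {k} {i j : Fin k} → next i ≡ next j → i ≡ j
  next-injective {k} {i} {j} eq with toℕ-next i | toℕ-next j
  ... | inj₁ p | inj₁ q = toℕ-injective (ℕₚ.suc-injective (≡.trans (≡.sym p) (≡.trans (≡.cong toℕ eq) q)))
  ... | inj₂ (p , _) | inj₂ (q , _) = toℕ-injective (ℕₚ.suc-injective (≡.trans p (≡.sym q)))
  ... | inj₁ p | inj₂ (_ , q) with ≡.trans (≡.sym p) (≡.trans (≡.cong toℕ eq) q)
  ...   | ()
  next-injective {k} {i} {j} eq | inj₂ (_ , p) | inj₁ q with ≡.trans (≡.sym q) (≡.trans (≡.cong toℕ (≡.sym eq)) p)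
  ...   | ()

  next^ : ∀ {k} → ℕ → Fin k → Fin k
  next^ zero    i = i
  next^ (suc a) i = next (next^ a i)

  -- `c` counts the passages from the last vertex to the first; this replaces congruences by an
  -- equation of natural numbers.
  toℕ-next^ : ∀ {k} a (i : Fin k) → ∃ λ c → toℕ (next^ a i) ℕ.+ c ℕ.* k ≡ a ℕ.+ toℕ i
  toℕ-next^ zero    i = 0 , ℕₚ.+-identityʳ _
  toℕ-next^ {k} (suc a) i with toℕ-next (next^ a i) | toℕ-next^ a i
  ... | inj₁ p           | c , q = c , ≡.trans (≡.cong (ℕ._+ c ℕ.* k) p) (≡.cong suc q)
  ... | inj₂ (full , p) | c , q = suc c , ≡.trans (≡.cong (ℕ._+ suc c ℕ.* k) p)
    (≡.trans (≡.cong (ℕ._+ c ℕ.* k) (≡.sym full)) (≡.cong suc q))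

  -- A return to `i` would make `suc a` a multiple of `k`, although it lies strictly between 0 and
  -- `k`.
  next^-≢ : ∀ {k} a (i : Fin k) → suc a ℕ.< k → next^ (suc a) i ≢ i
  next^-≢ {k} a i 1+a<k eq with toℕ-next^ (suc a) i
  ... | c , q = case c (ℕₚ.+-cancelˡ-≡ (toℕ i) (c ℕ.* k) (suc a)
    (≡.trans (≡.cong (ℕ._+ c ℕ.* k) (≡.sym (≡.cong toℕ eq))) (≡.trans q (ℕₚ.+-comm (suc a) (toℕ i)))))
    where
    case : ∀ c → ¬ (c ℕ.* k ≡ suc a)
    case zero    ()
    case (suc c) eq = ℕₚ.<⇒≱ 1+a<k (ℕₚ.≤-trans (ℕₚ.m≤m+n k (c ℕ.* k)) (ℕₚ.≤-reflexive eq))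

  module LargeWheel (k : ℕ) (3≤k : 3 ℕ.≤ k) (5≤k : 5 ℕ.≤ k) where

    W : Graph
    W = cone (cycle k 3≤k)

    F : Faces (k ℕ.+ k)
    F = matchings W

    rim spoke : Fin k → Fin (k ℕ.+ k)
    rim i   = i ↑ˡ k
    spoke i = k ↑ʳ i

    IsSpoke : Fin (k ℕ.+ k) → Set
    IsSpoke e = ∃ λ i → e ≡ spoke i

    ends-rim : ∀ i → Graph.ends W (rim i) ≡ (suc i , suc (next i))
    ends-rim i rewrite splitAt-↑ˡ k i k = ≡.refl

    ends-spoke : ∀ i → Graph.ends W (spoke i) ≡ (zero , suc i)
    ends-spoke i rewrite splitAt-↑ʳ k k i = ≡.refl

    rim-not-spoke : ∀ i → ¬ IsSpoke (rim i)
    rim-not-spoke i (j , eq) with ≡.trans (≡.sym (splitAt-↑ˡ k i k)) (≡.trans (≡.cong (splitAt k) eq) (splitAt-↑ʳ k k j))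
    ... | ()

    spoke-injective : ∀ {i j} → spoke i ≡ spoke j → i ≡ j
    spoke-injective {i} {j} eq with ≡.trans (≡.sym (splitAt-↑ʳ k k i)) (≡.trans (≡.cong (splitAt k) eq) (splitAt-↑ʳ k k j))
    ... | ≡.refl = ≡.refl

    rim-or-spoke : ∀ e → (∃ λ i → e ≡ rim i) ⊎ IsSpoke e
    rim-or-spoke e with splitAt k e in eq
    ... | inj₁ i = inj₁ (i , ≡.sym (splitAt⁻¹-↑ˡ {m = k} {i = e} eq))
    ... | inj₂ i = inj₂ (i , ≡.sym (splitAt⁻¹-↑ʳ {m = k} {i = e} eq))

    spoke∈hub : ∀ i → spoke i ∈ incident W zero
    spoke∈hub i = ∈-incident⁺ W (inj₁ (≡.cong proj₁ (ends-spoke i)))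

    rim∉hub : ∀ i → rim i ∉ incident W zero
    rim∉hub i p with ends-rim i | ∈-incident⁻ W p
    ... | eq | inj₁ q with ≡.trans (≡.sym (≡.cong proj₁ eq)) q
    ...   | ()
    rim∉hub i p | eq | inj₂ q with ≡.trans (≡.sym (≡.cong proj₂ eq)) q
    ...   | ()

    rim∈ : ∀ i u → rim i ∈ incident W (suc u) → i ≡ u ⊎ next i ≡ u
    rim∈ i u p with ∈-incident⁻ W p
    ... | inj₁ q = inj₁ (suc-injective (≡.trans (≡.sym (≡.cong proj₁ (ends-rim i))) q))
    ... | inj₂ q = inj₂ (suc-injective (≡.trans (≡.sym (≡.cong proj₂ (ends-rim i))) q))

    spoke∈ : ∀ i u → spoke i ∈ incident W (suc u) → i ≡ u
    spoke∈ i u p with ∈-incident⁻ W p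
    ... | inj₂ q = suc-injective (≡.trans (≡.sym (≡.cong proj₂ (ends-spoke i))) q)
    ... | inj₁ q with ≡.trans (≡.sym (≡.cong proj₁ (ends-spoke i))) q
    ...   | ()

    -- Apart from its spoke, a rim vertex has only the edges `rim u` and `rim m` with `next m ≡ u`.
    -- The predecessor is searched for among the finitely many vertices.
    degree≤2 : ∀ {p} u → p ⊆ incident W (suc u) → spoke u ∉ p → ∣ p ∣ ℕ.≤ 2
    degree≤2 {p} u p⊆ s∉p with any? (λ m → next m ≟ u)
    ... | yes (m , next-m≡u) = ∣p∣≤2 (rim u) (rim m) λ {e} e∈p → edge e e∈p
      where
      edge : ∀ e → e ∈ p → e ≡ rim u ⊎ e ≡ rim m
      edge e e∈p with rim-or-spoke e
      ... | inj₂ (i , ≡.refl) = contradiction (≡.subst (λ i → spoke i ∈ p) (spoke∈ i u (p⊆ e∈p)) e∈p) s∉p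
      ... | inj₁ (i , ≡.refl) with rim∈ i u (p⊆ e∈p)
      ...   | inj₁ i≡u      = inj₁ (≡.cong rim i≡u)
      ...   | inj₂ next-i≡u = inj₂ (≡.cong rim (next-injective (≡.trans next-i≡u (≡.sym next-m≡u))))
    ... | no  none = ∣p∣≤2 (rim u) (rim u) λ {e} e∈p → edge e e∈p
      where
      edge : ∀ e → e ∈ p → e ≡ rim u ⊎ e ≡ rim u
      edge e e∈p with rim-or-spoke e
      ... | inj₂ (i , ≡.refl) = contradiction (≡.subst (λ i → spoke i ∈ p) (spoke∈ i u (p⊆ e∈p)) e∈p) s∉p
      ... | inj₁ (i , ≡.refl) with rim∈ i u (p⊆ e∈p)
      ...   | inj₁ i≡u      = inj₁ (≡.cong rim i≡u)
      ...   | inj₂ next-i≡u = contradiction (i , next-i≡u) none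

    -- Only the ends of the new edge can gain degree, and a rim vertex without its spoke has degree
    -- at most 2 for every choice of rim edges.
    add-rim : ∀ {τ} i → Face F τ → spoke i ∉ τ → spoke (next i) ∉ τ → Face F (τ ∪ ⁅ rim i ⁆)
    add-rim {τ} i τ∈F s∉ s′∉ v = bound v
      where
      unchanged : ∀ v → rim i ∉ incident W v → degree W (τ ∪ ⁅ rim i ⁆) v ℕ.≤ 2
      unchanged v rim∉ = ℕₚ.≤-trans (p⊆q⇒∣p∣≤∣q∣ {p = (τ ∪ ⁅ rim i ⁆) ∩ incident W v} {τ ∩ incident W v} λ e∈ →
        let (e∈τ∪rim , e∈inc) = x∈p∩q⁻ (τ ∪ ⁅ rim i ⁆) (incident W v) e∈
        in x∈p∩q⁺ ([ id , (λ e∈rim → contradiction (≡.subst (_∈ incident W v) (x∈⁅y⁆⇒x≡y (rim i) e∈rim) e∈inc) rim∉) ]′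
             (x∈p∪q⁻ τ ⁅ rim i ⁆ e∈τ∪rim) , e∈inc)) (τ∈F v)
      without-spoke : ∀ u → spoke u ∉ τ → degree W (τ ∪ ⁅ rim i ⁆) (suc u) ℕ.≤ 2
      without-spoke u s∉τ = degree≤2 u (λ e∈ → proj₂ (x∈p∩q⁻ (τ ∪ ⁅ rim i ⁆) (incident W (suc u)) e∈)) λ s∈ →
        [ s∉τ , (λ s∈rim → rim-not-spoke i (u , ≡.sym (x∈⁅y⁆⇒x≡y (rim i) s∈rim))) ]′
          (x∈p∪q⁻ τ ⁅ rim i ⁆ (proj₁ (x∈p∩q⁻ (τ ∪ ⁅ rim i ⁆) (incident W (suc u)) s∈)))
      bound : ∀ v → degree W (τ ∪ ⁅ rim i ⁆) v ℕ.≤ 2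
      bound zero = unchanged zero (rim∉hub i)
      bound (suc u) with rim i ∈? incident W (suc u)
      ... | no  rim∉ = unchanged (suc u) rim∉
      ... | yes p with rim∈ i u p
      ...   | inj₁ ≡.refl = without-spoke i s∉
      ...   | inj₂ ≡.refl = without-spoke (next i) s′∉

    at-most-two-spokes : ∀ {τ i j l} → Face F τ → spoke i ∈ τ → spoke j ∈ τ → i ≢ j → i ≢ l → j ≢ l → spoke l ∉ τ
    at-most-two-spokes {τ} {i} {j} {l} τ∈F i∈ j∈ i≢j i≢l j≢l l∈ = ℕₚ.<⇒≱
      (3≤∣p∣ (hub i∈) (hub j∈) (hub l∈) (i≢j ∘ spoke-injective) (i≢l ∘ spoke-injective) (j≢l ∘ spoke-injective)) (τ∈F zero)
      where
      hub : ∀ {i} → spoke i ∈ τ → spoke i ∈ τ ∩ incident W zero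
      hub {i} p = x∈p∩q⁺ (p , spoke∈hub i)

    -- The first vertex after `i` that, like its successor, differs from `i` and `j`. For j = i + 2
    -- the successor is i + 4, and its being different from `i` is what requires `5 ≤ k`.
    gap : Fin k → Fin k → Fin k
    gap i j with j ≟ next^ 1 i | j ≟ next^ 2 i
    ... | yes _ | _     = next^ 2 i
    ... | no  _ | yes _ = next^ 3 i
    ... | no  _ | no  _ = next^ 1 i

    apart : ∀ a i → suc a ℕ.≤ 4 → i ≢ next^ (suc a) i
    apart a i 1+a≤4 eq = next^-≢ a i (ℕₚ.≤-trans (s≤s 1+a≤4) 5≤k) (≡.sym eq)

    1≤4 : 1 ℕ.≤ 4
    1≤4 = s≤s z≤n
    2≤4 : 2 ℕ.≤ 4
    2≤4 = s≤s (s≤s z≤n)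
    3≤4 : 3 ℕ.≤ 4
    3≤4 = s≤s (s≤s (s≤s z≤n))

    gap-spec : ∀ i j → (i ≢ gap i j × j ≢ gap i j) × (i ≢ next (gap i j) × j ≢ next (gap i j))
    gap-spec i j with j ≟ next^ 1 i | j ≟ next^ 2 i
    ... | yes ≡.refl | _ = (apart 1 i 2≤4 , apart 0 j 1≤4) , (apart 2 i 3≤4 , apart 1 j 2≤4)
    ... | no  _ | yes ≡.refl = (apart 2 i 3≤4 , apart 0 j 1≤4) , (apart 3 i ℕₚ.≤-refl , apart 1 j 2≤4)
    ... | no p | no q = (apart 0 i 1≤4 , p) , (apart 1 i 2≤4 , q)

    -- The pairs are ordered, so every set of two spokes occurs twice; its second removal takes
    -- nothing away.
    pairs : List (Fin k × Fin k)
    pairs = filter (λ (i , j) → ¬? (i ≟ j)) (cartesianProduct (allFin k) (allFin k))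

    pairMove : Fin k × Fin k → Move (k ℕ.+ k)
    pairMove (i , j) = ⁅ spoke i ⁆ ∪ ⁅ spoke j ⁆ , rim (gap i j)

    -- `rim (next i)` joins i + 1 and i + 2, at which no spoke is left once the faces with two
    -- spokes are gone.
    singleMove : Fin k → Move (k ℕ.+ k)
    singleMove i = ⁅ spoke i ⁆ , rim (next i)

    pairMoves singleMoves : List (Move (k ℕ.+ k))
    pairMoves   = map pairMove pairs
    singleMoves = map singleMove (allFin k)

    pairs-independent : All (Independent F IsSpoke) pairMoves
    pairs-independent = All.tabulate λ m∈ → independent m∈
      where
      independent : ∀ {m} → m ∈ˡ pairMoves → Independent F IsSpoke m
      independent m∈ with ∈-map⁻ pairMove m∈
      ... | (i , j) , ij∈ , ≡.refl = record
        { nonempty = spoke i , p⊆p∪q ⁅ spoke j ⁆ (x∈⁅x⁆ (spoke i))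
        ; base     = λ e∈ → [ (λ p → i , x∈⁅y⁆⇒x≡y (spoke i) p) , (λ p → j , x∈⁅y⁆⇒x≡y (spoke j) p) ]′
                              (x∈p∪q⁻ ⁅ spoke i ⁆ ⁅ spoke j ⁆ e∈)
        ; apex     = rim-not-spoke (gap i j)
        ; joinable = λ τ σ⊆τ τ∈F →
            let i∈τ = σ⊆τ (p⊆p∪q ⁅ spoke j ⁆ (x∈⁅x⁆ (spoke i)))
                j∈τ = σ⊆τ (q⊆p∪q ⁅ spoke i ⁆ ⁅ spoke j ⁆ (x∈⁅x⁆ (spoke j)))
                i≢j = proj₂ (∈-filter⁻ (λ (i , j) → ¬? (i ≟ j)) {xs = cartesianProduct (allFin k) (allFin k)} ij∈)
                ((i≢l , j≢l) , (i≢l′ , j≢l′)) = gap-spec i j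
            in add-rim (gap i j) τ∈F (at-most-two-spokes τ∈F i∈τ j∈τ i≢j i≢l j≢l)
                                     (at-most-two-spokes τ∈F i∈τ j∈τ i≢j i≢l′ j≢l′)
        }

    F₁ F₂ : Faces (k ℕ.+ k)
    F₁ = F ∖∖ pairMoves
    F₂ = F₁ ∖∖ singleMoves

    one-spoke : ∀ {τ i j} → Face F₁ τ → spoke i ∈ τ → i ≢ j → spoke j ∉ τ
    one-spoke {τ} {i} {j} τ∈F₁ i∈τ i≢j j∈τ = All.lookup (proj₂ (∖∖⁻ F pairMoves τ∈F₁))
      (∈-map⁺ pairMove (∈-filter⁺ (λ (i , j) → ¬? (i ≟ j)) (∈-cartesianProduct⁺ (∈-allFin i) (∈-allFin j)) i≢j))
      λ e∈ → [ (λ p → ≡.subst (_∈ τ) (≡.sym (x∈⁅y⁆⇒x≡y (spoke i) p)) i∈τ)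
             , (λ p → ≡.subst (_∈ τ) (≡.sym (x∈⁅y⁆⇒x≡y (spoke j) p)) j∈τ) ]′ (x∈p∪q⁻ ⁅ spoke i ⁆ ⁅ spoke j ⁆ e∈)

    no-spoke : ∀ {τ} i → Face F₂ τ → spoke i ∉ τ
    no-spoke {τ} i τ∈F₂ i∈τ = All.lookup (proj₂ (∖∖⁻ F₁ singleMoves τ∈F₂)) (∈-map⁺ singleMove (∈-allFin i))
      λ e∈ → ≡.subst (_∈ τ) (≡.sym (x∈⁅y⁆⇒x≡y (spoke i) e∈)) i∈τ

    F₁-add : ∀ {τ} i → Face F₁ τ → spoke i ∉ τ → spoke (next i) ∉ τ → Face F₁ (τ ∪ ⁅ rim i ⁆)
    F₁-add i τ∈F₁ s∉ s′∉ = let (τ∈F , avoids) = ∖∖⁻ F pairMoves τ∈F₁ in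
      ∖∖⁺ F pairMoves (add-rim i τ∈F s∉ s′∉) (avoids-add pairs-independent (rim-not-spoke i) avoids)

    singles-independent : All (Independent F₁ IsSpoke) singleMoves
    singles-independent = All.tabulate λ m∈ → independent m∈
      where
      independent : ∀ {m} → m ∈ˡ singleMoves → Independent F₁ IsSpoke m
      independent m∈ with ∈-map⁻ singleMove m∈
      ... | i , _ , ≡.refl = record
        { nonempty = spoke i , x∈⁅x⁆ (spoke i)
        ; base     = λ e∈ → i , x∈⁅y⁆⇒x≡y (spoke i) e∈
        ; apex     = rim-not-spoke (next i)
        ; joinable = λ τ σ⊆τ τ∈F₁ → let i∈τ = σ⊆τ (x∈⁅x⁆ (spoke i)) in
            F₁-add (next i) τ∈F₁ (one-spoke τ∈F₁ i∈τ (apart 0 i 1≤4)) (one-spoke τ∈F₁ i∈τ (apart 1 i 2≤4))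
        }

    contractible : Fin k → ∥ F ∥ᶠ ≃ point
    contractible i =
      ≃-trans (stableSpace F) stable-point (collapses-≃ F pairMoves (independent⇒collapsible F pairMoves pairs-independent))
      (≃-trans (stableSpace F₁) stable-point (collapses-≃ F₁ singleMoves (independent⇒collapsible F₁ singleMoves singles-independent))
      (cone-≃-point F₂ (rim i) empty (λ τ τ∈F₂ → let (τ∈F₁ , avoids) = ∖∖⁻ F₁ singleMoves τ∈F₂ in
        ∖∖⁺ F₁ singleMoves (F₁-add i τ∈F₁ (no-spoke i τ∈F₂) (no-spoke (next i) τ∈F₂))
          (avoids-add singles-independent (rim-not-spoke i) avoids))))
      where
      stable-point : StableSpace point
      stable-point = record { stable = λ _ _ → tt ; respects = λ _ _ → tt }
      empty : Face F₂ Subset.⊥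
      empty = ∖∖⁺ F₁ singleMoves (∖∖⁺ F pairMoves
        (down F (⊆-min ⁅ rim i ⁆) (SimplicialComplex.vertex (M₂ W) (rim i)))
        (avoids-⊥ pairs-independent)) (avoids-⊥ singles-independent)

-- The homeomorphism between the boundary of a simplex and the sphere.

module BoundaryOfSimplex (R : RealField) where

  open OrderedField R
  open SquareRoot R
  open Continuity R
  open Realizations R
  open SmallWheels R using (boundary)
  open import Algebra.Apartness.Bundles using (HeytingField)
  import Algebra.Properties.Semiring.Sum as SemiringSum
  open import Data.Empty using (⊥; ⊥-elim)
  open import Data.Fin.Base using (Fin; zero; suc)
  open import Data.Fin.Subset using (Subset)
  import Data.Fin.Subset as Subset
  open import Data.Fin.Subset.Properties using (_∈?_; ∈⊤)
  open import Data.Integer.Base using (+_)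
  open import Data.Nat.Base using (ℕ; zero; suc)
  open import Data.Product.Base using (∃; _,_; proj₁; proj₂)
  open import Data.Sum.Base using (_⊎_; inj₁; inj₂)
  open import Data.Vec.Base using ([]; _∷_)
  open import Data.Vec.Functional using (replicate)
  open import Function.Base using (_∘_; id)
  open import Function.Bundles using (Equivalence)
  open import Relation.Nullary using (Stable)
  open import Relation.Nullary.Decidable using (decidable-stable)
  open RealField R
  open Topology R
  open Space
  open Map
  open Solver using (solve; con; _:=_; _:+_; _:*_; _:-_; :-_)
  open SemiringSum ℝ.semiring using (sum-cong-≋; *-distribˡ-sum; sum-replicate)

  record Homeo (X Y : Space) : Set where
    field
      to      : Map X Y
      from    : Map Y X
      from∘to : ∀ x → Eq X (fun from (fun to x)) x
      to∘from : ∀ y → Eq Y (fun to (fun from y)) y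

  opaque
    ∀-or-∃ : ∀ {n} {P Q : Fin n → Set} → (∀ i → P i ⊎ Q i) → (∀ i → P i) ⊎ ∃ Q
    ∀-or-∃ {zero}  f = inj₁ λ ()
    ∀-or-∃ {suc n} f with f zero | ∀-or-∃ (f ∘ suc)
    ... | inj₂ q | _           = inj₂ (zero , q)
    ... | inj₁ p | inj₁ ps      = inj₁ λ { zero → p ; (suc i) → ps i }
    ... | inj₁ p | inj₂ (i , q) = inj₂ (suc i , q)

  opaque
    -- By cotransitivity the first term is positive or smaller than the sum, and then the remaining
    -- sum is positive. The index is thus actually found.
    positive-term : ∀ {n} (x : Fin n → ℝ) → 0# < sum x → ∃ λ i → 0# < x i
    positive-term {zero}  x 0<Σ = ⊥-elim (<-irrefl 0<Σ)
    positive-term {suc n} x 0<Σ with <-cotrans 0<Σ (x zero)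
    ... | inj₁ 0<x₀ = zero , 0<x₀
    ... | inj₂ x₀<Σ =
      let (i , p) = positive-term (x ∘ suc) (<-respʳ (solve 2 (λ a b → a :+ b :- a := b) ℝ.refl (x zero) _) (<⇒0< x₀<Σ))
      in suc i , p

  opaque
    term≤sum : ∀ {n} (x : Fin n → ℝ) → (∀ i → 0# ≤ x i) → ∀ i → x i ≤ sum x
    term≤sum x x≥0 zero    = ≤-by (sum-nonneg (x ∘ suc) (x≥0 ∘ suc))
      (solve 2 (λ a b → b := a :+ b :- a) ℝ.refl (x zero) _)
    term≤sum x x≥0 (suc i) = ≤-trans (term≤sum (x ∘ suc) (x≥0 ∘ suc) i)
      (≤-by (x≥0 zero) (solve 2 (λ a b → a := a :+ b :- b) ℝ.refl (x zero) _))

  opaque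
    square-pos-± : ∀ {x} → 0# < x ⊎ x < 0# → 0# < x * x
    square-pos-± (inj₁ 0<x) = *-pos 0<x 0<x
    square-pos-± {x} (inj₂ x<0) = <-respʳ (solve 1 (λ x → (con (+ 0) :- x) :* (con (+ 0) :- x) := x :* x) ℝ.refl x)
      (*-pos (<⇒0< x<0) (<⇒0< x<0))

  opaque
    -- If z inverts the square of x, then x z inverts x; invertible elements are apart from zero,
    -- and apartness comes with a sign.
    ±-of-square : ∀ {x} → 0# < x * x → 0# < x ⊎ x < 0#
    ±-of-square {x} 0<x² with inverse 0<x²
    ... | z , _ , x²z≈1 with Equivalence.to #⇔<⊎> (HeytingField.invertible⇒# heytingField {x} {0#}
      (x * z , ℝ.trans (solve 2 (λ x z → x :* z :* (x :- con (+ 0)) := x :* x :* z) ℝ.refl x z) x²z≈1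
             , ℝ.trans (solve 2 (λ x z → (x :- con (+ 0)) :* (x :* z) := x :* x :* z) ℝ.refl x z) x²z≈1))
    ...   | inj₁ x<0 = inj₂ x<0
    ...   | inj₂ 0<x = inj₁ 0<x

  opaque
    square-injective : ∀ {x y} → 0# < x → 0# < y → x * x ≈ y * y → x ≈ y
    square-injective {x} {y} 0<x 0<y x²≈y² = ≤-antisym (bound 0<x 0<y x²≈y²) (bound 0<y 0<x (ℝ.sym x²≈y²))
      where
      bound : ∀ {x y} → 0# < x → 0# < y → x * x ≈ y * y → x ≤ y
      bound {x} {y} 0<x 0<y x²≈y² = ≤-by (*-cancelˡ-nonneg (+-pos 0<x 0<y) (≈⇒≤ (ℝ.trans
        (ℝ.sym (ℝ.-‿inverseʳ (x * x))) (ℝ.trans (ℝ.+-congʳ x²≈y²)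
          (solve 2 (λ x y → y :* y :- x :* x := (x :+ y) :* (y :- x)) ℝ.refl x y))))) ℝ.refl

  opaque
    minimum-≤-initial : ∀ {n} (σ : Subset n) c x → minimum σ c x ≤ c
    minimum-≤-initial []            c x = ≤-refl
    minimum-≤-initial (Subset.inside  ∷ σ) c x = ≤-trans (x⊓y≤y _ _) (minimum-≤-initial σ c (x ∘ suc))
    minimum-≤-initial (Subset.outside ∷ σ) c x = minimum-≤-initial σ c (x ∘ suc)

  -- Subtracting the weight of the vertex one from the other weights maps the
  -- boundary of the simplex to a polytope around the origin, from which it is
  -- projected radially onto the sphere.  Conversely the coordinates of a point
  -- of the sphere, with 0 for the vertex one, are shifted so that their minimum
  -- is 0 and rescaled so that their sum is 1.
  module BoundarySphere (d : ℕ) where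

    ∂ : Faces (suc (suc d))
    ∂ = boundary (suc (suc d))

    -- The origin of the coordinates is taken here and not at `zero`, because then the base vertex
    -- `zero` has the differences (1, 0, ..., 0), the basepoint of `𝕊 d`.
    one : Fin (suc (suc d))
    one = suc zero

    rest : Fin (suc d) → Fin (suc (suc d))
    rest zero    = zero
    rest (suc j) = suc (suc j)

    opaque
      -- If no weight vanished, the set of all vertices would be a face. Which weight vanishes
      -- cannot be computed.
      some-zero : ∀ {A : Set} → Stable A → (w : Point ∣ ∂ ∣) → (∀ v → proj₁ w v ≈ 0# → A) → A
      some-zero stable w f = by-support stable (proj₁ w) λ τ s → stable λ ¬A →
        support-face ∂ w s λ v → decidable-stable (v ∈? τ) λ v∉τ →
          ¬A (f v (≤-antisym (λ 0<w → v∉τ (Support.pos⇒∈ s 0<w)) (proj₁ (proj₂ w) v)))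

    difference : (Fin (suc (suc d)) → ℝ) → Fin (suc d) → ℝ
    difference w j = w (rest j) - w one

    norm² : (Fin (suc (suc d)) → ℝ) → ℝ
    norm² w = sum (λ j → difference w j * difference w j)

    -- Some weight lies below the average: otherwise all of them are positive.
    opaque
      smaller-weight : (w : Point ∣ ∂ ∣) → ∃ λ v → suc (suc d) · proj₁ w v < 1#
      smaller-weight (w , w≥0 , Σw≈1 , carried) = choose (∀-or-∃ λ v → <-cotrans 0<θ (w v))
        where
        N : ℝ
        N = suc (suc d) · 1#
        ·≈* : ∀ n x → n · x ≈ (n · 1#) * x
        ·≈* zero    x = ℝ.sym (ℝ.zeroˡ x)
        ·≈* (suc n) x = ℝ.trans (ℝ.+-congˡ (·≈* n x))
          (solve 2 (λ x m → x :+ m :* x := (con (+ 1) :+ m) :* x) ℝ.refl x (n · 1#))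
        ·-nonneg : ∀ n → 0# ≤ n · 1#
        ·-nonneg zero    = ≤-refl
        ·-nonneg (suc n) = +-nonneg (<⇒≤ 0<1) (·-nonneg n)
        0<N : 0# < N
        0<N = +-pos-nonneg 0<1 (·-nonneg (suc d))
        θ : ℝ
        θ = proj₁ (inverse 0<N)
        0<θ : 0# < θ
        0<θ = proj₁ (proj₂ (inverse 0<N))
        Nθ≈1 : N * θ ≈ 1#
        Nθ≈1 = proj₂ (proj₂ (inverse 0<N))
        choose : (∀ v → 0# < w v) ⊎ ∃ (λ v → w v < θ) → ∃ λ v → suc (suc d) · w v < 1#
        choose (inj₁ pos) = ⊥-elim (carried Subset.⊤ (λ {v} _ → pos v) (λ v → ∈⊤))
        choose (inj₂ (v , w<θ)) = v , <-by (*-pos 0<N (<⇒0< w<θ)) (ℝ.trans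
          (solve 3 (λ N θ w → N :* (θ :- w) := N :* θ :- N :* w) ℝ.refl N θ (w v))
          (ℝ.+-cong Nθ≈1 (ℝ.-‿cong (ℝ.sym (·≈* (suc (suc d)) (w v))))))

    opaque
      -- The differences `w u - w v` add up to 1 minus d + 2 times `w v`, which is positive, so one
      -- of them is.
      larger-weight : (w : Point ∣ ∂ ∣) → ∀ v → suc (suc d) · proj₁ w v < 1# → ∃ λ u → proj₁ w v < proj₁ w u
      larger-weight (w , w≥0 , Σw≈1 , carried) v Nw<1 =
        let (u , p) = positive-term (λ u → w u + (0# - 1#) * replicate (suc (suc d)) (w v) u)
                        (<-respʳ (ℝ.sym (ℝ.trans (sum-linear w (replicate (suc (suc d)) (w v)) (0# - 1#))
                          (ℝ.trans (ℝ.+-cong Σw≈1 (ℝ.*-congˡ (sum-replicate (suc (suc d)))))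
                            (solve 1 (λ x → con (+ 1) :+ (con (+ 0) :- con (+ 1)) :* x := con (+ 1) :- x) ℝ.refl (suc (suc d) · w v)))))
                          (<⇒0< Nw<1))
        in u , <-by p (solve 2 (λ a b → a :+ (con (+ 0) :- con (+ 1)) :* b := a :- b) ℝ.refl (w u) (w v))

    opaque
      -- Of two unequal weights at least one differs from the weight at `one`; cotransitivity tells
      -- which, and its difference contributes a positive square.
      norm²-positive : (w : Point ∣ ∂ ∣) → 0# < norm² (proj₁ w)
      norm²-positive w′@(w , _) =
        let (v , Nw<1) = smaller-weight w′
            (u , wv<wu) = larger-weight w′ v Nw<1
        in unequal u v (<-cotrans (<-by (<⇒0< wv<wu)
             (solve 3 (λ a b c → a :- b := (a :- c) :- (b :- c)) ℝ.refl (w u) (w v) (w one))) 0#)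
        where
        apart-one : ∀ v → 0# < w v - w one ⊎ w v - w one < 0# → 0# < norm² w
        apart-one v@zero          h = <-≤-trans (square-pos-± h) (term≤sum (λ j → difference w j * difference w j) (λ j → square-nonneg _) zero)
        apart-one v@(suc (suc j)) h = <-≤-trans (square-pos-± h) (term≤sum (λ j → difference w j * difference w j) (λ j → square-nonneg _) (suc j))
        apart-one (suc zero) (inj₁ p) = ⊥-elim (<-irrefl (<-respʳ (ℝ.-‿inverseʳ _) p))
        apart-one (suc zero) (inj₂ p) = ⊥-elim (<-irrefl (<-respˡ (ℝ.-‿inverseʳ _) p))
        unequal : ∀ u v → w v - w one < 0# ⊎ 0# < w u - w one → 0# < norm² w
        unequal u v (inj₁ p) = apart-one v (inj₂ p)
        unequal u v (inj₂ p) = apart-one u (inj₁ p)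

    norm : Point ∣ ∂ ∣ → ℝ
    norm = root ∣ ∂ ∣ (norm² ∘ proj₁) norm²-positive

    norm-positive : ∀ w → 0# < norm w
    norm-positive w = proj₁ (proj₂ (sqrt (norm²-positive w)))

    norm-square : ∀ w → norm w * norm w ≈ norm² (proj₁ w)
    norm-square w = proj₂ (proj₂ (sqrt (norm²-positive w)))

    scale : Point ∣ ∂ ∣ → ℝ
    scale = recip ∣ ∂ ∣ norm norm-positive

    scale-positive : ∀ w → 0# < scale w
    scale-positive w = proj₁ (proj₂ (inverse (norm-positive w)))

    norm-scale : ∀ w → norm w * scale w ≈ 1#
    norm-scale w = proj₂ (proj₂ (inverse (norm-positive w)))

    direction : Point ∣ ∂ ∣ → Fin (suc d) → ℝ
    direction w j = scale w * difference (proj₁ w) j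

    opaque
      sum-of-squares : ∀ {n} (c : ℝ) (y : Fin n → ℝ) → sum (λ j → c * y j * (c * y j)) ≈ c * c * sum (λ j → y j * y j)
      sum-of-squares c y = ℝ.trans
        (sum-cong-≋ λ j → solve 2 (λ c y → c :* y :* (c :* y) := c :* c :* (y :* y)) ℝ.refl c (y j))
        (ℝ.sym (*-distribˡ-sum (c * c) (λ j → y j * y j)))

    opaque
      direction∈ : ∀ w → In (sphere d) (direction w)
      direction∈ w = ℝ.trans (sum-of-squares (scale w) (difference (proj₁ w)))
        (ℝ.trans (ℝ.*-congˡ (ℝ.sym (norm-square w)))
          (ℝ.trans (solve 2 (λ s t → t :* t :* (s :* s) := (s :* t) :* (s :* t)) ℝ.refl (norm w) (scale w))
            (ℝ.trans (ℝ.*-cong (norm-scale w) (norm-scale w)) (ℝ.*-identityˡ 1#))))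

    cont-difference : ∀ j → Cont ∣ ∂ ∣ (λ w → difference (proj₁ w) j)
    cont-difference j = cont-minus ∣ ∂ ∣ (cont-coord ∣ ∂ ∣ (rest j)) (cont-coord ∣ ∂ ∣ one)

    toSphere : Map ∣ ∂ ∣ (sphere d)
    toSphere = mapOf ∣ ∂ ∣ (sphere d) direction direction∈ λ j → cont-* ∣ ∂ ∣
      (cont-recip ∣ ∂ ∣ (cont-root ∣ ∂ ∣ (cont-sum ∣ ∂ ∣ λ j → cont-* ∣ ∂ ∣ (cont-difference j) (cont-difference j)) norm²-positive)
        norm-positive)
      (cont-difference j)

    extend : (Fin (suc d) → ℝ) → Fin (suc (suc d)) → ℝ
    extend y zero          = y zero
    extend y (suc zero)    = 0#
    extend y (suc (suc j)) = y (suc j)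

    extend-rest : ∀ y j → extend y (rest j) ≈ y j
    extend-rest y zero    = ℝ.refl
    extend-rest y (suc j) = ℝ.refl

    lowest : (Fin (suc d) → ℝ) → ℝ
    lowest y = minimum Subset.⊤ 0# y

    opaque
      lowest≤ : ∀ y v → lowest y ≤ extend y v
      lowest≤ y zero          = minimum-≤ Subset.⊤ 0# y {zero} ∈⊤
      lowest≤ y (suc zero)    = minimum-≤-initial Subset.⊤ 0# y
      lowest≤ y (suc (suc j)) = minimum-≤ Subset.⊤ 0# y {suc j} ∈⊤

    opaque
      lowest-glb : ∀ y z → (∀ v → z ≤ extend y v) → z ≤ lowest y
      lowest-glb y z z≤ = minimum-glb Subset.⊤ 0# y (z≤ one) λ { zero → z≤ zero ; (suc j) → z≤ (suc (suc j)) }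

    opaque
      lowest-attained : ∀ {A : Set} → Stable A → ∀ y → (∀ v → lowest y ≈ extend y v → A) → A
      lowest-attained stable y f = minimum-attained stable Subset.⊤ 0# y (f one)
        λ { {zero} _ → f zero ; {suc j} _ → f (suc (suc j)) }

    height : (Fin (suc d) → ℝ) → Fin (suc (suc d)) → ℝ
    height y v = extend y v - lowest y

    height-nonneg : ∀ y v → 0# ≤ height y v
    height-nonneg y v = ≤⇒0≤ (lowest≤ y v)

    total : (Fin (suc d) → ℝ) → ℝ
    total y = sum (height y)

    opaque
      -- A unit vector has a coordinate apart from zero. If it is positive, its own height is
      -- positive because `lowest` is at most 0; if it is negative, the height of `one` is positive.
      total-positive : (y : Point (sphere d)) → 0# < total (proj₁ y)
      total-positive (y , Σy²≈1) =
        let (j , 0<y²) = positive-term (λ j → y j * y j) (<-respʳ (ℝ.sym Σy²≈1) 0<1)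
        in positive j (±-of-square 0<y²)
        where
        through : ∀ v → 0# < height y v → 0# < total y
        through v p = <-≤-trans p (term≤sum (height y) (height-nonneg y) v)
        positive : ∀ j → 0# < y j ⊎ y j < 0# → 0# < total y
        positive j (inj₁ 0<y) = through (rest j) (<-by (+-pos-nonneg 0<y (≤⇒0≤ (lowest≤ y one)))
          (ℝ.trans (solve 2 (λ y m → y :+ (con (+ 0) :- m) := (y :- m) :- con (+ 0)) ℝ.refl (y j) (lowest y))
            (ℝ.+-congʳ (ℝ.+-congʳ (ℝ.sym (extend-rest y j))))))
        positive j (inj₂ y<0) = through one (<-by (+-pos-nonneg (<⇒0< y<0) (≤⇒0≤ (lowest≤ y (rest j))))
          (ℝ.trans (ℝ.+-congˡ (ℝ.+-congʳ (extend-rest y j)))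
            (solve 2 (λ y m → (con (+ 0) :- y) :+ (y :- m) := (con (+ 0) :- m) :- con (+ 0)) ℝ.refl (y j) (lowest y))))

    unit : Point (sphere d) → ℝ
    unit = recip (sphere d) (total ∘ proj₁) total-positive

    unit-positive : ∀ y → 0# < unit y
    unit-positive y = proj₁ (proj₂ (inverse (total-positive y)))

    total-unit : ∀ y → total (proj₁ y) * unit y ≈ 1#
    total-unit y = proj₂ (proj₂ (inverse (total-positive y)))

    weights : Point (sphere d) → Fin (suc (suc d)) → ℝ
    weights y v = unit y * height (proj₁ y) v

    opaque
      weights∈ : ∀ y → In ∣ ∂ ∣ (weights y)
      weights∈ y = (λ v → *-nonneg (<⇒≤ (unit-positive y)) (height-nonneg (proj₁ y) v))
        , ℝ.trans (ℝ.sym (*-distribˡ-sum (unit y) (height (proj₁ y)))) (ℝ.trans (ℝ.*-comm _ _) (total-unit y))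
        , λ σ σ⊆ full → lowest-attained {A = ⊥} (λ k → k id) (proj₁ y) λ v m≈y →
            ≈⇒≤ (ℝ.trans (ℝ.*-congˡ (ℝ.trans (ℝ.+-congˡ (ℝ.-‿cong m≈y)) (ℝ.-‿inverseʳ _))) (ℝ.zeroʳ _)) (σ⊆ (full v))

    cont-extend : ∀ v → Cont (sphere d) (λ y → extend (proj₁ y) v)
    cont-extend zero          = cont-coord (sphere d) zero
    cont-extend (suc zero)    = cont-const (sphere d) 0#
    cont-extend (suc (suc j)) = cont-coord (sphere d) (suc j)

    cont-height : ∀ v → Cont (sphere d) (λ y → height (proj₁ y) v)
    cont-height v = cont-minus (sphere d) (cont-extend v)
      (cont-minimum (sphere d) Subset.⊤ (cont-const (sphere d) 0#) (cont-coord (sphere d)))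

    fromSphere : Map (sphere d) ∣ ∂ ∣
    fromSphere = mapOf (sphere d) ∣ ∂ ∣ weights weights∈ λ v → cont-* (sphere d)
      (cont-recip (sphere d) (cont-sum (sphere d) cont-height) total-positive) (cont-height v)

    opaque
      extend-direction : ∀ w v → extend (direction w) v ≈ scale w * (proj₁ w v - proj₁ w one)
      extend-direction w zero          = ℝ.refl
      extend-direction w (suc zero)    = ℝ.sym (ℝ.trans (ℝ.*-congˡ (ℝ.-‿inverseʳ _)) (ℝ.zeroʳ _))
      extend-direction w (suc (suc j)) = ℝ.refl

    opaque
      -- All values `scale w * (w v - w one)` are at least the claimed one, and it is attained where
      -- the weight `w v` vanishes.
      lowest-direction : ∀ w → lowest (direction w) ≈ - (scale w * proj₁ w one)
      lowest-direction w = some-zero ≈-stable w λ v w≈0 → ≤-antisym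
        (≤-respʳ (ℝ.trans (extend-direction w v) (ℝ.trans (ℝ.*-congˡ (ℝ.+-congʳ w≈0))
            (solve 2 (λ t a → t :* (con (+ 0) :- a) := :- (t :* a)) ℝ.refl (scale w) (proj₁ w one))))
          (lowest≤ (direction w) v))
        (lowest-glb (direction w) _ λ u → ≤-respʳ (ℝ.sym (extend-direction w u))
          (≤-by (*-nonneg (<⇒≤ (scale-positive w)) (proj₁ (proj₂ w) u))
            (solve 3 (λ t a b → t :* b := t :* (b :- a) :- (:- (t :* a))) ℝ.refl (scale w) (proj₁ w one) (proj₁ w u))))

    opaque
      height-direction : ∀ w v → height (direction w) v ≈ scale w * proj₁ w v
      height-direction w v = ℝ.trans (ℝ.+-cong (extend-direction w v) (ℝ.-‿cong (lowest-direction w)))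
        (solve 3 (λ t a b → t :* (b :- a) :- (:- (t :* a)) := t :* b) ℝ.refl (scale w) (proj₁ w one) (proj₁ w v))

    opaque
      -- The heights are `scale w` times the weights, which add up to 1; so their total is
      -- `scale w`, and normalising cancels it.
      fromSphere∘toSphere : ∀ w → Eq ∣ ∂ ∣ (fun fromSphere (fun toSphere w)) w
      fromSphere∘toSphere w v = ℝ.trans (ℝ.*-congˡ (height-direction w v))
        (ℝ.trans (solve 3 (λ r t x → r :* (t :* x) := (t :* r) :* x) ℝ.refl r (scale w) (proj₁ w v))
          (ℝ.trans (ℝ.*-congʳ (ℝ.trans (ℝ.*-congʳ (ℝ.sym total≈scale)) (total-unit (fun toSphere w)))) (ℝ.*-identityˡ _)))
        where
        r : ℝ
        r = unit (fun toSphere w)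
        total≈scale : total (direction w) ≈ scale w
        total≈scale = ℝ.trans (sum-cong-≋ (height-direction w))
          (ℝ.trans (ℝ.sym (*-distribˡ-sum (scale w) (proj₁ w))) (ℝ.trans (ℝ.*-congˡ (proj₁ (proj₂ (proj₂ w)))) (ℝ.*-identityʳ _)))

    opaque
      difference-weights : ∀ y j → difference (weights y) j ≈ unit y * proj₁ y j
      difference-weights y j = ℝ.trans (ℝ.+-congʳ (ℝ.*-congˡ (ℝ.+-congʳ (extend-rest (proj₁ y) j))))
        (solve 3 (λ r a m → r :* (a :- m) :- r :* (con (+ 0) :- m) := r :* a) ℝ.refl (unit y) (proj₁ y j) (lowest (proj₁ y)))

    opaque
      norm-weights : ∀ y → norm (fun fromSphere y) ≈ unit y
      norm-weights y = square-injective (norm-positive (fun fromSphere y)) (unit-positive y)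
        (ℝ.trans (norm-square (fun fromSphere y))
          (ℝ.trans (sum-cong-≋ λ j → ℝ.*-cong (difference-weights y j) (difference-weights y j))
            (ℝ.trans (sum-of-squares (unit y) (proj₁ y)) (ℝ.trans (ℝ.*-congˡ (proj₂ y)) (ℝ.*-identityʳ _)))))

    opaque
      toSphere∘fromSphere : ∀ y → Eq (sphere d) (fun toSphere (fun fromSphere y)) y
      toSphere∘fromSphere y j = ℝ.trans (ℝ.*-congˡ (ℝ.trans (difference-weights y j) (ℝ.*-congʳ (ℝ.sym (norm-weights y)))))
        (ℝ.trans (solve 3 (λ t n a → t :* (n :* a) := (n :* t) :* a) ℝ.refl (scale (fun fromSphere y)) (norm (fun fromSphere y)) (proj₁ y j))
          (ℝ.trans (ℝ.*-congʳ (norm-scale (fun fromSphere y))) (ℝ.*-identityˡ _)))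

    boundary≅sphere : Homeo ∣ ∂ ∣ (sphere d)
    boundary≅sphere = record
      { to = toSphere ; from = fromSphere ; from∘to = fromSphere∘toSphere ; to∘from = toSphere∘fromSphere }

-- Wedges of complexes and wedges of spheres.

module Wedges (R : RealField) where

  open OrderedField R
  open Continuity R
  open Homotopies R
  open Realizations R
  open Collapsing R using (preimage)
  open SmallWheels R
  open BoundaryOfSimplex R
  import Algebra.Properties.Semiring.Sum as SemiringSum
  open import Data.Empty using (⊥; ⊥-elim)
  open import Data.Fin.Base using (Fin; zero; suc; splitAt; _↑ˡ_; _↑ʳ_)
  open import Data.Fin.Properties using (any?; splitAt-↑ˡ; splitAt-↑ʳ; splitAt⁻¹-↑ˡ; splitAt⁻¹-↑ʳ)
  open import Data.Fin.Subset using (_∈_; _∉_; ⁅_⁆)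
  open import Data.Fin.Subset.Properties using (_∈?_; x∈⁅x⁆; x∈⁅y⁆⇒x≡y)
  open import Data.Integer.Base using (+_)
  open import Data.Nat.Base as ℕ using (ℕ; zero; suc)
  open import Data.Product.Base using (∃; _,_; proj₁; proj₂)
  open import Data.Sum.Base using (_⊎_; inj₁; inj₂; [_,_]′)
  open import Data.Vec.Functional using (replicate; _∷_)
  open import Function.Base using (_∘_; id)
  import Relation.Binary.PropositionalEquality as ≡
  open ≡ using (_≡_; _≢_)
  open import Relation.Nullary using (Stable; Dec; yes; no)
  open import Relation.Nullary.Negation using (contradiction)
  open RealField R
  open Topology R
  open Space
  open Map
  open Homeo
  open Solver using (solve; con; _:=_; _:+_; _:-_; :-_)
  open SemiringSum ℝ.semiring using (sum-cong-≋; sum-replicate-zero)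

  homeo-≃ : ∀ {X Y} → Homeo X Y → X ≃ Y
  homeo-≃ {X} {Y} h = record
    { to      = to h
    ; from    = from h
    ; from∘to = homotopy-by-≈ (from h ∘ᵐ to h) id (from∘to h)
    ; to∘from = homotopy-by-≈ (to h ∘ᵐ from h) id (to∘from h)
    }

  homeo-trans : ∀ {X Y Z} → Homeo X Y → Homeo Y Z → Homeo X Z
  homeo-trans {X} {Y} {Z} h k = record
    { to      = to k ∘ᵐ to h
    ; from    = from h ∘ᵐ from k
    ; from∘to = λ x i → ℝ.trans (map-cong Y X (from h) (from∘to k (fun (to h) x)) i) (from∘to h x i)
    ; to∘from = λ z i → ℝ.trans (map-cong Y Z (to k) (to∘from h (fun (from k) z)) i) (to∘from k z i)
    }

  -- Maps have to preserve basepoints to act on a wedge. Requiring strict inverses means that no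
  -- homotopy has to be controlled at the basepoint.
  infix 1 _≅_
  record _≅_ (X Y : PointedSpace) : Set where
    field
      homeo   : Homeo (space X) (space Y)
      to-base : Eq (space Y) (fun (to homeo) (basepoint X)) (basepoint Y)

    from-base : Eq (space X) (fun (from homeo) (basepoint Y)) (basepoint X)
    from-base i = ℝ.trans (ℝ.sym (map-cong (space Y) (space X) (from homeo) to-base i)) (from∘to homeo (basepoint X) i)

  open _≅_

  ≅-trans : ∀ {X Y Z} → X ≅ Y → Y ≅ Z → X ≅ Z
  ≅-trans {X} {Y} {Z} h k = record
    { homeo   = homeo-trans (homeo h) (homeo k)
    ; to-base = λ i → ℝ.trans (map-cong (space Y) (space Z) (to (homeo k)) (to-base h) i) (to-base k i)
    }

  module _ (X Y X′ Y′ : PointedSpace) where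

    private
      V V′ : Space
      V  = space (X ⋁ Y)
      V′ = space (X′ ⋁ Y′)

    left-part : Point V → Point (space X)
    left-part (z , (x∈ , _) , _) = z ∘ inj₁ , x∈

    right-part : Point V → Point (space Y)
    right-part (z , (_ , y∈) , _) = z ∘ inj₂ , y∈

    left-map : Map V (space X)
    left-map = mapOf V (space X) (proj₁ ∘ left-part) (proj₂ ∘ left-part) (λ i → cont-coord V (inj₁ i))

    right-map : Map V (space Y)
    right-map = mapOf V (space Y) (proj₁ ∘ right-part) (proj₂ ∘ right-part) (λ i → cont-coord V (inj₂ i))

    ⋁-map : (f : Map (space X) (space X′)) (g : Map (space Y) (space Y′)) →
            Eq (space X′) (fun f (basepoint X)) (basepoint X′) →
            Eq (space Y′) (fun g (basepoint Y)) (basepoint Y′) → Map V V′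
    ⋁-map f g f₀ g₀ = mapOf V V′
      (λ z → [ proj₁ (fun f (left-part z)) , proj₁ (fun g (right-part z)) ]′)
      (λ z → (proj₂ (fun f (left-part z)) , proj₂ (fun g (right-part z))) , λ k → proj₂ (proj₂ z)
        λ { (inj₁ x≈) → k (inj₁ λ i → ℝ.trans (map-cong (space X) (space X′) f {left-part z} {basepoint X} x≈ i) (f₀ i))
          ; (inj₂ y≈) → k (inj₂ λ i → ℝ.trans (map-cong (space Y) (space Y′) g {right-part z} {basepoint Y} y≈ i) (g₀ i)) })
      λ { (inj₁ i) → map-cont V (space X′) (f ∘ᵐ left-map) i ; (inj₂ j) → map-cont V (space Y′) (g ∘ᵐ right-map) j }

  ⋁-cong : ∀ {X X′ Y Y′} → X ≅ X′ → Y ≅ Y′ → X ⋁ Y ≅ X′ ⋁ Y′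
  ⋁-cong {X} {X′} {Y} {Y′} h k = record
    { homeo = record
      { to      = ⋁-map X Y X′ Y′ (to (homeo h)) (to (homeo k)) (to-base h) (to-base k)
      ; from    = ⋁-map X′ Y′ X Y (from (homeo h)) (from (homeo k)) (from-base h) (from-base k)
      ; from∘to = λ { z (inj₁ i) → from∘to (homeo h) (left-part X Y X′ Y′ z) i
                    ; z (inj₂ j) → from∘to (homeo k) (right-part X Y X′ Y′ z) j }
      ; to∘from = λ { z (inj₁ i) → to∘from (homeo h) (left-part X′ Y′ X Y z) i
                    ; z (inj₂ j) → to∘from (homeo k) (right-part X′ Y′ X Y z) j }
      }
    ; to-base = λ { (inj₁ i) → to-base h i ; (inj₂ j) → to-base k j }
    }

  full : ∀ {n} → (Fin n → ℝ) → Fin (suc n) → ℝ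
  full x = (1# - sum x) ∷ x

  full-cong : ∀ {n} {x y : Fin n → ℝ} → (∀ i → x i ≈ y i) → ∀ v → full x v ≈ full y v
  full-cong x≈y zero    = ℝ.+-congˡ (ℝ.-‿cong (sum-cong-≋ x≈y))
  full-cong x≈y (suc i) = x≈y i

  opaque
    sum-full : ∀ {n} (x : Fin n → ℝ) → sum (full x) ≈ 1#
    sum-full x = solve 1 (λ s → (con (+ 1) :- s) :+ s := con (+ 1)) ℝ.refl (sum x)

  -- The weight of the base vertex is determined by the other weights and is
  -- dropped, so that the basepoint is the origin and wedges are concatenations.
  Reduced : ∀ {n} → Faces (suc n) → Space
  Reduced {n} F = record
    { Coord  = Fin n
    ; finite = finite (∣ boundary n ∣)
    ; In     = λ x → In ∣ F ∣ (full x)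
    }

  module _ {n} (F : Faces (suc n)) where

    cont-full : ∀ v → Cont (Reduced F) (λ x → full (proj₁ x) v)
    cont-full zero    = cont-minus (Reduced F) (cont-const (Reduced F) 1#) (cont-sum (Reduced F) (cont-coord (Reduced F)))
    cont-full (suc i) = cont-coord (Reduced F) i

    opaque
      full-tail : (x : Point ∣ F ∣) → ∀ v → full (proj₁ x ∘ suc) v ≈ proj₁ x v
      full-tail (x , _ , Σx≈1 , _) zero    = ℝ.trans (ℝ.+-congʳ (ℝ.sym Σx≈1))
        (solve 2 (λ a b → (a :+ b) :- b := a) ℝ.refl (x zero) (sum (x ∘ suc)))
      full-tail x (suc i) = ℝ.refl

    reduce : Homeo ∣ F ∣ (Reduced F)
    reduce = record
      { to      = mapOf ∣ F ∣ (Reduced F) (λ x → proj₁ x ∘ suc)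
          (λ x → StableSpace.respects (stableSpace F) (λ v → ℝ.sym (full-tail x v)) (proj₂ x)) (λ i → cont-coord ∣ F ∣ (suc i))
      ; from    = mapOf (Reduced F) ∣ F ∣ (full ∘ proj₁) proj₂ cont-full
      ; from∘to = full-tail
      ; to∘from = λ x i → ℝ.refl
      }

    opaque
      origin∈ : Face F ⁅ zero ⁆ → In (Reduced F) (replicate n 0#)
      origin∈ F₀ = (λ { zero → ≤-respʳ (ℝ.sym one) (<⇒≤ 0<1) ; (suc i) → ≤-refl })
        , sum-full (replicate n 0#)
        , λ σ σ⊆ → down F (λ { {zero} _ → x∈⁅x⁆ zero ; {suc i} p → ⊥-elim (<-irrefl (σ⊆ p)) }) F₀
        where
        one : 1# - sum (replicate n 0#) ≈ 1#
        one = ℝ.trans (ℝ.+-congˡ (ℝ.-‿cong (sum-replicate-zero n))) (solve 0 (con (+ 1) :- con (+ 0) := con (+ 1)) ℝ.refl)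

    Pointed : Face F ⁅ zero ⁆ → PointedSpace
    Pointed F₀ = record { space = Reduced F ; basepoint = replicate n 0# , origin∈ F₀ }

  opaque
    sum-split : ∀ n {m} (x : Fin (n ℕ.+ m) → ℝ) → sum x ≈ sum (λ i → x (i ↑ˡ m)) + sum (λ j → x (n ↑ʳ j))
    sum-split zero    x = ℝ.sym (ℝ.+-identityˡ _)
    sum-split (suc n) x = ℝ.trans (ℝ.+-congˡ (sum-split n (x ∘ suc))) (ℝ.sym (ℝ.+-assoc _ _ _))

  opaque
    sum-zero : ∀ {n} (x : Fin n → ℝ) → (∀ i → x i ≈ 0#) → sum x ≈ 0#
    sum-zero {n} x x≈0 = ℝ.trans (sum-cong-≋ x≈0) (sum-replicate-zero n)

  module WedgeOfFaces {n m} (F : Faces (suc n)) (G : Faces (suc m)) (F₀ : Face F ⁅ zero ⁆) (G₀ : Face G ⁅ zero ⁆) where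

    FG : Faces (suc (n ℕ.+ m))
    FG = F ∨ᶠ G

    ℓ : Fin (suc n) → Fin (suc (n ℕ.+ m))
    ℓ = leftVertex n m

    r : Fin (suc m) → Fin (suc (n ℕ.+ m))
    r = rightVertex n m

    left : (Fin (n ℕ.+ m) → ℝ) → Fin n → ℝ
    left x i = x (i ↑ˡ m)

    right : (Fin (n ℕ.+ m) → ℝ) → Fin m → ℝ
    right x j = x (n ↑ʳ j)

    opaque
      base-face : Face FG ⁅ zero ⁆
      base-face =
        down F (λ {v} p → at-zeroˡ v (x∈⁅y⁆⇒x≡y zero (∈-preimage⁻ {f = ℓ} p))) F₀ ,
        down G (λ {v} p → at-zeroʳ v (x∈⁅y⁆⇒x≡y zero (∈-preimage⁻ {f = r} p))) G₀ ,
        λ i j p → contradiction (x∈⁅y⁆⇒x≡y zero p) λ ()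
        where
        at-zeroˡ : ∀ v → ℓ v ≡ zero → v ∈ ⁅ zero ⁆
        at-zeroˡ zero _ = x∈⁅x⁆ zero
        at-zeroʳ : ∀ v → r v ≡ zero → v ∈ ⁅ zero ⁆
        at-zeroʳ zero _ = x∈⁅x⁆ zero

    opaque
      -- A face of the wedge never contains vertices from both sides other than the base, so the
      -- coordinates of one side vanish; which side is known only for a given support.
      one-side : ∀ {A : Set} → Stable A → (x : Point (Reduced FG)) →
        ((∀ j → right (proj₁ x) j ≈ 0#) → A) → ((∀ i → left (proj₁ x) i ≈ 0#) → A) → A
      one-side {A} stable (x , x∈@(x≥0 , _)) f g = by-support stable (full x) λ τ s →
        decide τ s (support-face FG (full x , x∈) s) (any? λ i → suc (i ↑ˡ m) ∈? τ)
        where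
        zero-at : ∀ {τ} → Support (full x) τ → ∀ e → suc e ∉ τ → x e ≈ 0#
        zero-at s e e∉ = ≤-antisym (λ 0<x → e∉ (Support.pos⇒∈ s 0<x)) (x≥0 (suc e))
        decide : ∀ τ → Support (full x) τ → Face FG τ → Dec (∃ λ i → suc (i ↑ˡ m) ∈ τ) → A
        decide τ s (_ , _ , disjoint) (yes (i , i∈τ)) = f λ j → zero-at s (n ↑ʳ j) (disjoint i j i∈τ)
        decide τ s _                  (no none)       = g λ i → zero-at s (i ↑ˡ m) λ p → none (i , p)

    opaque
      restrict : ∀ {k} (H : Faces (suc k)) (f : Fin (suc k) → Fin (suc (n ℕ.+ m))) →
        (∀ τ → Face FG τ → Face H (preimage f τ)) → (x : Point (Reduced FG)) (y : Fin k → ℝ) →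
        (∀ v → full y v ≈ full (proj₁ x) (f v)) → In (Reduced H) y
      restrict H f FG→H (x , x∈) y y≈x =
        (λ v → ≤-respʳ (ℝ.sym (y≈x v)) (proj₁ x∈ (f v))) , sum-full y , λ σ σ⊆ →
          by-support (stable H) (full x) λ τ s → down H
            (λ {v} v∈σ → ∈-preimage⁺ {f = f} (Support.pos⇒∈ s (<-respʳ (y≈x v) (σ⊆ v∈σ)))) (FG→H τ (support-face FG (full x , x∈) s))

    opaque
      full-left : ∀ x → (∀ j → right x j ≈ 0#) → ∀ v → full (left x) v ≈ full x (ℓ v)
      full-left x right≈0 (suc i) = ℝ.refl
      full-left x right≈0 zero    = ℝ.+-congˡ (ℝ.-‿cong (ℝ.sym (ℝ.trans (sum-split n x)
        (ℝ.trans (ℝ.+-congˡ (sum-zero (right x) right≈0)) (ℝ.+-identityʳ _)))))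

    opaque
      full-right : ∀ x → (∀ i → left x i ≈ 0#) → ∀ v → full (right x) v ≈ full x (r v)
      full-right x left≈0 (suc j) = ℝ.refl
      full-right x left≈0 zero    = ℝ.+-congˡ (ℝ.-‿cong (ℝ.sym (ℝ.trans (sum-split n x)
        (ℝ.trans (ℝ.+-congʳ (sum-zero (left x) left≈0)) (ℝ.+-identityˡ _)))))

    opaque
      at-origin : ∀ {k} (H : Faces (suc k)) → Face H ⁅ zero ⁆ → ∀ x → (∀ i → x i ≈ 0#) → In (Reduced H) x
      at-origin H H₀ x x≈0 = StableSpace.respects (stableSpace H) (full-cong λ i → ℝ.sym (x≈0 i)) (origin∈ H H₀)

    opaque
      -- When the right half vanishes, the left half has the full weights of the point; when the
      -- left half vanishes, it is the origin.
      left∈ : (x : Point (Reduced FG)) → In (Reduced F) (left (proj₁ x))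
      left∈ x = one-side (StableSpace.stable (stableSpace F) _) x
        (λ right≈0 → restrict F ℓ (λ τ → proj₁) x (left (proj₁ x)) (full-left (proj₁ x) right≈0))
        (at-origin F F₀ (left (proj₁ x)))

    opaque
      right∈ : (x : Point (Reduced FG)) → In (Reduced G) (right (proj₁ x))
      right∈ x = one-side (StableSpace.stable (stableSpace G) _) x
        (at-origin G G₀ (right (proj₁ x)))
        (λ left≈0 → restrict G r (λ τ → λ (_ , g , _) → g) x (right (proj₁ x)) (full-right (proj₁ x) left≈0))

    PF PG : PointedSpace
    PF = Pointed F F₀
    PG = Pointed G G₀

    glue : (Fin n ⊎ Fin m → ℝ) → Fin (n ℕ.+ m) → ℝ
    glue z e = z (splitAt n e)

    left-glue : ∀ z i → left (glue z) i ≈ z (inj₁ i)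
    left-glue z i = ℝ.reflexive (≡.cong z (splitAt-↑ˡ n i m))

    right-glue : ∀ z j → right (glue z) j ≈ z (inj₂ j)
    right-glue z j = ℝ.reflexive (≡.cong z (splitAt-↑ʳ n m j))

    module _ (z : Fin n ⊎ Fin m → ℝ) (z∈F : In (Reduced F) (z ∘ inj₁)) (z∈G : In (Reduced G) (z ∘ inj₂)) where

      nonneg : ∀ v → 0# ≤ z v
      nonneg (inj₁ i) = proj₁ z∈F (suc i)
      nonneg (inj₂ j) = proj₁ z∈G (suc j)

      opaque
        glue∈-left : (∀ j → z (inj₂ j) ≈ 0#) → In (Reduced FG) (glue z)
        glue∈-left right≈0 = (λ { zero → ≤-respʳ (same zero) (proj₁ z∈F zero) ; (suc e) → nonneg (splitAt n e) })
          , sum-full (glue z)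
          , λ σ σ⊆ →
              proj₂ (proj₂ z∈F) (preimage ℓ σ) (λ {v} p → <-respʳ (ℝ.sym (same v)) (σ⊆ (∈-preimage⁻ {f = ℓ} p))) ,
              down G (λ { {zero} _ → x∈⁅x⁆ zero
                        ; {suc j} p → ⊥-elim (<-irrefl (<-respʳ (vanish j) (σ⊆ (∈-preimage⁻ {f = r} {i = suc j} p)))) }) G₀ ,
              λ i j p q → <-irrefl (<-respʳ (vanish j) (σ⊆ q))
          where
          vanish : ∀ j → right (glue z) j ≈ 0#
          vanish j = ℝ.trans (right-glue z j) (right≈0 j)
          same : ∀ v → full (z ∘ inj₁) v ≈ full (glue z) (ℓ v)
          same v = ℝ.trans (full-cong (λ i → ℝ.sym (left-glue z i)) v) (full-left (glue z) vanish v)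

      opaque
        glue∈-right : (∀ i → z (inj₁ i) ≈ 0#) → In (Reduced FG) (glue z)
        glue∈-right left≈0 = (λ { zero → ≤-respʳ (same zero) (proj₁ z∈G zero) ; (suc e) → nonneg (splitAt n e) })
          , sum-full (glue z)
          , λ σ σ⊆ →
              down F (λ { {zero} _ → x∈⁅x⁆ zero
                        ; {suc i} p → ⊥-elim (<-irrefl (<-respʳ (vanish i) (σ⊆ (∈-preimage⁻ {f = ℓ} {i = suc i} p)))) }) F₀ ,
              proj₂ (proj₂ z∈G) (preimage r σ) (λ {v} p → <-respʳ (ℝ.sym (same v)) (σ⊆ (∈-preimage⁻ {f = r} p))) ,
              λ i j p q → <-irrefl (<-respʳ (vanish i) (σ⊆ p))
          where
          vanish : ∀ i → left (glue z) i ≈ 0#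
          vanish i = ℝ.trans (left-glue z i) (left≈0 i)
          same : ∀ v → full (z ∘ inj₂) v ≈ full (glue z) (r v)
          same v = ℝ.trans (full-cong (λ i → ℝ.sym (right-glue z i)) v) (full-right (glue z) vanish v)

    split-glue : ∀ (x : Fin (n ℕ.+ m) → ℝ) e → [ left x , right x ]′ (splitAt n e) ≈ x e
    split-glue x e with splitAt n e in eq
    ... | inj₁ i = ℝ.reflexive (≡.cong x (splitAt⁻¹-↑ˡ {m = n} {i = e} eq))
    ... | inj₂ j = ℝ.reflexive (≡.cong x (splitAt⁻¹-↑ʳ {m = n} {i = e} eq))

    wedge-homeo : Pointed FG base-face ≅ PF ⋁ PG
    wedge-homeo = record
      { homeo = record
        { to = mapOf (Reduced FG) (space (PF ⋁ PG)) (λ x → [ left (proj₁ x) , right (proj₁ x) ]′)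
            (λ x → (left∈ x , right∈ x) , λ k → one-side {A = ⊥} (λ z → z id) x
              (λ right≈0 → k (inj₂ right≈0)) (λ left≈0 → k (inj₁ left≈0)))
            λ { (inj₁ i) → cont-coord (Reduced FG) (i ↑ˡ m) ; (inj₂ j) → cont-coord (Reduced FG) (n ↑ʳ j) }
        ; from = mapOf (space (PF ⋁ PG)) (Reduced FG) (λ z → glue (proj₁ z))
            -- The wedge says only up to double negation which half is at its basepoint, which is
            -- enough since membership in the realization is stable.
            (λ { (z , (z∈F , z∈G) , nn) → StableSpace.stable (stableSpace FG) _ λ k → nn
              λ { (inj₁ left≈0) → k (glue∈-right z z∈F z∈G left≈0) ; (inj₂ right≈0) → k (glue∈-left z z∈F z∈G right≈0) } })
            (λ e → cont-coord (space (PF ⋁ PG)) (splitAt n e))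
        ; from∘to = λ x e → split-glue (proj₁ x) e
        ; to∘from = λ { z (inj₁ i) → left-glue (proj₁ z) i ; z (inj₂ j) → right-glue (proj₁ z) j }
        }
      ; to-base = λ { (inj₁ i) → ℝ.refl ; (inj₂ j) → ℝ.refl }
      }

  module _ (d : ℕ) where
    open BoundarySphere d

    opaque
      vertex-face : Face ∂ ⁅ zero ⁆
      vertex-face all = contradiction (x∈⁅y⁆⇒x≡y zero (all one)) λ ()

    opaque
      -- Differences that already form a unit vector have norm 1, so the radial projection does not
      -- change them.
      direction-on-sphere : ∀ w (y : Point (sphere d)) → (∀ j → difference (proj₁ w) j ≈ proj₁ y j) →
                            ∀ j → direction w j ≈ proj₁ y j
      direction-on-sphere w (y , Σy²≈1) diff≈y j = ℝ.trans (ℝ.*-cong scale≈1 (diff≈y j)) (ℝ.*-identityˡ _)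
        where
        norm≈1 : norm w ≈ 1#
        norm≈1 = square-injective (norm-positive w) 0<1 (ℝ.trans (norm-square w)
          (ℝ.trans (sum-cong-≋ λ j → ℝ.*-cong (diff≈y j) (diff≈y j)) (ℝ.trans Σy²≈1 (ℝ.sym (ℝ.*-identityˡ 1#)))))
        scale≈1 : scale w ≈ 1#
        scale≈1 = ℝ.trans (ℝ.sym (ℝ.*-identityˡ _)) (ℝ.trans (ℝ.*-congʳ (ℝ.sym norm≈1)) (norm-scale w))

    pointed-sphere : Pointed ∂ vertex-face ≅ 𝕊 d
    pointed-sphere = record
      { homeo   = homeo-trans (record
          { to = from (reduce ∂) ; from = to (reduce ∂) ; from∘to = to∘from (reduce ∂) ; to∘from = from∘to (reduce ∂) })
          boundary≅sphere
      ; to-base = direction-on-sphere (fun (from (reduce ∂)) (basepoint (Pointed ∂ vertex-face))) (basepoint (𝕊 d)) λ where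
          zero    → ℝ.trans (ℝ.+-congʳ (ℝ.+-congˡ (ℝ.-‿cong (sum-replicate-zero (suc d)))))
                      (solve 0 (con (+ 1) :- con (+ 0) :- con (+ 0) := con (+ 1)) ℝ.refl)
          (suc j) → ℝ.-‿inverseʳ 0#
      }

  sphere-stable : ∀ d → StableSpace (sphere d)
  sphere-stable d = record
    { stable   = λ x → ≈-stable
    ; respects = λ x≈y Σx²≈1 → ℝ.trans (sum-cong-≋ λ i → ℝ.sym (ℝ.*-cong (x≈y i) (x≈y i))) Σx²≈1
    }

  ⋁-stable : ∀ {X Y} → StableSpace (space X) → StableSpace (space Y) → StableSpace (space (X ⋁ Y))
  ⋁-stable {X} {Y} X-stable Y-stable = record
    { stable   = λ z ¬¬z∈ →
        (stable X-stable _ (λ k → ¬¬z∈ λ ((x∈ , _) , _) → k x∈) , stable Y-stable _ (λ k → ¬¬z∈ λ ((_ , y∈) , _) → k y∈)) ,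
        λ k → ¬¬z∈ λ (_ , nn) → nn k
    ; respects = λ x≈y ((x∈ , y∈) , nn) →
        (respects X-stable (λ i → x≈y (inj₁ i)) x∈ , respects Y-stable (λ j → x≈y (inj₂ j)) y∈) ,
        λ k → nn λ { (inj₁ p) → k (inj₁ λ i → ℝ.trans (ℝ.sym (x≈y (inj₁ i))) (p i))
                   ; (inj₂ p) → k (inj₂ λ j → ℝ.trans (ℝ.sym (x≈y (inj₂ j))) (p j)) }
    }
    where open StableSpace

-- The three cases of the theorem.

module Wheels (R : RealField) where

  open Homotopies R
  open Realizations R renaming (∣_∣ to ∥_∥ᶠ)
  open SmallWheels R
  open LargeWheels R
  open BoundaryOfSimplex R
  open Wedges R
  open import Data.Fin.Base using (zero)
  open import Data.Nat.Base as ℕ using (ℕ; suc; s≤s)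
  open Topology R
  open _≅_

  wedge-of-spheres : ∀ d → ∥ boundary (suc (suc d)) ∨ᶠ boundary (suc (suc d)) ∥ᶠ ≃ space (𝕊 d ⋁ 𝕊 d)
  wedge-of-spheres d = homeo-≃ (homeo-trans (reduce (∂ ∨ᶠ ∂))
    (homeo (≅-trans wedge-homeo (⋁-cong (pointed-sphere d) (pointed-sphere d)))))
    where
    open BoundarySphere d using (∂)
    open WedgeOfFaces ∂ ∂ (vertex-face d) (vertex-face d)

  wedge-of-three-spheres : ∀ d →
    ∥ boundary (suc (suc d)) ∨ᶠ boundary (suc (suc d)) ∨ᶠ boundary (suc (suc d)) ∥ᶠ ≃ space (𝕊 d ⋁ 𝕊 d ⋁ 𝕊 d)
  wedge-of-three-spheres d = homeo-≃ (homeo-trans (reduce (∂ ∨ᶠ ∂ ∨ᶠ ∂))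
    (homeo (≅-trans Triple.wedge-homeo
      (⋁-cong (≅-trans Double.wedge-homeo (⋁-cong (pointed-sphere d) (pointed-sphere d))) (pointed-sphere d)))))
    where
    open BoundarySphere d using (∂)
    module Double = WedgeOfFaces ∂ ∂ (vertex-face d) (vertex-face d)
    module Triple = WedgeOfFaces (∂ ∨ᶠ ∂) ∂ Double.base-face (vertex-face d)

  wheel-on-4 : (4≤4 : 4 ℕ.≤ 4) → ∥ M₂ (wheel 4 4≤4) ∥ ≃ space (𝕊 2 ⋁ 𝕊 2 ⋁ 𝕊 2)
  -- The graph unfolds only after the bound is matched. What is left of the bound is passed on as a
  -- variable, on which the evaluation of faces does not get stuck.
  wheel-on-4 (s≤s 3≤3) = ≃-trans (stableSpace (matchings (cone (cycle 3 3≤3))))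
    (⋁-stable {𝕊 2 ⋁ 𝕊 2} {𝕊 2} (⋁-stable {𝕊 2} {𝕊 2} (sphere-stable 2) (sphere-stable 2)) (sphere-stable 2))
    (WheelOnFour.four 3≤3) (wedge-of-three-spheres 2)

  wheel-on-5 : (4≤5 : 4 ℕ.≤ 5) → ∥ M₂ (wheel 5 4≤5) ∥ ≃ space (𝕊 3 ⋁ 𝕊 3)
  wheel-on-5 (s≤s 3≤4) = ≃-trans (stableSpace (matchings (cone (cycle 4 3≤4))))
    (⋁-stable {𝕊 3} {𝕊 3} (sphere-stable 3) (sphere-stable 3))
    (WheelOnFive.five 3≤4) (wedge-of-spheres 3)

  wheel-on-≥6 : ∀ n (4≤n : 4 ℕ.≤ n) → 6 ℕ.≤ n → ∥ M₂ (wheel n 4≤n) ∥ ≃ point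
  wheel-on-≥6 (suc (suc k)) (s≤s 3≤k) (s≤s 5≤k) = LargeWheel.contractible (suc k) 3≤k 5≤k zero

open import Data.Nat.Base using (ℕ; _≤_)
open import Data.Product.Base using (_×_; _,_)
open import Relation.Binary.PropositionalEquality using (_≡_; refl)

mainTheorem3 : (R : RealField) → let open Topology R in
    (n : ℕ) (4≤n : 4 ≤ n) →
    (n ≡ 4 → ∥ M₂ (wheel n 4≤n) ∥ ≃ space (𝕊 2 ⋁ 𝕊 2 ⋁ 𝕊 2))
    × (n ≡ 5 → ∥ M₂ (wheel n 4≤n) ∥ ≃ space (𝕊 3 ⋁ 𝕊 3))
    × (6 ≤ n → ∥ M₂ (wheel n 4≤n) ∥ ≃ point)
mainTheorem3 R n 4≤n =
  (λ { refl → wheel-on-4 4≤n }) , (λ { refl → wheel-on-5 4≤n }) , wheel-on-≥6 n 4≤n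
  where open Wheels R
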